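{- There is an absolute constant $C>0$ such that for all sufficiently large square-free integers $d>0$, $$\sum_{r\in\mathcal{D}}2^{\omega(d)-\omega(\gcd(d,r))}\ge C d,$$ where $\mathcal{D}=\{r\in\mathbb{Z}: 0<r<\tfrac d4,\ r\text{ is a square modulo }d,\ r\neq\alpha^2+d\beta^2\text{ for all }\alpha,\beta\in\mathbb{Q}\}$.
   Context: $\omega(n)$ denotes the number of distinct prime divisors of $n$. -}

module Defs where

open import Data.Nat using (ℕ; suc; _<_; _*_; _∸_; _^_)
open import Data.Nat.Divisibility using (_∣_; _∣?_)
open import Data.Nat.Primality using (Prime; prime?)
open import Data.Nat.GCD using (gcd)
open import Data.List using (List; length; filter; upTo; map)
open import Data.Nat.ListAction using (sum)
open import Data.Product using (∃; _×_)
open import Relation.Nullary using (¬_)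
open import Relation.Nullary.Decidable using (_×-dec_)
open import Relation.Unary using (Decidable)
open import Relation.Binary.PropositionalEquality using (_≡_)
import Data.Integer as ℤ
import Data.Integer.Divisibility as ℤD
import Data.Rational as ℚ

-- ω n : number of distinct primes p dividing n (primes dividing n ≥ 1 are ≤ n)
ω : ℕ → ℕ
ω n = length (filter (λ p → prime? p ×-dec p ∣? n) (upTo (suc n)))

SquareFree : ℕ → Set
SquareFree d = ∀ p → Prime p → ¬ (p * p ∣ d)

SquareMod : ℕ → ℕ → Set
SquareMod d r = ∃ λ (x : ℤ.ℤ) → (ℤ.+ d) ℤD.∣ (x ℤ.* x ℤ.- ℤ.+ r)

RepQ : ℕ → ℕ → Set
RepQ d r = ∃ λ (α : ℚ.ℚ) → ∃ λ (β : ℚ.ℚ) →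
  (ℤ.+ r ℚ./ 1) ≡ α ℚ.* α ℚ.+ (ℤ.+ d ℚ./ 1) ℚ.* (β ℚ.* β)

InD : ℕ → ℕ → Set
InD d r = (0 < r) × (4 * r < d) × SquareMod d r × ¬ RepQ d r

weight : ℕ → ℕ → ℕ
weight d r = 2 ^ (ω d ∸ ω (gcd d r))

-- Σ_{r ∈ 𝒟} weight d r, given a decision procedure for membership in 𝒟.
-- Every element of 𝒟 is < d, so filtering [0, d) enumerates 𝒟 exactly.
SumD : (d : ℕ) → Decidable (InD d) → ℕ
SumD d dec = sum (map (weight d) (filter dec (upTo d)))

{-# OPTIONS --safe #-}
-- A residue r has at most 2^(ω(d) − ω(gcd(d,r))) square roots modulo d, so it suffices to find ≫ d
-- integers x < d for which r = x² mod d is below d/4 and is not of the form α² + dβ².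
-- Squares are equidistributed in arithmetic progressions whose length exceeds √d by a factor d^ε:
-- in the variance of the number of x with c x² in a window, the substitution y = x + u makes the
-- pair condition linear in x, and Σ_u gcd(u,d) ≤ 2^ω(d) d.
-- If d is even or d ≡ 1 mod 4, there is an obstruction at 2 on a suitable class of r modulo 8.
-- If d ≡ 3 mod 4, call an odd prime q bad if q ∣ d or −d is not a square modulo q.  A bad q ∤ d
-- exactly dividing r is an obstruction, and so is a q ∣ gcd(d,r) for half of the classes of r/q.
-- By quadratic reciprocity an odd n without bad prime factors has Jacobi symbol (n/d) = 1, and by
-- equidistribution of a x² (over the a with (a/d) = 1) this holds for at most about half of
-- the odd n < X, where X = d^(1/2+ε).  Hence Σ_{bad q < X} 1/q ≫ 1.  Chebyshev's bound removes
-- the q near √d.  Inclusion–exclusion for the q below d^(1/8), and the bounded number of larger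
-- prime factors of r, turn the remaining sum into a positive proportion of x.
module Submission where

open import Defs
open import Data.Nat
open import Data.Nat.Properties hiding (_≟_; _≤?_; _<?_)
open import Data.Nat.DivMod
open import Data.Nat.Divisibility
open import Data.Nat.Primality using (Prime; prime?; prime[2]; euclidsLemma; prime⇒nonZero; prime⇒nonTrivial; prime⇒irreducible)
open import Data.Nat.Primality.Factorisation using (factorise)
open import Data.Nat.GCD using (gcd; gcd[m,n]∣m; gcd[m,n]∣n; gcd-greatest; c*gcd[m,n]≡gcd[cm,cn]; module Bézout)
open import Data.Nat.Coprimality using (Coprime; coprime-divisor; coprime-Bézout; coprime?) renaming (sym to coprime-sym)
open import Data.Nat.Combinatorics using (_C_; nCk+nC[k+1]≡[n+1]C[k+1]; nCk≡n!/k![n-k]!; k![n∸k]!∣n!)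
open import Data.Nat.Induction using (<-rec)
open import Data.Nat.ListAction using (sum; product)
open import Data.Nat.Tactic.RingSolver using (solve-∀)
open import Data.List using ([]; _∷_; length; filter; applyUpTo; map)
open import Data.Product using (∃; ∃₂; _×_; _,_; proj₁; proj₂)
open import Data.Sum using (_⊎_; inj₁; inj₂)
open import Data.Empty using (⊥)
open import Function using (case_of_; it)
open import Relation.Nullary using (¬_; Dec; yes; no; contradiction)
open import Relation.Nullary.Decidable using (_×-dec_; _⊎-dec_; ¬?; map′)
open import Relation.Unary using (Decidable)
open import Relation.Binary.PropositionalEquality using (_≡_; _≢_; refl; sym; trans; cong; cong₂; subst; subst₂; module ≡-Reasoning)
import Data.Integer as ℤ
import Data.Integer.Properties as ℤₚ
import Data.List.Relation.Unary.All as All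
import Data.Rational as ℚ
import Data.Rational.Properties as ℚₚ
import Data.Rational.Unnormalised as ℚᵘ
import Data.Rational.Unnormalised.Properties as ℚᵘₚ

-- Finite sums and congruences

-- Why d ≡ 3 mod 4 is the hard case: for d ≡ 7 mod 8 the number -d is a square in ℚ₂, so 2 excludes
-- nothing, and no other fixed prime need be bad. The obstructions come from primes that depend on
-- d. The supply of bad primes and their use do not quite meet. The variance bound needs
-- progressions longer than κ, where κ² ≥ Σ gcd(u,d), so it yields bad primes up to X = 512 κ,
-- slightly above √d. A bad q can be used only if its multiples below d/4 again form such a
-- progression, hence for κ q ≤ d/3072, slightly below √d. The gap consists of O(ω(d) + 1) dyadic
-- blocks near √d, each with at most O(1/log d) of the sum of 1/q; it is negligible because ω(d) =
-- o(log d). The usable part of Σ 1/q may sit on one prime or be spread over many.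
-- Inclusion-exclusion succeeds only for a sum small enough that the pair terms stay below the main
-- term, so the sum is cut at an initial segment of suitable size, and a single dominant prime is
-- treated by itself. All estimates stay in ℕ: ⌊X/q⌋ stands for X/q, and the accuracy of the
-- variance bound, 281 against the expected 256, is what leaves a positive supply.

∑ : ℕ → (ℕ → ℕ) → ℕ
∑ zero    f = 0
∑ (suc n) f = ∑ n f + f n

𝟙 : ∀ {p} {P : Set p} → Dec P → ℕ
𝟙 (yes _) = 1
𝟙 (no _)  = 0

-- Reduces a polynomial inequality to a ring identity: s is the slack.
≤-by : ∀ {l r A B} s → l ≤ r → A + r + s ≡ B + l → A ≤ B
≤-by {l} {r} {A} {B} s l≤r eq = +-cancelʳ-≤ l A B (begin
  A + l  ≤⟨ +-monoʳ-≤ A l≤r ⟩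
  A + r  ≤⟨ m≤m+n (A + r) s ⟩
  A + r + s  ≡⟨ eq ⟩
  B + l  ∎)
  where open ≤-Reasoning

module _ {p} {P : Set p} where
  𝟙≤1 : (P? : Dec P) → 𝟙 P? ≤ 1
  𝟙≤1 (yes _) = ≤-refl
  𝟙≤1 (no _)  = z≤n

  𝟙-yes : (P? : Dec P) → P → 𝟙 P? ≡ 1
  𝟙-yes (yes _) _ = refl
  𝟙-yes (no ¬p) p = contradiction p ¬p

  𝟙-no : (P? : Dec P) → ¬ P → 𝟙 P? ≡ 0
  𝟙-no (yes p) ¬p = contradiction p ¬p
  𝟙-no (no _)  _  = refl

  𝟙-elim : (P? : Dec P) {m : ℕ} → (P → 1 ≤ m) → 𝟙 P? ≤ m
  𝟙-elim (yes p) f = f p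
  𝟙-elim (no _)  f = z≤n

𝟙-mono : ∀ {p q} {P : Set p} {Q : Set q} (P? : Dec P) (Q? : Dec Q) → (P → Q) → 𝟙 P? ≤ 𝟙 Q?
𝟙-mono P? Q? f = 𝟙-elim P? (λ p → ≤-reflexive (sym (𝟙-yes Q? (f p))))

∑-cong : ∀ n {f g : ℕ → ℕ} → (∀ i → i < n → f i ≡ g i) → ∑ n f ≡ ∑ n g
∑-cong zero    h = refl
∑-cong (suc n) h = cong₂ _+_ (∑-cong n (λ i i<n → h i (m<n⇒m<1+n i<n))) (h n ≤-refl)

∑-mono : ∀ n {f g : ℕ → ℕ} → (∀ i → i < n → f i ≤ g i) → ∑ n f ≤ ∑ n g
∑-mono zero    h = z≤n
∑-mono (suc n) h = +-mono-≤ (∑-mono n (λ i i<n → h i (m<n⇒m<1+n i<n))) (h n ≤-refl)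

∑-const : ∀ n c → ∑ n (λ _ → c) ≡ n * c
∑-const zero    c = refl
∑-const (suc n) c = trans (cong (_+ c) (∑-const n c)) (+-comm (n * c) c)

∑-≤const : ∀ n {f : ℕ → ℕ} c → (∀ i → i < n → f i ≤ c) → ∑ n f ≤ n * c
∑-≤const n c h = ≤-trans (∑-mono n h) (≤-reflexive (∑-const n c))

∑-≥const : ∀ n {f : ℕ → ℕ} c → (∀ i → i < n → c ≤ f i) → n * c ≤ ∑ n f
∑-≥const n c h = ≤-trans (≤-reflexive (sym (∑-const n c))) (∑-mono n h)

∑-zero : ∀ n {f : ℕ → ℕ} → (∀ i → i < n → f i ≡ 0) → ∑ n f ≡ 0
∑-zero n h = trans (∑-cong n h) (trans (∑-const n 0) (*-zeroʳ n))

∑-+ : ∀ n (f g : ℕ → ℕ) → ∑ n (λ i → f i + g i) ≡ ∑ n f + ∑ n g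
∑-+ zero    f g = refl
∑-+ (suc n) f g = trans (cong (_+ (f n + g n)) (∑-+ n f g)) (lem (∑ n f) (∑ n g) (f n) (g n))
  where lem : ∀ a b c d → a + b + (c + d) ≡ a + c + (b + d)
        lem = solve-∀

∑-*ˡ : ∀ n c (f : ℕ → ℕ) → ∑ n (λ i → c * f i) ≡ c * ∑ n f
∑-*ˡ zero    c f = sym (*-zeroʳ c)
∑-*ˡ (suc n) c f = trans (cong (_+ c * f n) (∑-*ˡ n c f)) (sym (*-distribˡ-+ c (∑ n f) (f n)))

∑-*ʳ : ∀ n c (f : ℕ → ℕ) → ∑ n (λ i → f i * c) ≡ ∑ n f * c
∑-*ʳ n c f = trans (∑-cong n (λ i _ → *-comm (f i) c)) (trans (∑-*ˡ n c f) (*-comm c (∑ n f)))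

∑-swap : ∀ n m (f : ℕ → ℕ → ℕ) → ∑ n (λ i → ∑ m (f i)) ≡ ∑ m (λ j → ∑ n (λ i → f i j))
∑-swap zero    m f = sym (∑-zero m (λ _ _ → refl))
∑-swap (suc n) m f = trans (cong (_+ ∑ m (f n)) (∑-swap n m f)) (sym (∑-+ m (λ j → ∑ n (λ i → f i j)) (f n)))

∑-split : ∀ m n (f : ℕ → ℕ) → ∑ (m + n) f ≡ ∑ m f + ∑ n (λ i → f (m + i))
∑-split m zero    f = trans (cong (λ k → ∑ k f) (+-identityʳ m)) (sym (+-identityʳ _))
∑-split m (suc n) f = trans (cong (λ k → ∑ k f) (+-suc m n))
  (trans (cong (_+ f (m + n)) (∑-split m n f)) (+-assoc (∑ m f) (∑ n (λ i → f (m + i))) (f (m + n))))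

∑-blocks : ∀ k m (f : ℕ → ℕ) → ∑ (k * m) f ≡ ∑ k (λ j → ∑ m (λ i → f (j * m + i)))
∑-blocks zero    m f = refl
∑-blocks (suc k) m f = trans (cong (λ n → ∑ n f) (+-comm m (k * m)))
  (trans (∑-split (k * m) m f) (cong (_+ ∑ m (λ i → f (k * m + i))) (∑-blocks k m f)))

∑-range : ∀ {m n} (f : ℕ → ℕ) → m ≤ n → ∑ m f ≤ ∑ n f
∑-range {m} {n} f m≤n = subst (λ k → ∑ m f ≤ ∑ k f) (m+[n∸m]≡n m≤n)
  (≤-trans (m≤m+n (∑ m f) _) (≤-reflexive (sym (∑-split m (n ∸ m) f))))

∑-term : ∀ {n i} (f : ℕ → ℕ) → i < n → f i ≤ ∑ n f
∑-term {n} {i} f i<n = ≤-trans (m≤n+m (f i) (∑ i f)) (∑-range f i<n)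

𝟙≤∑ : ∀ {p q} {P : Set p} {Q : ℕ → Set q} (P? : Dec P) n (Q? : ∀ i → Dec (Q i)) →
  (P → ∃ λ i → i < n × Q i) → 𝟙 P? ≤ ∑ n (λ i → 𝟙 (Q? i))
𝟙≤∑ P? n Q? h = 𝟙-elim P? λ p → let i , i<n , q = h p in
  ≤-trans (≤-reflexive (sym (𝟙-yes (Q? i) q))) (∑-term (λ i → 𝟙 (Q? i)) i<n)

∑𝟙≤1 : ∀ {p} {P : ℕ → Set p} n (P? : ∀ i → Dec (P i)) →
  (∀ {i j} → i < n → j < n → P i → P j → i ≡ j) → ∑ n (λ i → 𝟙 (P? i)) ≤ 1
∑𝟙≤1 zero    P? h = z≤n
∑𝟙≤1 (suc n) P? h with P? n
... | no _  = ≤-trans (≤-reflexive (+-identityʳ _)) (∑𝟙≤1 n P? (λ a b → h (m<n⇒m<1+n a) (m<n⇒m<1+n b)))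
... | yes p = ≤-reflexive (cong (_+ 1) (∑-zero n
    (λ i i<n → 𝟙-no (P? i) (λ q → <⇒≢ i<n (h (m<n⇒m<1+n i<n) ≤-refl q p)))))

∑-inj : ∀ n m (π f : ℕ → ℕ) → (∀ i → i < n → π i < m) →
  (∀ {i j} → i < n → j < n → π i ≡ π j → i ≡ j) → ∑ n (λ i → f (π i)) ≤ ∑ m f
∑-inj n m π f π< inj = begin
  ∑ n (λ i → f (π i))  ≤⟨ ∑-mono n (λ i i<n → at i i<n) ⟩
  ∑ n (λ i → ∑ m (λ y → f y * 𝟙 (π i ≟ y)))  ≡⟨ ∑-swap n m (λ i y → f y * 𝟙 (π i ≟ y)) ⟩
  ∑ m (λ y → ∑ n (λ i → f y * 𝟙 (π i ≟ y)))  ≤⟨ ∑-mono m (λ y _ → fibre y) ⟩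
  ∑ m f  ∎
  where
  open ≤-Reasoning
  at : ∀ i → i < n → f (π i) ≤ ∑ m (λ y → f y * 𝟙 (π i ≟ y))
  at i i<n = ≤-trans (≤-reflexive (sym (trans (cong (f (π i) *_) (𝟙-yes (π i ≟ π i) refl)) (*-identityʳ _))))
                     (∑-term (λ y → f y * 𝟙 (π i ≟ y)) (π< i i<n))
  fibre : ∀ y → ∑ n (λ i → f y * 𝟙 (π i ≟ y)) ≤ f y
  fibre y = begin
    ∑ n (λ i → f y * 𝟙 (π i ≟ y))  ≡⟨ ∑-*ˡ n (f y) (λ i → 𝟙 (π i ≟ y)) ⟩
    f y * ∑ n (λ i → 𝟙 (π i ≟ y))  ≤⟨ *-monoʳ-≤ (f y) (∑𝟙≤1 n (λ i → π i ≟ y) (λ a b p q → inj a b (trans p (sym q)))) ⟩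
    f y * 1  ≡⟨ *-identityʳ (f y) ⟩
    f y  ∎

-- An injection of a finite set into itself is onto. No inverse is constructed: `∑-inj` is applied
-- to `f` and to its complement `c ∸ f`, and the two sums add up to `n * c` before and after `π`.
∑-perm : ∀ n c (π f : ℕ → ℕ) → (∀ x → x < n → f x ≤ c) → (∀ i → i < n → π i < n) →
  (∀ {i j} → i < n → j < n → π i ≡ π j → i ≡ j) → ∑ n (λ i → f (π i)) ≡ ∑ n f
∑-perm n c π f f≤c π< inj = ≤-antisym (∑-inj n n π f π< inj)
  (+-cancelʳ-≤ (∑ n (λ i → c ∸ f (π i))) _ _ (begin
    ∑ n f + ∑ n (λ i → c ∸ f (π i))  ≤⟨ +-monoʳ-≤ (∑ n f) (∑-inj n n π (λ x → c ∸ f x) π< inj) ⟩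
    ∑ n f + ∑ n (λ i → c ∸ f i)  ≡⟨ total f f≤c ⟩
    n * c  ≡⟨ total (λ i → f (π i)) (λ i i<n → f≤c (π i) (π< i i<n)) ⟨
    ∑ n (λ i → f (π i)) + ∑ n (λ i → c ∸ f (π i))  ∎))
  where
  open ≤-Reasoning
  total : (g : ℕ → ℕ) → (∀ x → x < n → g x ≤ c) → ∑ n g + ∑ n (λ i → c ∸ g i) ≡ n * c
  total g g≤c = trans (sym (∑-+ n g (λ i → c ∸ g i)))
    (trans (∑-cong n (λ i i<n → m+[n∸m]≡n (g≤c i i<n))) (∑-const n c))

infix 4 _≈_[_] _≈?_[_]

-- A multiple of `m` on either side avoids subtraction and makes symmetry immediate; for `m = 0` the
-- relation is equality.
record _≈_[_] (a b m : ℕ) : Set where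
  no-eta-equality
  pattern
  constructor mk≈
  field
    {i j} : ℕ
    eq    : a + i * m ≡ b + j * m

module _ {m : ℕ} where
  ≈-reflexive : ∀ {a b} → a ≡ b → a ≈ b [ m ]
  ≈-reflexive refl = mk≈ {i = 0} {0} refl

  ≈-refl : ∀ {a} → a ≈ a [ m ]
  ≈-refl = ≈-reflexive refl

  ≈-sym : ∀ {a b} → a ≈ b [ m ] → b ≈ a [ m ]
  ≈-sym (mk≈ {i} {j} p) = mk≈ {i = j} {i} (sym p)

  ≈-trans : ∀ {a b c} → a ≈ b [ m ] → b ≈ c [ m ] → a ≈ c [ m ]
  ≈-trans {a} {b} {c} (mk≈ {i} {j} p) (mk≈ {k} {l} q) = mk≈ {i = i + k} {l + j} (begin
    a + (i + k) * m  ≡⟨ l1 a i k m ⟩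
    (a + i * m) + k * m  ≡⟨ cong (_+ k * m) p ⟩
    (b + j * m) + k * m  ≡⟨ l2 b j k m ⟩
    (b + k * m) + j * m  ≡⟨ cong (_+ j * m) q ⟩
    (c + l * m) + j * m  ≡⟨ l1 c l j m ⟨
    c + (l + j) * m  ∎)
    where
    open ≡-Reasoning
    l1 : ∀ a i k m → a + (i + k) * m ≡ (a + i * m) + k * m
    l1 = solve-∀
    l2 : ∀ a i k m → (a + i * m) + k * m ≡ (a + k * m) + i * m
    l2 = solve-∀

  ≈-+ : ∀ {a b c d} → a ≈ b [ m ] → c ≈ d [ m ] → a + c ≈ b + d [ m ]
  ≈-+ {a} {b} {c} {d} (mk≈ {i} {j} p) (mk≈ {k} {l} q) = mk≈ {i = i + k} {j + l}
    (trans (l1 a c i k m) (trans (cong₂ _+_ p q) (sym (l1 b d j l m))))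
    where
    l1 : ∀ a c i k m → a + c + (i + k) * m ≡ (a + i * m) + (c + k * m)
    l1 = solve-∀

  ≈-*ˡ : ∀ k {a b} → a ≈ b [ m ] → k * a ≈ k * b [ m ]
  ≈-*ˡ k {a} {b} (mk≈ {i} {j} p) = mk≈ {i = k * i} {k * j}
    (trans (l1 k a i m) (trans (cong (k *_) p) (sym (l1 k b j m))))
    where
    l1 : ∀ k a i m → k * a + k * i * m ≡ k * (a + i * m)
    l1 = solve-∀

  ≈-*ʳ : ∀ k {a b} → a ≈ b [ m ] → a * k ≈ b * k [ m ]
  ≈-*ʳ k {a} {b} p = subst₂ (_≈_[ m ]) (*-comm k a) (*-comm k b) (≈-*ˡ k p)

  ≈-* : ∀ {a b c d} → a ≈ b [ m ] → c ≈ d [ m ] → a * c ≈ b * d [ m ]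
  ≈-* {b = b} {c} p q = ≈-trans (≈-*ʳ c p) (≈-*ˡ b q)

  ≈-+cancelʳ : ∀ {a b c d} → c ≈ d [ m ] → a + c ≈ b + d [ m ] → a ≈ b [ m ]
  ≈-+cancelʳ {a} {b} {c} {d} (mk≈ {i} {j} p) (mk≈ {k} {l} q) = mk≈ {i = k + j} {l + i}
    (+-cancelʳ-≡ (c + d) _ _ (begin
      a + (k + j) * m + (c + d)  ≡⟨ l1 a c d k j m ⟩
      (a + c + k * m) + (d + j * m)  ≡⟨ cong₂ _+_ q (sym p) ⟩
      (b + d + l * m) + (c + i * m)  ≡⟨ l2 b c d l i m ⟩
      b + (l + i) * m + (c + d)  ∎))
    where
    open ≡-Reasoning
    l1 : ∀ a c d k j m → a + (k + j) * m + (c + d) ≡ (a + c + k * m) + (d + j * m)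
    l1 = solve-∀
    l2 : ∀ b c d l i m → (b + d + l * m) + (c + i * m) ≡ b + (l + i) * m + (c + d)
    l2 = solve-∀

  ≈-+cancelˡ : ∀ {a b} c → c + a ≈ c + b [ m ] → a ≈ b [ m ]
  ≈-+cancelˡ {a} {b} c p = ≈-+cancelʳ {a} {b} {c} {c} ≈-refl (subst₂ (_≈_[ m ]) (+-comm c a) (+-comm c b) p)

  ≈-+m : ∀ a k → a + k * m ≈ a [ m ]
  ≈-+m a k = mk≈ {i = 0} {k} (+-identityʳ _)

  ∣⇒≈0 : ∀ {a} → m ∣ a → a ≈ 0 [ m ]
  ∣⇒≈0 (divides q refl) = ≈-+m 0 q

  ≈0⇒∣ : ∀ {a} → a ≈ 0 [ m ] → m ∣ a
  ≈0⇒∣ {a} (mk≈ {i} {j} p) = ∣m+n∣m⇒∣n {m} {i * m} {a} (divides j (trans (+-comm (i * m) a) p)) (n∣m*n i)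

  ≈⇒∣ : ∀ {a b} → a ≈ b [ m ] → m ∣ a → m ∣ b
  ≈⇒∣ p d = ≈0⇒∣ (≈-trans (≈-sym p) (∣⇒≈0 d))

≈-∣ : ∀ {m n a b} → n ∣ m → a ≈ b [ m ] → a ≈ b [ n ]
≈-∣ {m} {n} {a} {b} (divides q refl) (mk≈ {i} {j} p) = mk≈ {i = i * q} {j * q}
  (trans (cong (a +_) (*-assoc i q n)) (trans p (cong (b +_) (sym (*-assoc j q n)))))

≈-cancel-≥ : ∀ {m a b} k → Coprime m k → b ≤ a → k * a ≈ k * b [ m ] → a ≈ b [ m ]
≈-cancel-≥ {m} {a} {b} k cop b≤a p = subst₂ (_≈_[ m ]) (m+[n∸m]≡n b≤a) (+-identityʳ b) (≈-+ (≈-refl {a = b})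
  (∣⇒≈0 (coprime-divisor cop (≈0⇒∣ (≈-+cancelˡ (k * b) (subst₂ (_≈_[ m ])
    (trans (cong (k *_) (sym (m+[n∸m]≡n b≤a))) (*-distribˡ-+ k b (a ∸ b))) (sym (+-identityʳ (k * b))) p))))))

≈-cancel : ∀ {m a b} k → Coprime m k → k * a ≈ k * b [ m ] → a ≈ b [ m ]
≈-cancel {m} {a} {b} k cop p with ≤-total b a
... | inj₁ b≤a = ≈-cancel-≥ k cop b≤a p
... | inj₂ a≤b = ≈-sym (≈-cancel-≥ k cop a≤b (≈-sym p))

≈⇒% : ∀ {m a b} .{{_ : NonZero m}} → a ≈ b [ m ] → a % m ≡ b % m
≈⇒% {m} {a} {b} (mk≈ {i} {j} p) = trans (sym ([m+kn]%n≡m%n a i m)) (trans (cong (_% m) p) ([m+kn]%n≡m%n b j m))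

%-≈ : ∀ a m .{{_ : NonZero m}} → a % m ≈ a [ m ]
%-≈ a m = mk≈ {i = a / m} {0} (trans (sym (m≡m%n+[m/n]*n a m)) (sym (+-identityʳ a)))

%⇒≈ : ∀ {m a b} .{{_ : NonZero m}} → a % m ≡ b % m → a ≈ b [ m ]
%⇒≈ {m} {a} {b} p = ≈-trans (≈-sym (%-≈ a m)) (≈-trans (≈-reflexive p) (%-≈ b m))

≈-< : ∀ {m a b} → a < m → b < m → a ≈ b [ m ] → a ≡ b
≈-< {suc m} a< b< p = trans (sym (m<n⇒m%n≡m a<)) (trans (≈⇒% p) (m<n⇒m%n≡m b<))

_≈?_[_] : ∀ a b m → Dec (a ≈ b [ m ])
a ≈? b [ zero ]  = map′ ≈-reflexive
  (λ (mk≈ {i} {j} p) → trans (sym (trans (cong (a +_) (*-zeroʳ i)) (+-identityʳ a)))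
    (trans p (trans (cong (b +_) (*-zeroʳ j)) (+-identityʳ b)))) (a ≟ b)
a ≈? b [ suc m ] = map′ %⇒≈ ≈⇒% (a % suc m ≟ b % suc m)

-- At most one member of a residue class in each block of m consecutive integers.
∑𝟙-class : ∀ {p} {P : ℕ → Set p} n m k (P? : ∀ i → Dec (P i)) → n ≤ k * m →
  (∀ {i j} → P i → P j → i ≈ j [ m ]) → ∑ n (λ i → 𝟙 (P? i)) ≤ k
∑𝟙-class n m k P? n≤ h = begin
  ∑ n (λ i → 𝟙 (P? i))  ≤⟨ ∑-range (λ i → 𝟙 (P? i)) n≤ ⟩
  ∑ (k * m) (λ i → 𝟙 (P? i))  ≡⟨ ∑-blocks k m (λ i → 𝟙 (P? i)) ⟩
  ∑ k (λ j → ∑ m (λ i → 𝟙 (P? (j * m + i))))  ≤⟨ ∑-≤const k 1 (λ j _ → ∑𝟙≤1 m (λ i → P? (j * m + i))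
                                                     (λ a b p q → ≈-< a b (≈-+cancelˡ (j * m) (h p q)))) ⟩
  k * 1  ≡⟨ *-identityʳ k ⟩
  k  ∎
  where open ≤-Reasoning

inverse : ∀ {m} k .{{_ : NonZero m}} → Coprime m k → ∃ λ k̄ → k * k̄ ≈ 1 [ m ]
inverse {m} k cop with coprime-Bézout cop
-- Here `1 + y * k ≡ x * m`: the inverse is `- y`, with `m ∸ 1` in the role of -1.
... | Bézout.+- x y p = y * (m ∸ 1) , mk≈ {i = x} {y * k} (begin
      k * (y * (m ∸ 1)) + x * m  ≡⟨ cong (k * (y * (m ∸ 1)) +_) (sym p) ⟩
      k * (y * (m ∸ 1)) + (1 + y * k)  ≡⟨ lem k y (m ∸ 1) ⟩
      1 + y * k * (1 + (m ∸ 1))  ≡⟨ cong (λ z → 1 + y * k * z) (m+[n∸m]≡n {1} {m} (>-nonZero⁻¹ m)) ⟩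
      1 + y * k * m  ∎)
  where
  open ≡-Reasoning
  lem : ∀ k y z → k * (y * z) + (1 + y * k) ≡ 1 + y * k * (1 + z)
  lem = solve-∀
... | Bézout.-+ x y p = y , mk≈ {i = 0} {x} (trans (+-identityʳ _) (trans (*-comm k y) (sym p)))

-- Equidistribution of c x² in progressions

𝟙-× : ∀ {p q} {P : Set p} {Q : Set q} (P? : Dec P) (Q? : Dec Q) → 𝟙 P? * 𝟙 Q? ≡ 𝟙 (P? ×-dec Q?)
𝟙-× (yes _) (yes _) = refl
𝟙-× (yes _) (no _)  = refl
𝟙-× (no _)  _       = refl

∑-product : ∀ n m (f g : ℕ → ℕ) → ∑ n f * ∑ m g ≡ ∑ n (λ i → ∑ m (λ j → f i * g j))
∑-product n m f g = trans (sym (∑-*ʳ n (∑ m g) f)) (∑-cong n (λ i _ → sym (∑-*ˡ m (f i) g)))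

dist²-+ : ∀ b c → ∣ b + c - b ∣ * ∣ b + c - b ∣ + 2 * (b * (b + c)) ≡ (b + c) * (b + c) + b * b
dist²-+ b c rewrite ∣-∣-comm (b + c) b | ∣m-m+n∣≡n b c = lem b c
  where lem : ∀ b c → c * c + 2 * (b * (b + c)) ≡ (b + c) * (b + c) + b * b
        lem = solve-∀

dist² : ∀ a b → ∣ a - b ∣ * ∣ a - b ∣ + 2 * (b * a) ≡ a * a + b * b
dist² a b with ≤-total b a
... | inj₁ b≤a = subst (λ x → ∣ x - b ∣ * ∣ x - b ∣ + 2 * (b * x) ≡ x * x + b * b) (m+[n∸m]≡n b≤a) (dist²-+ b (a ∸ b))
... | inj₂ a≤b = trans (cong₂ (λ x y → x * x + 2 * y) (∣-∣-comm a b) (*-comm b a))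
  (trans (subst (λ x → ∣ x - a ∣ * ∣ x - a ∣ + 2 * (a * x) ≡ x * x + a * a) (m+[n∸m]≡n a≤b) (dist²-+ a (b ∸ a))) (+-comm (b * b) (a * a)))

am-gm : ∀ a b → 2 * (b * a) ≤ a * a + b * b
am-gm a b = ≤-trans (m≤n+m _ (∣ a - b ∣ * ∣ a - b ∣)) (≤-reflexive (dist² a b))

≤-+dist : ∀ a b → a ≤ b + ∣ a - b ∣
≤-+dist a b = ≤-trans (m≤∣m-n∣+n a b) (≤-reflexive (+-comm ∣ a - b ∣ b))

gcd-split : ∀ u e .{{_ : NonZero e}} → ∃₂ λ u′ e′ → u ≡ gcd u e * u′ × e ≡ gcd u e * e′ × Coprime e′ u′
gcd-split u e with gcd[m,n]∣m u e | gcd[m,n]∣n u e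
... | divides u′ p | divides e′ q = u′ , e′ , trans p (*-comm u′ g) , trans q (*-comm e′ g) , λ {d} (d∣e′ , d∣u′) →
  ∣1⇒≡1 (*-cancelʳ-∣ g (subst (d * g ∣_) (sym (*-identityˡ g))
    (gcd-greatest {u} {e} (subst (d * g ∣_) (sym p) (*-monoˡ-∣ g d∣u′)) (subst (d * g ∣_) (sym q) (*-monoˡ-∣ g d∣e′)))))
  where
  g = gcd u e
  instance g≢0 : NonZero g
           g≢0 = ≢-nonZero (λ g≡0 → ≢-nonZero⁻¹ e (trans q (trans (cong (e′ *_) g≡0) (*-zeroʳ e′))))

≈-scale⁻¹ : ∀ g {a b m} .{{_ : NonZero g}} → g * a ≈ g * b [ g * m ] → a ≈ b [ m ]
≈-scale⁻¹ g {a} {b} {m} (mk≈ {i} {j} p) = mk≈ {i = i} {j} (*-cancelˡ-≡ (a + i * m) (b + j * m) g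
  (trans (sym (lem g a i m)) (trans p (lem g b j m))))
  where lem : ∀ g a i m → g * a + i * (g * m) ≡ g * (a + i * m)
        lem = solve-∀

-- `m ∸ 1` is -1 modulo `m`, so `x + s * (m ∸ 1)` is `x - s`; the moment computations subtract
-- residues in this form.
≈-neg : ∀ {m} .{{_ : NonZero m}} x s → x + s * (m ∸ 1) + s ≈ x [ m ]
≈-neg {m} x s = mk≈ {i = 0} {s} (trans (lem x s (m ∸ 1)) (cong (λ z → x + s * z) (m+[n∸m]≡n (>-nonZero⁻¹ m))))
  where lem : ∀ x s z → x + s * z + s + 0 * (1 + z) ≡ x + s * (1 + z)
        lem = solve-∀

-- Pillai's arithmetical function. `H` times it bounds the variance of the window counts below.
∑gcd : ℕ → ℕ
∑gcd e = ∑ e (λ u → gcd u e)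

-- The coefficient `c` will be a residue of Jacobi symbol 1 in the supply of bad primes, `q` after a
-- prime `q ∣ d` has been divided out, and 1 otherwise.
#sols : (e c k s a : ℕ) → ℕ
#sols e c k s a = ∑ e (λ x → 𝟙 (c * (x * x) ≈? k * a + s [ e ]))

module Equidistribution (e c k : ℕ) .{{_ : NonZero e}}
  (e⊥2 : Coprime e 2) (e⊥c : Coprime e c) (e⊥k : Coprime e k) where

  N : ℕ → ℕ → ℕ
  N = #sols e c k

  -- Each `x` is counted at the `a` that solves the linear congruence. Only this direction is
  -- proved, because the first moment enters the variance with a negative sign.
  first-moment : ∀ s h → e ≤ ∑ e (λ a → N s (a + h))
  first-moment s h = begin
    e  ≡⟨ *-identityʳ e ⟨
    e * 1  ≤⟨ ∑-≥const e 1 (λ x _ → hit x) ⟩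
    ∑ e (λ x → ∑ e (λ a → 𝟙 (c * (x * x) ≈? k * (a + h) + s [ e ])))
                                   ≡⟨ ∑-swap e e (λ x a → 𝟙 (c * (x * x) ≈? k * (a + h) + s [ e ])) ⟩
    ∑ e (λ a → N s (a + h))  ∎
    where
    open ≤-Reasoning
    k̄ = proj₁ (inverse {e} k e⊥k)
    hit : ∀ x → 1 ≤ ∑ e (λ a → 𝟙 (c * (x * x) ≈? k * (a + h) + s [ e ]))
    hit x = ≤-trans (≤-reflexive (sym (𝟙-yes (c * (x * x) ≈? k * (a₀ + h) + s [ e ]) sol)))
                    (∑-term (λ a → 𝟙 (c * (x * x) ≈? k * (a + h) + s [ e ])) (m%n<n _ e))
      where
      z = c * (x * x) + s * (e ∸ 1)
      a₀ = (k̄ * z + h * (e ∸ 1)) % e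
      sol : c * (x * x) ≈ k * (a₀ + h) + s [ e ]
      sol = ≈-sym (≈-trans (≈-+ (≈-trans (≈-*ˡ k (≈-trans (≈-+ (%-≈ _ e) ≈-refl) (≈-neg (k̄ * z) h)))
              (≈-trans (≈-reflexive (sym (*-assoc k k̄ z))) (≈-trans (≈-*ʳ z (proj₂ (inverse {e} k e⊥k))) (≈-reflexive (*-identityˡ z))))) (≈-refl {a = s}))
              (≈-neg (c * (x * x)) s))

  -- Substituting y = x + u makes the pair condition linear in x, of modulus e / gcd u e.
  correlation : ∀ s h h′ → ∑ e (λ a → N s (a + h) * N s (a + h′)) ≤ ∑ e (λ u → gcd u e * 𝟙 (h ≈? h′ [ gcd u e ]))
  correlation s h h′ = begin
    ∑ e (λ a → N s (a + h) * N s (a + h′))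
      ≡⟨ ∑-cong e (λ a _ → ∑-product e e (λ x → 𝟙 (P? h x a)) (λ y → 𝟙 (P? h′ y a))) ⟩
    ∑ e (λ a → ∑ e (λ x → ∑ e (λ y → F x y a)))
      ≡⟨ ∑-swap e e (λ a x → ∑ e (λ y → F x y a)) ⟩
    ∑ e (λ x → ∑ e (λ a → ∑ e (λ y → F x y a)))
      ≡⟨ ∑-cong e (λ x _ → ∑-swap e e (λ a y → F x y a)) ⟩
    ∑ e (λ x → ∑ e (λ y → ∑ e (F x y)))
      ≤⟨ ∑-mono e (λ x _ → ∑-mono e (λ y _ → shift x y)) ⟩
    ∑ e (λ x → ∑ e (λ y → 𝟙 (Q? x ((y + x * (e ∸ 1)) % e))))
      ≤⟨ ∑-mono e (λ x _ → ∑-inj e e (λ y → (y + x * (e ∸ 1)) % e) (λ u → 𝟙 (Q? x u)) (λ y _ → m%n<n _ e)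
          (λ y< y′< p → ≈-< y< y′< (≈-+cancelʳ ≈-refl (%⇒≈ p)))) ⟩
    ∑ e (λ x → ∑ e (λ u → 𝟙 (Q? x u)))
      ≡⟨ ∑-swap e e (λ x u → 𝟙 (Q? x u)) ⟩
    ∑ e (λ u → ∑ e (λ x → 𝟙 (Q? x u)))
      ≤⟨ ∑-mono e (λ u _ → count u) ⟩
    ∑ e (λ u → gcd u e * 𝟙 (h ≈? h′ [ gcd u e ])) ∎
    where
    open ≤-Reasoning
    P? : ∀ h x a → Dec (c * (x * x) ≈ k * (a + h) + s [ e ])
    P? h x a = c * (x * x) ≈? k * (a + h) + s [ e ]
    F : ℕ → ℕ → ℕ → ℕ
    F x y a = 𝟙 (P? h x a) * 𝟙 (P? h′ y a)
    Q : ℕ → ℕ → Set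
    Q x u = c * (x * x) + k * h′ ≈ c * ((u + x) * (u + x)) + k * h [ e ]
    Q? : ∀ x u → Dec (Q x u)
    Q? x u = _ ≈? _ [ e ]
    -- The first congruence determines `a`, so a pair `x`, `y` is counted at most once; eliminating
    -- `a` between the two congruences leaves `Q` at `u = y - x`.
    shift : ∀ x y → ∑ e (F x y) ≤ 𝟙 (Q? x ((y + x * (e ∸ 1)) % e))
    shift x y with Q? x ((y + x * (e ∸ 1)) % e)
    ... | yes _ = begin
      ∑ e (F x y)  ≡⟨ ∑-cong e (λ a _ → 𝟙-× (P? h x a) (P? h′ y a)) ⟩
      ∑ e (λ a → 𝟙 (P? h x a ×-dec P? h′ y a))  ≤⟨ ∑𝟙≤1 e (λ a → P? h x a ×-dec P? h′ y a)
        (λ a< a′< (p , _) (q , _) → ≈-< a< a′< (≈-+cancelʳ (≈-refl {a = h}) (≈-cancel k e⊥k (≈-+cancelʳ (≈-refl {a = s}) (≈-trans (≈-sym p) q))))) ⟩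
      1  ∎
    ... | no ¬q = ≤-reflexive (∑-zero e (λ a _ → trans (𝟙-× (P? h x a) (P? h′ y a))
        (𝟙-no (P? h x a ×-dec P? h′ y a) (λ (p , q) → ¬q (≈-trans (pair a p q) (≈-+ (≈-*ˡ c (≈-* back back)) ≈-refl))))))
      where
      back : y ≈ (y + x * (e ∸ 1)) % e + x [ e ]
      back = ≈-sym (≈-trans (≈-+ (%-≈ _ e) ≈-refl) (≈-neg y x))
      pair : ∀ a → c * (x * x) ≈ k * (a + h) + s [ e ] → c * (y * y) ≈ k * (a + h′) + s [ e ] → c * (x * x) + k * h′ ≈ c * (y * y) + k * h [ e ]
      pair a p q = ≈-trans (≈-+ p ≈-refl) (≈-trans (≈-reflexive (lem k a s h h′)) (≈-+ (≈-sym q) ≈-refl))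
        where lem : ∀ k a s h h′ → k * (a + h) + s + k * h′ ≡ k * (a + h′) + s + k * h
              lem = solve-∀
    expand : ∀ x u → c * ((u + x) * (u + x)) + k * h ≡ c * (x * x) + (u * ((c * 2) * x) + (u * (c * u) + k * h))
    expand x u = lem c x u (k * h)
      where lem : ∀ c x u z → c * ((u + x) * (u + x)) + z ≡ c * (x * x) + (u * ((c * 2) * x) + (u * (c * u) + z))
            lem = solve-∀
    linear : ∀ x u → Q x u → k * h′ ≈ u * ((c * 2) * x) + (u * (c * u) + k * h) [ e ]
    linear x u q = ≈-+cancelˡ (c * (x * x)) (≈-trans q (≈-reflexive (expand x u)))
    e⊥2c : Coprime e (c * 2)
    e⊥2c {d} (d∣e , d∣2c) = e⊥2 (d∣e , coprime-divisor (λ {f} (f∣d , f∣c) → e⊥c (∣-trans f∣d d∣e , f∣c)) d∣2c)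
    -- Modulo `gcd u e` the terms with `u` vanish and leave `k h′ ≡ k h`, so there is no solution
    -- unless `h ≡ h′`. If there is one, the solutions form a single class modulo `e / gcd u e`,
    -- with `gcd u e` members.
    count : ∀ u → ∑ e (λ x → 𝟙 (Q? x u)) ≤ gcd u e * 𝟙 (h ≈? h′ [ gcd u e ])
    count u with h ≈? h′ [ gcd u e ]
    ... | no ¬p = ≤-trans (≤-reflexive (∑-zero e (λ x _ → 𝟙-no (Q? x u) (λ q → ¬p (≈-sym (≈-cancel k
            (λ (d∣g , d∣k) → e⊥k (∣-trans d∣g (gcd[m,n]∣n u e) , d∣k))
            (≈-trans (≈-∣ (gcd[m,n]∣n u e) (linear x u q))
              (≈-+ (∣⇒≈0 (∣m⇒∣m*n _ (gcd[m,n]∣m u e))) (≈-+ (∣⇒≈0 (∣m⇒∣m*n _ (gcd[m,n]∣m u e))) ≈-refl))))))))) z≤n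
    ... | yes _ = ≤-trans (by-gcd (gcd-split u e)) (≤-reflexive (sym (*-identityʳ _)))
      where
      by-gcd : (∃₂ λ u′ e′ → u ≡ gcd u e * u′ × e ≡ gcd u e * e′ × Coprime e′ u′) → ∑ e (λ x → 𝟙 (Q? x u)) ≤ gcd u e
      by-gcd (u′ , e′ , u≡ , e≡ , cop) = ∑𝟙-class e e′ (gcd u e) (λ x → Q? x u) (≤-reflexive e≡) same
        where
        instance g≢0 : NonZero (gcd u e)
                 g≢0 = ≢-nonZero (λ g≡0 → ≢-nonZero⁻¹ e (trans e≡ (cong (_* e′) g≡0)))
        scale : ∀ z → u * z ≡ gcd u e * (u′ * z)
        scale z = trans (cong (_* z) u≡) (*-assoc (gcd u e) u′ z)
        same : ∀ {x y} → Q x u → Q y u → x ≈ y [ e′ ]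
        same {x} {y} p q = ≈-cancel (c * 2) (λ (d∣e′ , d∣2c) → e⊥2c (∣-trans d∣e′ (divides (gcd u e) e≡) , d∣2c))
          (≈-cancel u′ cop (≈-scale⁻¹ (gcd u e) {m = e′} (subst (λ m → gcd u e * (u′ * ((c * 2) * x)) ≈ gcd u e * (u′ * ((c * 2) * y)) [ m ]) e≡
            (subst₂ (_≈_[ e ]) (scale ((c * 2) * x)) (scale ((c * 2) * y)) (≈-+cancelʳ ≈-refl (≈-trans (≈-sym (linear x u p)) (linear y u q)))))))

  module _ (H s : ℕ) where
    W : ℕ → ℕ
    W a = ∑ H (λ h → N s (a + h))

    D : ℕ → ℕ
    D a = ∣ W a - H ∣

    ∑W : H * e ≤ ∑ e W
    ∑W = ≤-trans (∑-≥const H e (λ h _ → first-moment s h)) (≤-reflexive (∑-swap H e (λ h a → N s (a + h))))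

    -- Each `h` has at most `1 + H / g` partners. Summed over `u`, the `H` of `H + g` becomes the
    -- main term `e H²` and the `g` becomes the error `H * ∑gcd e`.
    congruent-pairs : ∀ g .{{_ : NonZero g}} → ∑ H (λ h → ∑ H (λ h′ → g * 𝟙 (h ≈? h′ [ g ]))) ≤ H * (H + g)
    congruent-pairs g = ∑-≤const H (H + g) (λ h _ → begin
      ∑ H (λ h′ → g * 𝟙 (h ≈? h′ [ g ]))  ≡⟨ ∑-*ˡ H g (λ h′ → 𝟙 (h ≈? h′ [ g ])) ⟩
      g * ∑ H (λ h′ → 𝟙 (h ≈? h′ [ g ]))  ≤⟨ *-monoʳ-≤ g (∑𝟙-class H g (1 + H / g) (λ h′ → h ≈? h′ [ g ]) H≤ (λ p q → ≈-trans (≈-sym p) q)) ⟩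
      g * (1 + H / g)  ≡⟨ lem g (H / g) ⟩
      H / g * g + g  ≤⟨ +-monoˡ-≤ g (m/n*n≤m H g) ⟩
      H + g  ∎)
      where
      open ≤-Reasoning
      lem : ∀ g q → g * (1 + q) ≡ q * g + g
      lem = solve-∀
      H≤ : H ≤ (1 + H / g) * g
      H≤ = ≤-trans (≤-reflexive (m≡m%n+[m/n]*n H g)) (+-monoˡ-≤ (H / g * g) (<⇒≤ (m%n<n H g)))

    second-moment : ∑ e (λ a → W a * W a) ≤ e * (H * H) + H * ∑gcd e
    second-moment = begin
      ∑ e (λ a → W a * W a)
        ≡⟨ ∑-cong e (λ a _ → ∑-product H H (λ h → N s (a + h)) (λ h → N s (a + h))) ⟩
      ∑ e (λ a → ∑ H (λ h → ∑ H (λ h′ → F h h′ a)))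
        ≡⟨ ∑-swap e H (λ a h → ∑ H (λ h′ → F h h′ a)) ⟩
      ∑ H (λ h → ∑ e (λ a → ∑ H (λ h′ → F h h′ a)))
        ≡⟨ ∑-cong H (λ h _ → ∑-swap e H (λ a h′ → F h h′ a)) ⟩
      ∑ H (λ h → ∑ H (λ h′ → ∑ e (F h h′)))
        ≤⟨ ∑-mono H (λ h _ → ∑-mono H (λ h′ _ → correlation s h h′)) ⟩
      ∑ H (λ h → ∑ H (λ h′ → ∑ e (R h h′)))
        ≡⟨ ∑-cong H (λ h _ → ∑-swap H e (R h)) ⟩
      ∑ H (λ h → ∑ e (λ u → ∑ H (λ h′ → R h h′ u)))
        ≡⟨ ∑-swap H e (λ h u → ∑ H (λ h′ → R h h′ u)) ⟩
      ∑ e (λ u → ∑ H (λ h → ∑ H (λ h′ → R h h′ u)))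
        ≤⟨ ∑-mono e (λ u _ → congruent-pairs (gcd u e) {{g≢0 u}}) ⟩
      ∑ e (λ u → H * (H + gcd u e))
        ≡⟨ ∑-*ˡ e H (λ u → H + gcd u e) ⟩
      H * ∑ e (λ u → H + gcd u e)
        ≡⟨ cong (H *_) (∑-+ e (λ _ → H) (λ u → gcd u e)) ⟩
      H * (∑ e (λ _ → H) + ∑gcd e)
        ≡⟨ cong (λ z → H * (z + ∑gcd e)) (∑-const e H) ⟩
      H * (e * H + ∑gcd e)
        ≡⟨ lem H e (∑gcd e) ⟩
      e * (H * H) + H * ∑gcd e ∎
      where
      open ≤-Reasoning
      lem : ∀ H e z → H * (e * H + z) ≡ e * (H * H) + H * z
      lem = solve-∀
      F : ℕ → ℕ → ℕ → ℕ
      F h h′ a = N s (a + h) * N s (a + h′)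
      R : ℕ → ℕ → ℕ → ℕ
      R h h′ u = gcd u e * 𝟙 (h ≈? h′ [ gcd u e ])
      g≢0 : ∀ u → NonZero (gcd u e)
      g≢0 u = ≢-nonZero (λ p → ≢-nonZero⁻¹ e (0∣⇒≡0 (subst (_∣ e) p (gcd[m,n]∣n u e))))

    variance : ∑ e (λ a → D a * D a) ≤ H * ∑gcd e
    variance = ≤-by {l = 2 * (H * (H * e)) + ∑ e (λ a → W a * W a)} 0
      (+-mono-≤ (*-monoʳ-≤ 2 (*-monoʳ-≤ H ∑W)) second-moment) (begin
      ∑ e (λ a → D a * D a) + (2 * (H * ∑ e W) + (e * (H * H) + H * ∑gcd e)) + 0
        ≡⟨ lem₁ (∑ e (λ a → D a * D a)) (2 * (H * ∑ e W)) (e * (H * H) + H * ∑gcd e) ⟩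
      (∑ e (λ a → D a * D a) + 2 * (H * ∑ e W)) + (e * (H * H) + H * ∑gcd e)
        ≡⟨ cong (_+ (e * (H * H) + H * ∑gcd e)) total ⟩
      (∑ e (λ a → W a * W a) + e * (H * H)) + (e * (H * H) + H * ∑gcd e)
        ≡⟨ lem₂ (∑ e (λ a → W a * W a)) H e (∑gcd e) ⟩
      H * ∑gcd e + (2 * (H * (H * e)) + ∑ e (λ a → W a * W a)) ∎)
      where
      open ≡-Reasoning
      lem₁ : ∀ a b c → a + (b + c) + 0 ≡ (a + b) + c
      lem₁ = solve-∀
      lem₂ : ∀ w H e g → (w + e * (H * H)) + (e * (H * H) + H * g) ≡ H * g + (2 * (H * (H * e)) + w)
      lem₂ = solve-∀
      total : ∑ e (λ a → D a * D a) + 2 * (H * ∑ e W) ≡ ∑ e (λ a → W a * W a) + e * (H * H)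
      total = begin
        ∑ e (λ a → D a * D a) + 2 * (H * ∑ e W)
          ≡⟨ cong (λ z → ∑ e (λ a → D a * D a) + z) (trans (cong (2 *_) (sym (∑-*ˡ e H W))) (sym (∑-*ˡ e 2 (λ a → H * W a)))) ⟩
        ∑ e (λ a → D a * D a) + ∑ e (λ a → 2 * (H * W a))
          ≡⟨ ∑-+ e (λ a → D a * D a) (λ a → 2 * (H * W a)) ⟨
        ∑ e (λ a → D a * D a + 2 * (H * W a))
          ≡⟨ ∑-cong e (λ a _ → dist² (W a) H) ⟩
        ∑ e (λ a → W a * W a + H * H)
          ≡⟨ ∑-+ e (λ a → W a * W a) (λ _ → H * H) ⟩
        ∑ e (λ a → W a * W a) + ∑ e (λ _ → H * H)
          ≡⟨ cong (∑ e (λ a → W a * W a) +_) (∑-const e (H * H)) ⟩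
        ∑ e (λ a → W a * W a) + e * (H * H) ∎

    -- AM-GM, `2 κ D ≤ D² + κ²`, takes the place of Cauchy-Schwarz and avoids square roots. The
    -- variance over all residues also bounds its part over an initial segment. When `n` and `H` are
    -- fixed multiples of `κ`, the main term `n H` and the total deviation both have order `κ²`, and
    -- the multiples decide between them.
    deviation : ∀ κ n → n ≤ e → ∑gcd e ≤ κ * κ → 2 * (κ * ∑ n D) ≤ H * (κ * κ) + n * (κ * κ)
    deviation κ n n≤e G≤ = begin
      2 * (κ * ∑ n D)  ≡⟨ trans (cong (2 *_) (sym (∑-*ˡ n κ D))) (sym (∑-*ˡ n 2 (λ a → κ * D a))) ⟩
      ∑ n (λ a → 2 * (κ * D a))  ≤⟨ ∑-mono n (λ a _ → am-gm (D a) κ) ⟩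
      ∑ n (λ a → D a * D a + κ * κ)  ≡⟨ ∑-+ n (λ a → D a * D a) (λ _ → κ * κ) ⟩
      ∑ n (λ a → D a * D a) + ∑ n (λ _ → κ * κ)  ≡⟨ cong (∑ n (λ a → D a * D a) +_) (∑-const n (κ * κ)) ⟩
      ∑ n (λ a → D a * D a) + n * (κ * κ)  ≤⟨ +-monoˡ-≤ (n * (κ * κ)) (≤-trans (∑-range (λ a → D a * D a) n≤e) (≤-trans variance (*-monoʳ-≤ H G≤))) ⟩
      H * (κ * κ) + n * (κ * κ)  ∎
      where open ≤-Reasoning

  module _ (κ : ℕ) .{{_ : NonZero κ}} (G≤ : ∑gcd e ≤ κ * κ) (κ≤e : 272 * κ ≤ e) where
    private H = 16 * κ

    scaled-deviation : ∀ s m → m * κ ≤ e → 2 * ∑ (m * κ) (D H s) ≤ (16 + m) * (κ * κ)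
    scaled-deviation s m m≤ = *-cancelˡ-≤ κ (begin
      κ * (2 * ∑ (m * κ) (D H s))  ≡⟨ lem₁ κ (∑ (m * κ) (D H s)) ⟩
      2 * (κ * ∑ (m * κ) (D H s))  ≤⟨ deviation H s κ (m * κ) m≤ G≤ ⟩
      16 * κ * (κ * κ) + m * κ * (κ * κ)  ≡⟨ lem₂ κ m ⟩
      κ * ((16 + m) * (κ * κ))  ∎)
      where
      open ≤-Reasoning
      lem₁ : ∀ κ z → κ * (2 * z) ≡ 2 * (κ * z)
      lem₁ = solve-∀
      lem₂ : ∀ κ m → 16 * κ * (κ * κ) + m * κ * (κ * κ) ≡ κ * ((16 + m) * (κ * κ))
      lem₂ = solve-∀

    -- Windows of length `16 κ` that start in `[0, 240 κ)` stay inside `[0, 256 κ)`. Averaging over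
    -- the starts gives `240 κ` less the total deviation `128 κ²` divided by `16 κ`, that is
    -- `232 κ`.
    lower : ∀ s → 232 * κ ≤ ∑ (256 * κ) (N s)
    lower s = *-cancelˡ-≤ (32 * κ) {{m*n≢0 32 κ}} (≤-by {l = 2 * ∑ n (D H s) + 2 * (n * H)} {r = 256 * (κ * κ) + 2 * (H * ∑ (256 * κ) (N s) + ∑ n (D H s))} 0
        (+-mono-≤ (scaled-deviation s 240 (≤-trans (*-monoˡ-≤ κ (m≤m+n 240 32)) κ≤e)) (*-monoʳ-≤ 2 below))
        (lem κ (∑ n (D H s)) (∑ (256 * κ) (N s))))
      where
      open ≤-Reasoning
      n = 240 * κ
      lem : ∀ κ z t → 32 * κ * (232 * κ) + (256 * (κ * κ) + 2 * (16 * κ * t + z)) + 0 ≡ 32 * κ * t + (2 * z + 2 * (240 * κ * (16 * κ)))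
      lem = solve-∀
      below : n * H ≤ H * ∑ (256 * κ) (N s) + ∑ n (D H s)
      below = begin
        n * H  ≤⟨ ∑-≥const n H (λ a _ → ≤-trans (≤-+dist H (W H s a)) (≤-reflexive (cong (W H s a +_) (∣-∣-comm H (W H s a))))) ⟩
        ∑ n (λ a → W H s a + D H s a)  ≡⟨ ∑-+ n (W H s) (D H s) ⟩
        ∑ n (W H s) + ∑ n (D H s)  ≡⟨ cong (_+ ∑ n (D H s)) (∑-swap n H (λ a h → N s (a + h))) ⟩
        ∑ H (λ h → ∑ n (λ a → N s (a + h))) + ∑ n (D H s) ≤⟨ +-monoˡ-≤ (∑ n (D H s)) (∑-≤const H (∑ (256 * κ) (N s)) window) ⟩
        H * ∑ (256 * κ) (N s) + ∑ n (D H s)  ∎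
        where
        window : ∀ h → h < H → ∑ n (λ a → N s (a + h)) ≤ ∑ (256 * κ) (N s)
        window h h<H = begin
          ∑ n (λ a → N s (a + h))  ≡⟨ ∑-cong n (λ a _ → cong (N s) (+-comm a h)) ⟩
          ∑ n (λ a → N s (h + a))  ≤⟨ m≤n+m _ (∑ h (N s)) ⟩
          ∑ h (N s) + ∑ n (λ a → N s (h + a)) ≡⟨ ∑-split h n (N s) ⟨
          ∑ (h + n) (N s)  ≤⟨ ∑-range (N s) (≤-trans (+-monoˡ-≤ n (<⇒≤ h<H)) (≤-reflexive (sym (*-distribʳ-+ κ 16 240)))) ⟩
          ∑ (256 * κ) (N s)  ∎

    -- Conversely, after a shift by `H` every point of the range is covered by all the `16 κ`
    -- positions in a window, with starts in `[0, 272 κ)`. The deviation `144 κ²` divided by `16 κ`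
    -- adds `9 κ`, and `272 + 9 = 281`.
    upper : ∀ s → ∑ (256 * κ) (N s) ≤ 281 * κ
    upper s = *-cancelˡ-≤ (32 * κ) {{m*n≢0 32 κ}} (≤-by {l = 2 * ∑ n (D H s′) + 2 * (H * ∑ (256 * κ) (N s))} {r = 288 * (κ * κ) + 2 * (n * H + ∑ n (D H s′))} 0
        (+-mono-≤ (scaled-deviation s′ 272 κ≤e) (*-monoʳ-≤ 2 above))
        (lem κ (∑ n (D H s′)) (∑ (256 * κ) (N s))))
      where
      open ≤-Reasoning
      n = 272 * κ
      -- The progression moved back by `H` steps, so that windows beginning before the range still
      -- have starts in ℕ.
      s′ = s + k * H * (e ∸ 1)
      lem : ∀ κ z t → 32 * κ * t + (288 * (κ * κ) + 2 * (272 * κ * (16 * κ) + z)) + 0 ≡ 32 * κ * (281 * κ) + (2 * z + 2 * (16 * κ * t))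
      lem = solve-∀
      shifted : ∀ j → N s j ≤ N s′ (H + j)
      shifted j = ∑-mono e (λ x _ → 𝟙-mono (_ ≈? _ [ e ]) (_ ≈? _ [ e ])
        (λ p → ≈-trans p (≈-sym (≈-trans (≈-reflexive (lem′ k H j s (e ∸ 1))) (≈-neg (k * j + s) (k * H))))))
        where lem′ : ∀ k H j s z → k * (H + j) + (s + k * H * z) ≡ k * j + s + k * H * z + k * H
              lem′ = solve-∀
      above : H * ∑ (256 * κ) (N s) ≤ n * H + ∑ n (D H s′)
      above = begin
        H * ∑ (256 * κ) (N s)  ≤⟨ ∑-≥const H (∑ (256 * κ) (N s)) window ⟩
        ∑ H (λ h → ∑ n (λ a → N s′ (a + h)))  ≡⟨ ∑-swap n H (λ a h → N s′ (a + h)) ⟨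
        ∑ n (W H s′)  ≤⟨ ∑-mono n (λ a _ → ≤-+dist (W H s′ a) H) ⟩
        ∑ n (λ a → H + D H s′ a)  ≡⟨ ∑-+ n (λ _ → H) (D H s′) ⟩
        ∑ n (λ _ → H) + ∑ n (D H s′)  ≡⟨ cong (_+ ∑ n (D H s′)) (∑-const n H) ⟩
        n * H + ∑ n (D H s′)  ∎
        where
        window : ∀ h → h < H → ∑ (256 * κ) (N s) ≤ ∑ n (λ a → N s′ (a + h))
        window h h<H = begin
          ∑ (256 * κ) (N s)  ≤⟨ ∑-mono (256 * κ) (λ j _ → shifted j) ⟩
          ∑ (256 * κ) (λ j → N s′ (H + j))  ≡⟨ ∑-cong (256 * κ) (λ j _ → cong (N s′) (reindex j)) ⟩
          ∑ (256 * κ) (λ j → N s′ ((H ∸ h + j) + h))  ≤⟨ m≤n+m _ (∑ (H ∸ h) (λ a → N s′ (a + h))) ⟩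
          ∑ (H ∸ h) (λ a → N s′ (a + h)) + ∑ (256 * κ) (λ j → N s′ ((H ∸ h + j) + h)) ≡⟨ ∑-split (H ∸ h) (256 * κ) (λ a → N s′ (a + h)) ⟨
          ∑ (H ∸ h + 256 * κ) (λ a → N s′ (a + h))  ≤⟨ ∑-range (λ a → N s′ (a + h)) (≤-trans (+-monoˡ-≤ (256 * κ) (m∸n≤m H h)) (≤-reflexive (sym (*-distribʳ-+ κ 16 256)))) ⟩
          ∑ n (λ a → N s′ (a + h))  ∎
          where
          reindex : ∀ j → H + j ≡ (H ∸ h + j) + h
          reindex j = trans (cong (_+ j) (sym (m∸n+n≡m (<⇒≤ h<H)))) (lem₃ (H ∸ h) h j)
            where lem₃ : ∀ a h j → a + h + j ≡ a + j + h
                  lem₃ = solve-∀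

    private
      reindex : ∀ s j i → N (s + k * (j * (256 * κ))) i ≡ N s (j * (256 * κ) + i)
      reindex s j i = cong (λ z → ∑ e (λ x → 𝟙 (c * (x * x) ≈? z [ e ]))) (lem k i s (j * (256 * κ)))
        where lem : ∀ k i s z → k * i + (s + k * z) ≡ k * (z + i) + s
              lem = solve-∀

    -- A later block of the progression is the first block for another offset, and `lower` is
    -- uniform in the offset.
    lower* : ∀ s m → m * (232 * κ) ≤ ∑ (m * (256 * κ)) (N s)
    lower* s m = ≤-trans
      (∑-≥const m (232 * κ) (λ j _ → ≤-trans (lower (s + k * (j * (256 * κ)))) (≤-reflexive (∑-cong (256 * κ) (λ i _ → reindex s j i)))))
      (≤-reflexive (sym (∑-blocks m (256 * κ) (N s))))

    upper* : ∀ s m → ∑ (m * (256 * κ)) (N s) ≤ m * (281 * κ)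
    upper* s m = ≤-trans (≤-reflexive (∑-blocks m (256 * κ) (N s)))
      (∑-≤const m (281 * κ) (λ j _ → ≤-trans (≤-reflexive (∑-cong (256 * κ) (λ i _ → sym (reindex s j i)))) (upper (s + k * (j * (256 * κ))))))

-- Prime divisors, square roots and the weight

2^-cancel-≤ : ∀ {m n} → 2 ^ m ≤ 2 ^ n → m ≤ n
2^-cancel-≤ {m} {n} h = ≮⇒≥ (λ n<m → <⇒≱ (^-monoʳ-< 2 (s<s z<s) n<m) h)

∑-head : ∀ n (f : ℕ → ℕ) → ∑ (suc n) f ≡ f 0 + ∑ n (λ i → f (suc i))
∑-head n f = ∑-split 1 n f

length-filter-applyUpTo : ∀ {p} {P : ℕ → Set p} (P? : Decidable P) (f : ℕ → ℕ) n →
  length (filter P? (applyUpTo f n)) ≡ ∑ n (λ i → 𝟙 (P? (f i)))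
length-filter-applyUpTo P? f zero    = refl
length-filter-applyUpTo P? f (suc n) rewrite ∑-head n (λ i → 𝟙 (P? (f i))) with P? (f 0)
... | yes _ = cong suc (length-filter-applyUpTo P? (λ i → f (suc i)) n)
... | no _  = length-filter-applyUpTo P? (λ i → f (suc i)) n

sum-filter-applyUpTo : ∀ {p} {P : ℕ → Set p} (w : ℕ → ℕ) (P? : Decidable P) (f : ℕ → ℕ) n →
  sum (map w (filter P? (applyUpTo f n))) ≡ ∑ n (λ i → 𝟙 (P? (f i)) * w (f i))
sum-filter-applyUpTo w P? f zero    = refl
sum-filter-applyUpTo w P? f (suc n) rewrite ∑-head n (λ i → 𝟙 (P? (f i)) * w (f i)) with P? (f 0)
... | yes _ = cong₂ _+_ (sym (+-identityʳ _)) (sum-filter-applyUpTo w P? (λ i → f (suc i)) n)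
... | no _  = sum-filter-applyUpTo w P? (λ i → f (suc i)) n

∑𝟙-witness : ∀ {p} {P : ℕ → Set p} n (P? : ∀ i → Dec (P i)) → ∑ n (λ i → 𝟙 (P? i)) ≡ 0 ⊎ (∃ λ i → i < n × P i)
∑𝟙-witness zero    P? = inj₁ refl
∑𝟙-witness (suc n) P? with P? n | ∑𝟙-witness n P?
... | yes p | _                    = inj₂ (n , ≤-refl , p)
... | no _  | inj₁ z               = inj₁ (trans (+-identityʳ _) z)
... | no _  | inj₂ (i , i<n , p)   = inj₂ (i , m<n⇒m<1+n i<n , p)

∑-insert : ∀ n {p} c (f g : ℕ → ℕ) → p < n → (∀ q → f q ≤ g q) → f p + c ≤ g p → ∑ n f + c ≤ ∑ n g
∑-insert n {p} c f g p<n f≤g fp = begin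
  ∑ n f + c  ≡⟨ cong (∑ n f +_) (trans (sym (*-identityʳ c)) (cong (c *_) (sym (𝟙-yes (p ≟ p) refl)))) ⟩
  ∑ n f + c * 𝟙 (p ≟ p)  ≤⟨ +-monoʳ-≤ (∑ n f) (∑-term (λ q → c * 𝟙 (p ≟ q)) p<n) ⟩
  ∑ n f + ∑ n (λ q → c * 𝟙 (p ≟ q))  ≡⟨ ∑-+ n f (λ q → c * 𝟙 (p ≟ q)) ⟨
  ∑ n (λ q → f q + c * 𝟙 (p ≟ q))  ≤⟨ ∑-mono n (λ q _ → at q) ⟩
  ∑ n g  ∎
  where
  open ≤-Reasoning
  at : ∀ q → f q + c * 𝟙 (p ≟ q) ≤ g q
  at q with p ≟ q
  ... | yes refl = ≤-trans (≤-reflexive (cong (f q +_) (*-identityʳ c))) fp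
  ... | no _     = ≤-trans (≤-reflexive (trans (cong (f q +_) (*-zeroʳ c)) (+-identityʳ _))) (f≤g q)

∃prime∣ : ∀ n → 1 < n → ∃ λ p → Prime p × p ∣ n
∃prime∣ n 1<n with factorise n {{>-nonZero (<-trans z<s 1<n)}}
... | record { factors = []    ; isFactorisation = eq } = contradiction (sym eq) (<⇒≢ 1<n)
... | record { factors = p ∷ ps ; isFactorisation = eq ; factorsPrime = pp All.∷ _ } = p , pp , divides (product ps) (trans eq (*-comm p _))

prime∤⇒coprime : ∀ {p e} → Prime p → ¬ (p ∣ e) → Coprime p e
prime∤⇒coprime pp p∤e (d∣p , d∣e) with prime⇒irreducible pp d∣p
... | inj₁ d≡1  = d≡1
... | inj₂ refl = contradiction d∣e p∤e

prime>1 : ∀ {p} → Prime p → 1 < p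
prime>1 {p} pp = nonTrivial⇒n>1 p {{prime⇒nonTrivial pp}}

squarefree-divisor : ∀ {e d} → e ∣ d → SquareFree d → SquareFree e
squarefree-divisor e∣d sf p pp h = sf p pp (∣-trans h e∣d)

squarefree-coprime : ∀ {e p} → Prime p → SquareFree (e * p) → Coprime p e
squarefree-coprime {e} {p} pp sf = prime∤⇒coprime pp (λ p∣e → sf p pp (*-monoˡ-∣ p p∣e))

squarefree-induction : (P : ℕ → Set) → P 1 →
  (∀ p e → Prime p → Coprime p e → 0 < e → SquareFree (e * p) → P e → P (e * p)) →
  ∀ d → 0 < d → SquareFree d → P d
squarefree-induction P base step = <-rec _ go
  where
  go : ∀ d → (∀ {e} → e < d → 0 < e → SquareFree e → P e) → 0 < d → SquareFree d → P d
  go 1 rec _ _ = base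
  go d@(suc (suc _)) rec 0<d sf with ∃prime∣ d (s<s z<s)
  ... | p , pp , divides e d≡ = subst P (sym d≡) (step p e pp (squarefree-coprime pp sf′) 0<e sf′
          (rec e<d 0<e (squarefree-divisor (divides p (trans d≡ (*-comm e p))) sf)))
    where
    sf′ : SquareFree (e * p)
    sf′ = subst SquareFree d≡ sf
    0<e : 0 < e
    0<e = n≢0⇒n>0 (λ e≡0 → <⇒≢ 0<d (sym (trans d≡ (cong (_* p) e≡0))))
    e<d : e < d
    e<d = subst (e <_) (sym d≡) (m<m*n e p {{>-nonZero 0<e}} (prime>1 pp))

-- `ω` with a range independent of `n`, so that the counts for `e` and `e * p` can be compared term
-- by term.
primes : ℕ → ℕ → ℕ
primes B n = ∑ B (λ q → 𝟙 (prime? q ×-dec q ∣? n))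

ω≡primes : ∀ n → ω n ≡ primes (suc n) n
ω≡primes n = length-filter-applyUpTo (λ p → prime? p ×-dec p ∣? n) (λ i → i) (suc n)

-- Half of the Chinese remainder theorem is enough: for a fixed residue `i` modulo `p`, the map
-- `j ↦ (j p + i) % e` is injective.
∑-crt : ∀ p e .{{_ : NonZero e}} (F f g : ℕ → ℕ) → Coprime e p →
  (∀ i j → i < p → F (j * p + i) ≤ f i * g ((j * p + i) % e)) → ∑ (e * p) F ≤ ∑ p f * ∑ e g
∑-crt p e F f g cop F≤ = begin
  ∑ (e * p) F  ≡⟨ ∑-blocks e p F ⟩
  ∑ e (λ j → ∑ p (λ i → F (j * p + i)))  ≡⟨ ∑-swap e p (λ j i → F (j * p + i)) ⟩
  ∑ p (λ i → ∑ e (λ j → F (j * p + i)))  ≤⟨ ∑-mono p (λ i i<p → row i i<p) ⟩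
  ∑ p (λ i → f i * ∑ e g)  ≡⟨ ∑-*ʳ p (∑ e g) f ⟩
  ∑ p f * ∑ e g  ∎
  where
  open ≤-Reasoning
  row : ∀ i → i < p → ∑ e (λ j → F (j * p + i)) ≤ f i * ∑ e g
  row i i<p = begin
    ∑ e (λ j → F (j * p + i))  ≤⟨ ∑-mono e (λ j _ → F≤ i j i<p) ⟩
    ∑ e (λ j → f i * g ((j * p + i) % e))  ≡⟨ ∑-*ˡ e (f i) (λ j → g ((j * p + i) % e)) ⟩
    f i * ∑ e (λ j → g ((j * p + i) % e))  ≤⟨ *-monoʳ-≤ (f i) (∑-inj e e (λ j → (j * p + i) % e) g (λ j _ → m%n<n _ e)
      (λ {j} {j′} j< j′< q → ≈-< j< j′< (≈-cancel p cop (subst₂ (_≈_[ e ]) (*-comm j p) (*-comm j′ p) (≈-+cancelʳ (≈-refl {a = i}) (%⇒≈ q)))))) ⟩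
    f i * ∑ e g  ∎

gcd≢0 : ∀ u e .{{_ : NonZero e}} → NonZero (gcd u e)
gcd≢0 u e = ≢-nonZero (λ p → ≢-nonZero⁻¹ e (0∣⇒≡0 (subst (_∣ e) p (gcd[m,n]∣n u e))))

-- The exact factor at a new prime is `2 p - 1`. Allowing `1 + p` in place of `p` at the multiples
-- of `p` rounds it to `2 p`.
∑gcd-step : ∀ p e .{{_ : NonZero e}} → Prime p → Coprime p e → ∑gcd (e * p) ≤ 2 * p * ∑gcd e
∑gcd-step p e pp cop = ≤-trans (∑-crt p e (λ u → gcd u (e * p)) (λ i → 1 + p * 𝟙 (p ∣? i)) (λ z → gcd z e) (coprime-sym cop) bound)
  (*-monoˡ-≤ (∑gcd e) (begin
    ∑ p (λ i → 1 + p * 𝟙 (p ∣? i))  ≡⟨ ∑-+ p (λ _ → 1) (λ i → p * 𝟙 (p ∣? i)) ⟩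
    ∑ p (λ _ → 1) + ∑ p (λ i → p * 𝟙 (p ∣? i))  ≡⟨ cong₂ _+_ (∑-const p 1) (∑-*ˡ p p (λ i → 𝟙 (p ∣? i))) ⟩
    p * 1 + p * ∑ p (λ i → 𝟙 (p ∣? i))  ≤⟨ +-monoʳ-≤ (p * 1) (*-monoʳ-≤ p (∑𝟙-class p p 1 (p ∣?_) (≤-reflexive (sym (+-identityʳ p)))
                                                     (λ a b → ≈-trans (∣⇒≈0 a) (≈-sym (∣⇒≈0 b))))) ⟩
    p * 1 + p * 1  ≡⟨ lem p ⟩
    2 * p  ∎))
  where
  open ≤-Reasoning
  lem : ∀ p → p * 1 + p * 1 ≡ 2 * p
  lem = solve-∀
  reduce : ∀ u → gcd u e ∣ gcd (u % e) e
  reduce u = gcd-greatest (%-presˡ-∣ (gcd[m,n]∣m u e) (gcd[m,n]∣n u e)) (gcd[m,n]∣n u e)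
  bound : ∀ i j → i < p → gcd (j * p + i) (e * p) ≤ (1 + p * 𝟙 (p ∣? i)) * gcd ((j * p + i) % e) e
  bound i j i<p with p ∣? i
  ... | yes _ = ≤-trans (∣⇒≤ {{m*n≢0 p (gcd (u % e) e) {{prime⇒nonZero pp}} {{gcd≢0 (u % e) e}}}} (∣-trans
            (subst (gcd u (e * p) ∣_) (sym (c*gcd[m,n]≡gcd[cm,cn] p u e))
              (gcd-greatest (∣n⇒∣m*n p (gcd[m,n]∣m u (e * p))) (subst (gcd u (e * p) ∣_) (*-comm e p) (gcd[m,n]∣n u (e * p)))))
            (*-monoʳ-∣ p (reduce u))))
          (*-monoˡ-≤ (gcd (u % e) e) (≤-trans (≤-reflexive (sym (*-identityʳ p))) (n≤1+n (p * 1))))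
    where u = j * p + i
  ... | no p∤i = ≤-trans (∣⇒≤ {{gcd≢0 (u % e) e}} (∣-trans
            (gcd-greatest (gcd[m,n]∣m u (e * p)) (coprime-divisor {gcd u (e * p)} {p} {e}
              (coprime-sym (prime∤⇒coprime pp (λ p∣g → p∤i (∣m+n∣m⇒∣n (∣-trans p∣g (gcd[m,n]∣m u (e * p))) (n∣m*n j)))))
              (subst (gcd u (e * p) ∣_) (*-comm e p) (gcd[m,n]∣n u (e * p)))))
            (reduce u)))
          (m≤m+n (gcd (u % e) e) _)
    where u = j * p + i

primes-step : ∀ B p e → p < B → Prime p → Coprime p e → primes B e + 1 ≤ primes B (e * p)
primes-step B p e p<B pp cop = ∑-insert B 1 _ _ p<B
  (λ q → 𝟙-mono (prime? q ×-dec q ∣? e) (prime? q ×-dec q ∣? (e * p)) (λ (pq , q∣e) → pq , ∣m⇒∣m*n p q∣e))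
  (≤-reflexive (trans (cong (_+ 1) (𝟙-no (prime? p ×-dec p ∣? e) (λ (_ , p∣e) → <⇒≢ (prime>1 pp) (sym (cop (∣-refl , p∣e))))))
                (sym (𝟙-yes (prime? p ×-dec p ∣? (e * p)) (pp , n∣m*n e)))))

∑gcd≤ : ∀ B d → 0 < d → d < B → SquareFree d → ∑gcd d ≤ 2 ^ primes B d * d
∑gcd≤ B d 0<d d<B sf = squarefree-induction (λ d → d < B → ∑gcd d ≤ 2 ^ primes B d * d) base step d 0<d sf d<B
  where
  open ≤-Reasoning
  base : 1 < B → 1 ≤ 2 ^ primes B 1 * 1
  base _ = ≤-trans (m^n>0 2 (primes B 1)) (≤-reflexive (sym (*-identityʳ _)))
  step : ∀ p e → Prime p → Coprime p e → 0 < e → SquareFree (e * p) → (e < B → ∑gcd e ≤ 2 ^ primes B e * e) → e * p < B → ∑gcd (e * p) ≤ 2 ^ primes B (e * p) * (e * p)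
  step p e pp cop 0<e _ ih ep<B = begin
    ∑gcd (e * p)  ≤⟨ ∑gcd-step p e pp cop ⟩
    2 * p * ∑gcd e  ≤⟨ *-monoʳ-≤ (2 * p) (ih (≤-<-trans (m≤m*n e p) ep<B)) ⟩
    2 * p * (2 ^ primes B e * e)  ≡⟨ lem p (2 ^ primes B e) e ⟩
    2 ^ primes B e * 2 * (e * p)  ≡⟨ cong (_* (e * p)) (^-distribˡ-+-* 2 (primes B e) 1) ⟨
    2 ^ (primes B e + 1) * (e * p)  ≤⟨ *-monoˡ-≤ (e * p) (^-monoʳ-≤ 2 (primes-step B p e (≤-<-trans (m≤n*m p e) ep<B) pp cop)) ⟩
    2 ^ primes B (e * p) * (e * p)  ∎
    where
    instance e≢0 : NonZero e
             e≢0 = >-nonZero 0<e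
             p≢0 : NonZero p
             p≢0 = prime⇒nonZero pp
    lem : ∀ p x e → 2 * p * (x * e) ≡ x * 2 * (e * p)
    lem = solve-∀

square-roots-prime-≤ : ∀ {p x y} → Prime p → y ≤ x → x * x ≈ y * y [ p ] → x ≈ y [ p ] ⊎ x + y ≈ 0 [ p ]
square-roots-prime-≤ {p} {x} {y} pp y≤x h = case euclidsLemma (x ∸ y) (x + y) pp p∣ of λ where
    (inj₁ q) → inj₁ (subst (_≈ y [ p ]) x≡ (≈-+ (∣⇒≈0 q) ≈-refl))
    (inj₂ q) → inj₂ (∣⇒≈0 q)
  where
  x≡ : x ∸ y + y ≡ x
  x≡ = m∸n+n≡m y≤x
  lem : ∀ c y → y * y + c * (c + y + y) ≡ (c + y) * (c + y)
  lem = solve-∀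
  eq : y * y + (x ∸ y) * (x + y) ≡ x * x
  eq = subst (λ z → y * y + (x ∸ y) * (z + y) ≡ z * z) x≡ (lem (x ∸ y) y)
  p∣ : p ∣ (x ∸ y) * (x + y)
  p∣ = ≈0⇒∣ (≈-+cancelˡ (y * y) (≈-trans (≈-reflexive eq) (≈-trans h (≈-reflexive (sym (+-identityʳ _))))))

square-roots-prime : ∀ {p x y} → Prime p → x * x ≈ y * y [ p ] → x ≈ y [ p ] ⊎ x + y ≈ 0 [ p ]
square-roots-prime {p} {x} {y} pp h = case ≤-total y x of λ where
  (inj₁ y≤x) → square-roots-prime-≤ pp y≤x h
  (inj₂ x≤y) → case square-roots-prime-≤ pp x≤y (≈-sym h) of λ where
    (inj₁ q) → inj₁ (≈-sym q)
    (inj₂ q) → inj₂ (≈-trans (≈-reflexive (+-comm x y)) q)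

#roots : ℕ → ℕ → ℕ
#roots d r = ∑ d (λ x → 𝟙 (x * x ≈? r [ d ]))

#roots-prime : ∀ p r → Prime p → #roots p r ≤ 1 + 𝟙 (¬? (p ∣? r))
#roots-prime p r pp with ∑𝟙-witness p (λ x → x * x ≈? r [ p ])
... | inj₁ z = ≤-trans (≤-reflexive z) z≤n
... | inj₂ (x₀ , _ , h₀) with p ∣? r
...   | yes p∣r = ∑𝟙-class p p 1 (λ x → x * x ≈? r [ p ]) (≤-reflexive (sym (+-identityʳ p))) (λ a b → ≈-trans (root a) (≈-sym (root b)))
  where
  root : ∀ {x} → x * x ≈ r [ p ] → x ≈ 0 [ p ]
  root {x} h with euclidsLemma x x pp (≈⇒∣ (≈-sym h) p∣r)
  ... | inj₁ q = ∣⇒≈0 q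
  ... | inj₂ q = ∣⇒≈0 q
...   | no _ = begin
  ∑ p (λ x → 𝟙 (x * x ≈? r [ p ]))  ≤⟨ ∑-mono p (λ x _ → 𝟙-elim (x * x ≈? r [ p ]) (split x)) ⟩
  ∑ p (λ x → 𝟙 (x ≈? x₀ [ p ]) + 𝟙 (x + x₀ ≈? 0 [ p ]))  ≡⟨ ∑-+ p (λ x → 𝟙 (x ≈? x₀ [ p ])) (λ x → 𝟙 (x + x₀ ≈? 0 [ p ])) ⟩
  ∑ p (λ x → 𝟙 (x ≈? x₀ [ p ])) + ∑ p (λ x → 𝟙 (x + x₀ ≈? 0 [ p ]))
    ≤⟨ +-mono-≤ (∑𝟙-class p p 1 (λ x → x ≈? x₀ [ p ]) (≤-reflexive (sym (+-identityʳ p))) (λ a b → ≈-trans a (≈-sym b)))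
                (∑𝟙-class p p 1 (λ x → x + x₀ ≈? 0 [ p ]) (≤-reflexive (sym (+-identityʳ p))) (λ a b → ≈-+cancelʳ (≈-refl {a = x₀}) (≈-trans a (≈-sym b)))) ⟩
  2  ∎
  where
  open ≤-Reasoning
  split : ∀ x → x * x ≈ r [ p ] → 1 ≤ 𝟙 (x ≈? x₀ [ p ]) + 𝟙 (x + x₀ ≈? 0 [ p ])
  split x h with square-roots-prime pp (≈-trans h (≈-sym h₀))
  ... | inj₁ q = ≤-trans (≤-reflexive (sym (𝟙-yes (x ≈? x₀ [ p ]) q))) (m≤m+n _ _)
  ... | inj₂ q = ≤-trans (≤-reflexive (sym (𝟙-yes (x + x₀ ≈? 0 [ p ]) q))) (m≤n+m _ _)

primes∤ : ℕ → ℕ → ℕ → ℕ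
primes∤ B d r = ∑ B (λ q → 𝟙 (prime? q ×-dec (q ∣? d ×-dec ¬? (q ∣? r))))

#roots≤ : ∀ B d r → 0 < d → d < B → SquareFree d → #roots d r ≤ 2 ^ primes∤ B d r
#roots≤ B d r 0<d d<B sf = squarefree-induction (λ d → d < B → #roots d r ≤ 2 ^ primes∤ B d r) base step d 0<d sf d<B
  where
  open ≤-Reasoning
  base : 1 < B → #roots 1 r ≤ 2 ^ primes∤ B 1 r
  base _ = ≤-trans (𝟙≤1 (0 ≈? r [ 1 ])) (m^n>0 2 (primes∤ B 1 r))
  1+𝟙 : ∀ {P : Set} (P? : Dec P) → 1 + 𝟙 P? ≤ 2 ^ 𝟙 P?
  1+𝟙 (yes _) = ≤-refl
  1+𝟙 (no _)  = ≤-refl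
  step : ∀ p e → Prime p → Coprime p e → 0 < e → SquareFree (e * p) → (e < B → #roots e r ≤ 2 ^ primes∤ B e r) → e * p < B → #roots (e * p) r ≤ 2 ^ primes∤ B (e * p) r
  step p e pp cop 0<e _ ih ep<B = begin
    #roots (e * p) r  ≤⟨ ∑-crt p e (λ x → 𝟙 (x * x ≈? r [ e * p ])) (λ x → 𝟙 (x * x ≈? r [ p ])) (λ x → 𝟙 (x * x ≈? r [ e ])) (coprime-sym cop) both ⟩
    #roots p r * #roots e r  ≤⟨ *-mono-≤ (≤-trans (#roots-prime p r pp) (1+𝟙 (¬? (p ∣? r)))) (ih (≤-<-trans (m≤m*n e p) ep<B)) ⟩
    2 ^ 𝟙 (¬? (p ∣? r)) * 2 ^ primes∤ B e r  ≡⟨ *-comm (2 ^ 𝟙 (¬? (p ∣? r))) _ ⟩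
    2 ^ primes∤ B e r * 2 ^ 𝟙 (¬? (p ∣? r))  ≡⟨ ^-distribˡ-+-* 2 (primes∤ B e r) (𝟙 (¬? (p ∣? r))) ⟨
    2 ^ (primes∤ B e r + 𝟙 (¬? (p ∣? r)))  ≤⟨ ^-monoʳ-≤ 2 (∑-insert B (𝟙 (¬? (p ∣? r))) _ _ (≤-<-trans (m≤n*m p e) ep<B)
        (λ q → 𝟙-mono (prime? q ×-dec (q ∣? e ×-dec ¬? (q ∣? r))) (prime? q ×-dec (q ∣? (e * p) ×-dec ¬? (q ∣? r))) (λ (pq , q∣e , n) → pq , ∣m⇒∣m*n p q∣e , n))
        (≤-trans (≤-reflexive (cong (_+ 𝟙 (¬? (p ∣? r))) (𝟙-no (prime? p ×-dec (p ∣? e ×-dec ¬? (p ∣? r))) (λ (_ , p∣e , _) → <⇒≢ (prime>1 pp) (sym (cop (∣-refl , p∣e)))))))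
                 (𝟙-mono (¬? (p ∣? r)) (prime? p ×-dec (p ∣? (e * p) ×-dec ¬? (p ∣? r))) (λ n → pp , n∣m*n e , n)))) ⟩
    2 ^ primes∤ B (e * p) r  ∎
    where
    instance e≢0 : NonZero e
             e≢0 = >-nonZero 0<e
             p≢0 : NonZero p
             p≢0 = prime⇒nonZero pp
    both : ∀ i j → i < p → 𝟙 ((j * p + i) * (j * p + i) ≈? r [ e * p ]) ≤ 𝟙 (i * i ≈? r [ p ]) * 𝟙 (((j * p + i) % e) * ((j * p + i) % e) ≈? r [ e ])
    both i j _ = ≤-trans (𝟙-mono ((j * p + i) * (j * p + i) ≈? r [ e * p ]) (i * i ≈? r [ p ] ×-dec (((j * p + i) % e) * ((j * p + i) % e) ≈? r [ e ]))
        (λ h → ≈-trans (≈-* i≈ i≈) (≈-∣ {n = p} (n∣m*n e) h) , ≈-trans (≈-* (%-≈ (j * p + i) e) (%-≈ (j * p + i) e)) (≈-∣ {n = e} (m∣m*n p) h)))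
      (≤-reflexive (sym (𝟙-× (i * i ≈? r [ p ]) (_ ≈? r [ e ]))))
      where
      i≈ : i ≈ j * p + i [ p ]
      i≈ = ≈-sym (≈-trans (≈-reflexive (+-comm (j * p) i)) (≈-+m i j))

#roots≤weight : ∀ d r → 0 < d → SquareFree d → #roots d r ≤ weight d r
#roots≤weight d r 0<d sf = ≤-trans (#roots≤ (suc d) d r 0<d ≤-refl sf) (^-monoʳ-≤ 2 (m+n≤o⇒m≤o∸n (primes∤ (suc d) d r) (begin
  primes∤ (suc d) d r + ω g  ≡⟨ cong (primes∤ (suc d) d r +_) (ω≡primes g) ⟩
  primes∤ (suc d) d r + primes (suc g) g  ≤⟨ +-monoʳ-≤ (primes∤ (suc d) d r) (∑-range (λ q → 𝟙 (prime? q ×-dec q ∣? g)) (s≤s (∣⇒≤ {{>-nonZero 0<d}} (gcd[m,n]∣m d r)))) ⟩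
  primes∤ (suc d) d r + primes (suc d) g  ≡⟨ ∑-+ (suc d) (λ q → 𝟙 (prime? q ×-dec (q ∣? d ×-dec ¬? (q ∣? r)))) (λ q → 𝟙 (prime? q ×-dec q ∣? g)) ⟨
  ∑ (suc d) (λ q → 𝟙 (prime? q ×-dec (q ∣? d ×-dec ¬? (q ∣? r))) + 𝟙 (prime? q ×-dec q ∣? g)) ≤⟨ ∑-mono (suc d) (λ q _ → disjoint q) ⟩
  primes (suc d) d  ≡⟨ ω≡primes d ⟨
  ω d  ∎)))
  where
  open ≤-Reasoning
  g = gcd d r
  disjoint : ∀ q → 𝟙 (prime? q ×-dec (q ∣? d ×-dec ¬? (q ∣? r))) + 𝟙 (prime? q ×-dec q ∣? g) ≤ 𝟙 (prime? q ×-dec q ∣? d)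
  disjoint q with prime? q ×-dec q ∣? g
  ... | yes (pq , q∣g) = ≤-trans (≤-reflexive (cong (_+ 1) (𝟙-no (prime? q ×-dec (q ∣? d ×-dec ¬? (q ∣? r))) (λ (_ , _ , n) → n (∣-trans q∣g (gcd[m,n]∣n d r))))))
          (≤-reflexive (sym (𝟙-yes (prime? q ×-dec q ∣? d) (pq , ∣-trans q∣g (gcd[m,n]∣m d r)))))
  ... | no _ = ≤-trans (≤-reflexive (+-identityʳ _)) (𝟙-mono (prime? q ×-dec (q ∣? d ×-dec ¬? (q ∣? r))) (prime? q ×-dec q ∣? d) (λ (a , b , _) → a , b))

SumD≥ : ∀ d .{{_ : NonZero d}} → SquareFree d → (dec : Decidable (InD d)) → ∑ d (λ x → 𝟙 (dec ((x * x) % d))) ≤ SumD d dec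
SumD≥ d sf dec = begin
  ∑ d (λ x → 𝟙 (dec ((x * x) % d)))  ≤⟨ ∑-mono d (λ x _ → at x) ⟩
  ∑ d (λ x → ∑ d (λ r → 𝟙 (dec r) * 𝟙 (x * x ≈? r [ d ])))  ≡⟨ ∑-swap d d (λ x r → 𝟙 (dec r) * 𝟙 (x * x ≈? r [ d ])) ⟩
  ∑ d (λ r → ∑ d (λ x → 𝟙 (dec r) * 𝟙 (x * x ≈? r [ d ])))  ≡⟨ ∑-cong d (λ r _ → ∑-*ˡ d (𝟙 (dec r)) (λ x → 𝟙 (x * x ≈? r [ d ]))) ⟩
  ∑ d (λ r → 𝟙 (dec r) * #roots d r)  ≤⟨ ∑-mono d (λ r _ → *-monoʳ-≤ (𝟙 (dec r)) (#roots≤weight d r (>-nonZero⁻¹ d) sf)) ⟩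
  ∑ d (λ r → 𝟙 (dec r) * weight d r)  ≡⟨ sum-filter-applyUpTo (weight d) dec (λ i → i) d ⟨
  SumD d dec  ∎
  where
  open ≤-Reasoning
  at : ∀ x → 𝟙 (dec ((x * x) % d)) ≤ ∑ d (λ r → 𝟙 (dec r) * 𝟙 (x * x ≈? r [ d ]))
  at x = ≤-trans (≤-reflexive (sym (trans (cong (𝟙 (dec ((x * x) % d)) *_) (𝟙-yes (x * x ≈? (x * x) % d [ d ]) (≈-sym (%-≈ (x * x) d)))) (*-identityʳ _))))
                 (∑-term (λ r → 𝟙 (dec r) * 𝟙 (x * x ≈? r [ d ])) (m%n<n (x * x) d))

-- The product of the counted primes divides M.
prime-divisors≤ : ∀ {y} {P : ℕ → Set} (P? : ∀ q → Dec (P q)) B M → 0 < M →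
  (∀ q → q < B → P q → Prime q × y ≤ q × q ∣ M) → y ^ ∑ B (λ q → 𝟙 (P? q)) ≤ M
prime-divisors≤ P? zero M 0<M h = 0<M
prime-divisors≤ {y} {P} P? (suc B) M 0<M h with P? B
... | no _ = subst (λ z → y ^ z ≤ M) (sym (+-identityʳ (∑ B (λ q → 𝟙 (P? q))))) (prime-divisors≤ {y} {P} P? B M 0<M (λ q q<B → h q (m<n⇒m<1+n q<B)))
... | yes pB with h B ≤-refl pB
...   | pp , y≤B , divides M′ refl = begin
  y ^ (∑ B (λ q → 𝟙 (P? q)) + 1)  ≡⟨ cong (y ^_) (+-comm (∑ B (λ q → 𝟙 (P? q))) 1) ⟩
  y * y ^ ∑ B (λ q → 𝟙 (P? q))  ≤⟨ *-mono-≤ y≤B (prime-divisors≤ {y} {P} P? B M′ 0<M′ rest) ⟩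
  B * M′  ≡⟨ *-comm B M′ ⟩
  M′ * B  ∎
  where
  open ≤-Reasoning
  0<M′ : 0 < M′
  0<M′ = n≢0⇒n>0 (λ z → <⇒≢ 0<M (sym (cong (_* B) z)))
  rest : ∀ q → q < B → P q → Prime q × y ≤ q × q ∣ M′
  rest q q<B pq with h q (m<n⇒m<1+n q<B) pq
  ... | ppq , y≤q , q∣M with euclidsLemma M′ B ppq q∣M
  ...   | inj₁ r = ppq , y≤q , r
  ...   | inj₂ q∣B with prime⇒irreducible pp q∣B
  ...     | inj₁ q≡1 = contradiction (sym q≡1) (<⇒≢ (prime>1 ppq))
  ...     | inj₂ q≡B = contradiction q≡B (<⇒≢ q<B)

nCk≤2^n : ∀ n k → n C k ≤ 2 ^ n
nCk≤2^n zero    zero    = ≤-refl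
nCk≤2^n zero    (suc k) = z≤n
nCk≤2^n (suc n) zero    = m^n>0 2 (suc n)
nCk≤2^n (suc n) (suc k) = begin
  suc n C suc k  ≡⟨ nCk+nC[k+1]≡[n+1]C[k+1] n k ⟨
  n C k + n C suc k  ≤⟨ +-mono-≤ (nCk≤2^n n k) (≤-trans (nCk≤2^n n (suc k)) (m≤m+n (2 ^ n) 0)) ⟩
  2 ^ suc n  ∎
  where open ≤-Reasoning

prime∣!⇒≤ : ∀ {p} n → Prime p → p ∣ n ! → p ≤ n
prime∣!⇒≤ zero pp p∣ = contradiction (∣1⇒≡1 p∣) (λ p≡1 → <⇒≢ (prime>1 pp) (sym p≡1))
prime∣!⇒≤ (suc n) pp p∣ with euclidsLemma (suc n) (n !) pp p∣
... | inj₁ q = ∣⇒≤ q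
... | inj₂ q = m≤n⇒m≤1+n (prime∣!⇒≤ n pp q)

nCk*k![n∸k]!≡n! : ∀ {n k} → k ≤ n → (n C k) * (k ! * (n ∸ k) !) ≡ n !
nCk*k![n∸k]!≡n! {n} {k} k≤n = begin
  (n C k) * (k ! * (n ∸ k) !)  ≡⟨ cong (_* (k ! * (n ∸ k) !)) (nCk≡n!/k![n-k]! k≤n) ⟩
  (n ! / (k ! * (n ∸ k) !)) {{k !* (n ∸ k) !≢0}} * (k ! * (n ∸ k) !)  ≡⟨ m/n*n≡m {{k !* (n ∸ k) !≢0}} (k![n∸k]!∣n! k≤n) ⟩
  n !  ∎
  where open ≡-Reasoning

prime∣central : ∀ n p → Prime p → n < p → p ≤ n + n → p ∣ (n + n) C n
prime∣central n p pp n<p p≤2n = case euclidsLemma ((n + n) C n) (n ! * (n + n ∸ n) !) pp p∣ of λ where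
    (inj₁ q) → q
    (inj₂ q) → case euclidsLemma (n !) ((n + n ∸ n) !) pp q of λ where
      (inj₁ r) → contradiction (prime∣!⇒≤ n pp r) (<⇒≱ n<p)
      (inj₂ r) → contradiction (≤-trans (prime∣!⇒≤ (n + n ∸ n) pp r) (≤-reflexive (m+n∸n≡m n n))) (<⇒≱ n<p)
  where
  instance p≢0 : NonZero p
           p≢0 = prime⇒nonZero pp
  p∣ : p ∣ ((n + n) C n) * (n ! * (n + n ∸ n) !)
  p∣ = subst (p ∣_) (sym (nCk*k![n∸k]!≡n! (m≤m+n n n)))
    (∣-trans (subst (λ z → z ∣ z !) (suc-pred p) (m∣m*n (pred p !))) (m≤n⇒m!∣n! p≤2n))

-- Chebyshev's bound for the primes in (2^i, 2^(i+1)), through the central binomial coefficient.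
dyadic-primes : ∀ {P : ℕ → Set} (P? : ∀ q → Dec (P q)) i → (∀ q → P q → Prime q × 2 ^ i < q) →
  i * ∑ (2 ^ suc i) (λ q → 𝟙 (P? q)) ≤ 2 ^ suc i
dyadic-primes P? i h = 2^-cancel-≤ (begin
  2 ^ (i * ∑ (2 ^ suc i) (λ q → 𝟙 (P? q)))  ≡⟨ ^-*-assoc 2 i _ ⟨
  (2 ^ i) ^ ∑ (2 ^ suc i) (λ q → 𝟙 (P? q))  ≤⟨ prime-divisors≤ P? (2 ^ suc i) ((n + n) C n) 0<C
      (λ q q< pq → proj₁ (h q pq) , <⇒≤ (proj₂ (h q pq)) , prime∣central n q (proj₁ (h q pq)) (proj₂ (h q pq)) (≤-trans (<⇒≤ q<) (≤-reflexive 2n))) ⟩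
  (n + n) C n  ≤⟨ nCk≤2^n (n + n) n ⟩
  2 ^ (n + n)  ≡⟨ cong (2 ^_) (sym 2n) ⟩
  2 ^ (2 ^ suc i)  ∎)
  where
  open ≤-Reasoning
  n = 2 ^ i
  2n : 2 ^ suc i ≡ n + n
  2n = cong (n +_) (+-identityʳ n)
  0<C : 0 < (n + n) C n
  0<C = n≢0⇒n>0 (λ z → ≢-nonZero⁻¹ ((n + n) !) {{(n + n) !≢0}}
    (trans (sym (nCk*k![n∸k]!≡n! (m≤m+n n n))) (cong (_* (n ! * (n + n ∸ n) !)) z)))

-- The Jacobi symbol and quadratic reciprocity

∑-≈ : ∀ {m} n {f g : ℕ → ℕ} → (∀ i → i < n → f i ≈ g i [ m ]) → ∑ n f ≈ ∑ n g [ m ]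
∑-≈ zero    h = ≈-refl
∑-≈ (suc n) h = ≈-+ (∑-≈ n (λ i i<n → h i (m<n⇒m<1+n i<n))) (h n ≤-refl)

double-≈0 : ∀ a → a + a ≈ 0 [ 2 ]
double-≈0 a = ∣⇒≈0 (divides a (lem a))
  where lem : ∀ a → a + a ≡ a * 2
        lem = solve-∀

-- The Jacobi symbol (a / 2h+1) is (-1)^(signs h a), by the Gauss-Schering lemma.
signs : ℕ → ℕ → ℕ
signs h a = ∑ (suc h) (λ x → 𝟙 (h <? (a * x) % suc (2 * h)))

module HalfSystem (h : ℕ) where
  n : ℕ
  n = suc (2 * h)

  h<n : h < n
  h<n = s≤s (m≤n*m h 2)

  σ : ℕ → ℕ
  σ r = 𝟙 (h <? r)

  -- The half system `0, ..., h` represents all residues up to sign, non-units included, as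
  -- Schering's version for composite `n` requires.
  fold : ℕ → ℕ
  fold r with h <? r
  ... | yes _ = n ∸ r
  ... | no _  = r

  fold-≤ : ∀ r → fold r ≤ h
  fold-≤ r with h <? r
  ... | yes h<r = ≤-trans (∸-monoʳ-≤ n h<r) (≤-reflexive (trans (cong (_∸ h) (cong (h +_) (+-identityʳ h))) (m+n∸m≡n h h)))
  ... | no h≮r  = ≮⇒≥ h≮r

  fold-± : ∀ r → r < n → (fold r ≡ r) ⊎ (fold r + r ≡ n)
  fold-± r r<n with h <? r
  ... | yes _ = inj₂ (m∸n+n≡m (<⇒≤ r<n))
  ... | no _  = inj₁ refl

  fold-parity : ∀ r → r < n → r ≈ fold r + σ r [ 2 ]
  fold-parity r r<n with h <? r
  ... | no _  = ≈-reflexive (sym (+-identityʳ r))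
  ... | yes _ = ≈-+cancelʳ (≈-refl {a = n ∸ r}) (≈-trans (≈-reflexive (trans (+-comm r (n ∸ r)) (m∸n+n≡m (<⇒≤ r<n))))
      (≈-trans (≈-trans (≈-reflexive (lem₁ h)) (≈-+m 1 h)) (≈-sym (≈-trans (≈-reflexive (lem₂ (n ∸ r))) (≈-+m 1 (n ∸ r))))))
    where
    lem₁ : ∀ h → suc (2 * h) ≡ 1 + h * 2
    lem₁ = solve-∀
    lem₂ : ∀ x → x + 1 + x ≡ 1 + x * 2
    lem₂ = solve-∀

  sum-n : ∀ {u v} → 0 < u → u < n → v < n → u + v ≈ 0 [ n ] → u + v ≡ n
  sum-n {u} {v} 0<u u<n v<n p with ≈0⇒∣ p
  ... | divides zero eq = contradiction (sym (m+n≡0⇒m≡0 u eq)) (<⇒≢ 0<u)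
  ... | divides (suc zero) eq = trans eq (+-identityʳ n)
  ... | divides (suc (suc q)) eq = contradiction (≤-trans (≤-reflexive (cong (n +_) (sym (+-identityʳ n)))) (≤-trans (*-monoˡ-≤ n (m≤m+n 2 q)) (≤-reflexive (sym eq)))) (<⇒≱ (+-mono-< u<n v<n))

  σ-neg : ∀ {u v} → u + v ≡ n → σ v ≈ 1 + σ u [ 2 ]
  σ-neg {u} {v} eq with h <? u | h <? v
  ... | yes p | yes q = contradiction (≤-reflexive eq) (<⇒≱ (≤-trans (≤-reflexive (lem h)) (+-mono-≤ p q)))
    where lem : ∀ h → suc (suc (2 * h)) ≡ suc h + suc h
          lem = solve-∀
  ... | yes p | no ¬q = ≈-sym (∣⇒≈0 (divides 1 refl))
  ... | no ¬p | yes q = ≈-refl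
  ... | no ¬p | no ¬q = contradiction (≤-reflexive (sym eq)) (<⇒≱ (s≤s (≤-trans (+-mono-≤ (≮⇒≥ ¬p) (≮⇒≥ ¬q)) (≤-reflexive (cong (h +_) (sym (+-identityʳ h)))))))

  small-cancel : ∀ {b x y} → Coprime n b → x ≤ h → y ≤ h → (b * x) % n ≡ (b * y) % n ⊎ (b * x) % n + (b * y) % n ≡ n → x ≡ y
  small-cancel {b} {x} {y} cop x≤ y≤ (inj₁ e) = ≈-< (≤-<-trans x≤ h<n) (≤-<-trans y≤ h<n) (≈-cancel b cop (%⇒≈ e))
  small-cancel {b} {x} {y} cop x≤ y≤ (inj₂ e) = trans (m+n≡0⇒m≡0 x x+y≡0) (sym (m+n≡0⇒n≡0 x x+y≡0))
    where
    x+y≡0 : x + y ≡ 0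
    x+y≡0 = ≈-< (s≤s (≤-trans (+-mono-≤ x≤ y≤) (≤-reflexive (cong (h +_) (sym (+-identityʳ h)))))) (s≤s z≤n)
      (≈-cancel b cop (≈-trans (≈-reflexive (*-distribˡ-+ b x y)) (≈-trans (≈-sym (≈-+ (%-≈ (b * x) n) (%-≈ (b * y) n)))
        (≈-trans (≈-reflexive e) (≈-trans (≈-trans (≈-reflexive (sym (+-identityʳ n))) (≈-+m 0 1)) (≈-reflexive (sym (*-zeroʳ b))))))))

  π : ℕ → ℕ → ℕ
  π b x = fold ((b * x) % n)

  π-inj : ∀ b → Coprime n b → ∀ {x y} → x < suc h → y < suc h → π b x ≡ π b y → x ≡ y
  π-inj b cop {x} {y} x< y< e = small-cancel cop (s≤s⁻¹ x<) (s≤s⁻¹ y<)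
    (go (fold-± ((b * x) % n) (m%n<n (b * x) n)) (fold-± ((b * y) % n) (m%n<n (b * y) n)))
    where
    r = (b * x) % n
    s = (b * y) % n
    go : (fold r ≡ r) ⊎ (fold r + r ≡ n) → (fold s ≡ s) ⊎ (fold s + s ≡ n) → r ≡ s ⊎ r + s ≡ n
    go (inj₁ p) (inj₁ q) = inj₁ (trans (sym p) (trans e q))
    go (inj₁ p) (inj₂ q) = inj₂ (trans (cong (_+ s) (trans (sym p) e)) q)
    go (inj₂ p) (inj₁ q) = inj₂ (trans (trans (+-comm r s) (cong (_+ r) (trans (sym q) (sym e)))) p)
    go (inj₂ p) (inj₂ q) = inj₁ (+-cancelˡ-≡ (fold r) r s (trans p (trans (sym q) (cong (_+ s) (sym e)))))

  ∑-π : ∀ b → Coprime n b → ∀ c (f : ℕ → ℕ) → (∀ x → x < suc h → f x ≤ c) → ∑ (suc h) (λ x → f (π b x)) ≡ ∑ (suc h) f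
  ∑-π b cop c f f≤ = ∑-perm (suc h) c (π b) f f≤ (λ x _ → s≤s (fold-≤ ((b * x) % n))) (π-inj b cop)

  signs-cong : ∀ {a b} → a ≈ b [ n ] → signs h a ≡ signs h b
  signs-cong p = ∑-cong (suc h) (λ x _ → cong σ (≈⇒% (≈-*ʳ x p)))

  -- If `b x` lies in the upper half, it is minus its folded representative, and negation moves the
  -- product with `a` to the other half, since that product is nonzero modulo `n`. Summed over the
  -- half system, which `π b` permutes, this makes the symbol multiplicative.
  cocycle : ∀ a b → Coprime n a → ∀ x → σ ((a * b * x) % n) ≈ σ ((a * π b x) % n) + σ ((b * x) % n) [ 2 ]
  cocycle a b cop x with h <? (b * x) % n
  ... | no _    = ≈-reflexive (trans (cong σ (≈⇒% (≈-trans (≈-reflexive (*-assoc a b x)) (≈-*ˡ a (≈-sym (%-≈ (b * x) n)))))) (sym (+-identityʳ _)))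
  ... | yes h<r = ≈-trans (σ-neg (sum-n 0<u (m%n<n (a * y) n) (m%n<n (a * b * x) n) u+v≈0)) (≈-reflexive (+-comm 1 (σ ((a * y) % n))))
    where
    r = (b * x) % n
    y = n ∸ r
    y+r : y + r ≡ n
    y+r = m∸n+n≡m (<⇒≤ (m%n<n (b * x) n))
    0<y : 0 < y
    0<y = m<n⇒0<n∸m (m%n<n (b * x) n)
    y<n : y < n
    y<n = ∸-monoʳ-< (≤-<-trans z≤n h<r) (<⇒≤ (m%n<n (b * x) n))
    0<u : 0 < (a * y) % n
    0<u = n≢0⇒n>0 (λ z → <⇒≢ 0<y (sym (≈-< y<n (s≤s z≤n) (≈-cancel a cop
      (≈-trans (≈-sym (%-≈ (a * y) n)) (≈-reflexive (trans z (sym (*-zeroʳ a)))))))))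
    u+v≈0 : (a * y) % n + (a * b * x) % n ≈ 0 [ n ]
    u+v≈0 = ≈-trans (≈-+ (%-≈ (a * y) n) (≈-trans (%-≈ (a * b * x) n) (≈-trans (≈-reflexive (*-assoc a b x)) (≈-*ˡ a (≈-sym (%-≈ (b * x) n))))))
      (≈-trans (≈-reflexive (trans (sym (*-distribˡ-+ a y r)) (cong (a *_) y+r))) (≈-+m 0 a))

  signs-* : ∀ a b → Coprime n a → Coprime n b → signs h (a * b) ≈ signs h a + signs h b [ 2 ]
  signs-* a b copa copb = ≈-trans (∑-≈ (suc h) (λ x _ → cocycle a b copa x)) (≈-reflexive
    (trans (∑-+ (suc h) (λ x → σ ((a * π b x) % n)) (λ x → σ ((b * x) % n)))
      (cong (_+ signs h b) (∑-π b copb 1 (λ y → σ ((a * y) % n)) (λ y _ → 𝟙≤1 (h <? (a * y) % n))))))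

  signs-square : ∀ a → Coprime n a → signs h (a * a) ≈ 0 [ 2 ]
  signs-square a cop = ≈-trans (signs-* a a cop cop) (double-≈0 (signs h a))

  -- `2 * h` is -1 modulo `n`; it sends every nonzero element of the half system to the other half.
  signs-neg : signs h (2 * h) ≡ h
  signs-neg = begin
    signs h (2 * h)  ≡⟨ ∑-head h (λ x → σ ((2 * h * x) % n)) ⟩
    σ ((2 * h * 0) % n) + ∑ h (λ x → σ ((2 * h * suc x) % n))
      ≡⟨ cong₂ _+_ (trans (cong (λ z → σ (z % n)) (*-zeroʳ (2 * h))) (𝟙-no (h <? 0) (λ ()))) (trans (∑-cong h (λ x x<h → 𝟙-yes (h <? _) (big x x<h))) (trans (∑-const h 1) (*-identityʳ h))) ⟩
    h  ∎
    where
    open ≡-Reasoning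
    big : ∀ x → x < h → h < (2 * h * suc x) % n
    big x x<h = subst (h <_) (sym (trans (cong (_% n) eq) (trans ([m+kn]%n≡m%n (2 * h ∸ x) x n) (m<n⇒m%n≡m (s≤s (m∸n≤m (2 * h) x)))))) (m+n≤o⇒m≤o∸n (suc h) (≤-trans (≤-reflexive (sym (+-suc h x))) (≤-trans (+-monoʳ-≤ h x<h) (≤-reflexive (cong (h +_) (sym (+-identityʳ h)))))))
      where
      eq : 2 * h * suc x ≡ 2 * h ∸ x + x * n
      eq = +-cancelˡ-≡ x _ _ (trans (lem x (2 * h)) (cong (_+ x * n) (trans (sym (m∸n+n≡m (≤-trans (<⇒≤ x<h) (m≤n*m h 2)))) (+-comm (2 * h ∸ x) x)) ⟨trans⟩ +-assoc x (2 * h ∸ x) (x * n)))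
        where
        lem : ∀ x z → x + z * suc x ≡ z + x * suc z
        lem = solve-∀
        _⟨trans⟩_ = trans

  signs≡1 : signs h 1 ≡ 0
  signs≡1 = ∑-zero (suc h) (λ x x≤h → 𝟙-no (h <? _) (λ p → <⇒≱ p (≤-trans (m%n≤m (1 * x) n) (≤-trans (≤-reflexive (*-identityˡ x)) (s≤s⁻¹ x≤h)))))

  -- Summing q x = p ⌊q x / p⌋ + (remainder) over the half system, modulo 2.
  eisenstein : ∀ k → Coprime n (suc (2 * k)) → signs h (suc (2 * k)) ≈ ∑ (suc h) (λ x → (suc (2 * k) * x) / n) [ 2 ]
  eisenstein k cop = ≈-sym (≈-+cancelˡ (∑ (suc h) (λ x → x) + signs h q) (≈-trans
      (≈-trans (≈-reflexive (+-comm (S + signs h q) F)) (≈-sym sum₁)) (≈-trans (≈-sym (≈-+cancel₂ (signs h q))) (≈-reflexive (sym (+-assoc S (signs h q) (signs h q)))))))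
    where
    q = suc (2 * k)
    S = ∑ (suc h) (λ x → x)
    F = ∑ (suc h) (λ x → (q * x) / n)
    odd : ∀ m x → suc (2 * m) * x ≈ x [ 2 ]
    odd m x = ≈-trans (≈-reflexive (lem m x)) (≈-+m x (m * x))
      where lem : ∀ m x → suc (2 * m) * x ≡ x + m * x * 2
            lem = solve-∀
    ≈-+cancel₂ : ∀ z → S + (z + z) ≈ S [ 2 ]
    ≈-+cancel₂ z = ≈-trans (≈-+ (≈-refl {a = S}) (double-≈0 z)) (≈-reflexive (+-identityʳ S))
    pointwise : ∀ x → x ≈ (q * x) / n + (π q x + σ ((q * x) % n)) [ 2 ]
    pointwise x = ≈-trans (≈-sym (odd k x)) (≈-trans (≈-reflexive (trans (m≡m%n+[m/n]*n (q * x) n) (+-comm ((q * x) % n) ((q * x) / n * n))))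
      (≈-+ (≈-trans (≈-reflexive (*-comm ((q * x) / n) n)) (odd h ((q * x) / n))) (fold-parity ((q * x) % n) (m%n<n (q * x) n))))
    sum₁ : S ≈ F + (S + signs h q) [ 2 ]
    sum₁ = ≈-trans (∑-≈ (suc h) (λ x _ → pointwise x)) (≈-reflexive (trans (∑-+ (suc h) (λ x → (q * x) / n) (λ x → π q x + σ ((q * x) % n)))
      (cong (F +_) (trans (∑-+ (suc h) (π q) (λ x → σ ((q * x) % n))) (cong (_+ signs h q) (∑-π q cop h (λ x → x) (λ x x< → s≤s⁻¹ x<)))))))

count-suc≤ : ∀ {Q} k → Q ≤ k → ∑ k (λ y → 𝟙 (suc y ≤? Q)) ≡ Q
count-suc≤ {Q} k Q≤k = begin
  ∑ k (λ y → 𝟙 (suc y ≤? Q))  ≡⟨ cong (λ z → ∑ z (λ y → 𝟙 (suc y ≤? Q))) (m+[n∸m]≡n Q≤k) ⟨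
  ∑ (Q + (k ∸ Q)) (λ y → 𝟙 (suc y ≤? Q))  ≡⟨ ∑-split Q (k ∸ Q) (λ y → 𝟙 (suc y ≤? Q)) ⟩
  ∑ Q (λ y → 𝟙 (suc y ≤? Q)) + ∑ (k ∸ Q) (λ y → 𝟙 (suc (Q + y) ≤? Q))
    ≡⟨ cong₂ _+_ (trans (∑-cong Q (λ y y<Q → 𝟙-yes (suc y ≤? Q) y<Q)) (trans (∑-const Q 1) (*-identityʳ Q)))
                 (∑-zero (k ∸ Q) (λ y _ → 𝟙-no (suc (Q + y) ≤? Q) (λ p → <⇒≱ p (m≤m+n Q y)))) ⟩
  Q + 0  ≡⟨ +-identityʳ Q ⟩
  Q  ∎
  where open ≡-Reasoning

floor-count : ∀ h k → ∑ (suc h) (λ x → (suc (2 * k) * x) / suc (2 * h)) ≡ ∑ h (λ x → ∑ k (λ y → 𝟙 (suc y * suc (2 * h) ≤? suc x * suc (2 * k))))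
floor-count h k = trans (∑-head h (λ x → (q * x) / p)) (trans (cong (λ z → z / p + ∑ h (λ x → (q * suc x) / p)) (*-zeroʳ q)) (∑-cong h at))
  where
  p = suc (2 * h)
  q = suc (2 * k)
  at : ∀ x → x < h → (q * suc x) / p ≡ ∑ k (λ y → 𝟙 (suc y * p ≤? suc x * q))
  at x x<h = trans (sym (count-suc≤ k floor≤k)) (∑-cong k (λ y _ → ≤-antisym
      (𝟙-mono (suc y ≤? (q * suc x) / p) (suc y * p ≤? suc x * q) (λ le → ≤-trans (*-monoˡ-≤ p le) (≤-trans (m/n*n≤m (q * suc x) p) (≤-reflexive (*-comm q (suc x))))))
      (𝟙-mono (suc y * p ≤? suc x * q) (suc y ≤? (q * suc x) / p) (λ le → ≤-trans (≤-reflexive (sym (m*n/n≡m (suc y) p))) (/-monoˡ-≤ p (≤-trans le (≤-reflexive (*-comm (suc x) q))))))))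
    where
    floor≤k : (q * suc x) / p ≤ k
    floor≤k = s≤s⁻¹ (m<n*o⇒m/o<n {q * suc x} {suc k} {p} (≤-<-trans (*-monoʳ-≤ q x<h) (≤-by {l = 0} (h + k) z≤n (lem h k))))
      where lem : ∀ h k → suc (suc (2 * k) * h) + 0 + (h + k) ≡ suc k * suc (2 * h) + 0
            lem = solve-∀

-- Eisenstein's lattice points: the two sums of floors count the points of an `h` by `k` rectangle
-- on the two sides of its diagonal.
reciprocity : ∀ h k → Coprime (suc (2 * h)) (suc (2 * k)) → signs h (suc (2 * k)) + signs k (suc (2 * h)) ≈ h * k [ 2 ]
reciprocity h k cop = ≈-trans (≈-+ (HalfSystem.eisenstein h k cop) (HalfSystem.eisenstein k h (coprime-sym cop)))
  (≈-reflexive (begin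
    ∑ (suc h) (λ x → (q * x) / p) + ∑ (suc k) (λ y → (p * y) / q)
      ≡⟨ cong₂ _+_ (floor-count h k) (trans (floor-count k h) (∑-swap k h (λ y x → 𝟙 (suc x * q ≤? suc y * p)))) ⟩
    ∑ h (λ x → ∑ k (B x)) + ∑ h (λ x → ∑ k (A x))
      ≡⟨ ∑-+ h (λ x → ∑ k (B x)) (λ x → ∑ k (A x)) ⟨
    ∑ h (λ x → ∑ k (B x) + ∑ k (A x))
      ≡⟨ ∑-cong h (λ x x<h → trans (sym (∑-+ k (B x) (A x))) (trans (∑-cong k (λ y _ → one x y x<h)) (trans (∑-const k 1) (*-identityʳ k)))) ⟩
    ∑ h (λ _ → k) ≡⟨ ∑-const h k ⟩
    h * k ∎))
  where
  open ≡-Reasoning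
  p = suc (2 * h)
  q = suc (2 * k)
  A B : ℕ → ℕ → ℕ
  A x y = 𝟙 (suc x * q ≤? suc y * p)
  B x y = 𝟙 (suc y * p ≤? suc x * q)
  -- A point on the diagonal would make `p` divide `suc x`, which is at most `h`.
  one : ∀ x y → x < h → 𝟙 (suc y * p ≤? suc x * q) + 𝟙 (suc x * q ≤? suc y * p) ≡ 1
  one x y x<h with suc y * p ≤? suc x * q | suc x * q ≤? suc y * p
  ... | yes a | yes b = contradiction (∣⇒≤ (coprime-divisor {p} {q} cop (subst (p ∣_) (trans (≤-antisym a b) (*-comm (suc x) q)) (n∣m*n (suc y)))))
                          (<⇒≱ (≤-<-trans x<h (HalfSystem.h<n h)))
  ... | yes _ | no _  = refl
  ... | no _  | yes _ = refl
  ... | no a  | no b  = contradiction (<⇒≤ (≰⇒> a)) b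

-- Quadratic reciprocity for -d, d = 2h+1 ≡ 3 mod 4.
signs-of-split : ∀ h k y → h ≈ 1 [ 2 ] → Coprime (suc (2 * h)) (suc (2 * k)) → y * y + suc (2 * h) ≈ 0 [ suc (2 * k) ] → signs h (suc (2 * k)) ≈ 0 [ 2 ]
-- From `y² ≡ - d` modulo `q` and `signs k (2 * k) ≡ k` follows `signs k d ≡ k`. Reciprocity with
-- `h` odd gives `signs h q + signs k d ≡ k`, so `signs h q` is even.
signs-of-split h k y h-odd cop sq = ≈-+cancelʳ (≈-sym (≈-+cancelʳ {b = signs k d} (≈-refl {a = k})
    (≈-trans (double-≈0 k) (≈-trans (≈-sym (signs-square y q⊥y)) (≈-trans (≈-reflexive (signs-cong y²≈))
      (≈-trans (signs-* (2 * k) d q⊥2k (coprime-sym cop)) (≈-reflexive (trans (cong (_+ signs k d) signs-neg) (+-comm k (signs k d)))))))))) (≈-trans (reciprocity h k cop)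
    (≈-trans (≈-*ʳ k h-odd) (≈-reflexive (*-identityˡ k))))
  where
  open HalfSystem k
  d = suc (2 * h)
  q⊥2k : Coprime n (2 * k)
  q⊥2k {c} (c∣q , c∣2k) = ∣1⇒≡1 (∣m+n∣m⇒∣n {c} {2 * k} {1} (subst (c ∣_) (+-comm 1 (2 * k)) c∣q) c∣2k)
  q⊥y : Coprime n y
  q⊥y {c} (c∣q , c∣y) = cop (∣m+n∣m⇒∣n (≈0⇒∣ (≈-∣ c∣q sq)) (∣m⇒∣m*n y c∣y) , c∣q)
  y²≈ : y * y ≈ 2 * k * d [ n ]
  y²≈ = ≈-+cancelʳ (≈-refl {a = d}) (≈-trans sq (≈-sym (≈-trans (≈-reflexive (lem k d)) (≈-+m 0 d))))
    where lem : ∀ k d → 2 * k * d + d ≡ d * suc (2 * k)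
          lem = solve-∀

-- Odd integers without bad prime factors

odd⇒suc-double : ∀ n → ¬ 2 ∣ n → ∃ λ k → n ≡ suc (2 * k)
odd⇒suc-double n n-odd with n % 2 in eq | m%n<n n 2
... | 0 | _ = contradiction (m%n≡0⇒n∣m n 2 eq) n-odd
... | 1 | _ = n / 2 , trans (m≡m%n+[m/n]*n n 2) (cong₂ _+_ eq (*-comm (n / 2) 2))
... | suc (suc _) | s≤s (s≤s ())

suc-double-odd : ∀ k → ¬ 2 ∣ suc (2 * k)
suc-double-odd k 2∣ with ∣1⇒≡1 (∣m+n∣m⇒∣n {2} {2 * k} {1} (subst (2 ∣_) (+-comm 1 (2 * k)) 2∣) (m∣m*n k))
... | ()

coprime-* : ∀ {d m n} → Coprime d m → Coprime d n → Coprime d (m * n)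
coprime-* d⊥m d⊥n (c∣d , c∣mn) = d⊥n (c∣d , coprime-divisor (λ (e∣c , e∣m) → d⊥m (∣-trans e∣c c∣d , e∣m)) c∣mn)

1≉0 : ¬ (1 ≈ 0 [ 2 ])
1≉0 p with ≈-< (s≤s (s≤s z≤n)) (s≤s z≤n) p
... | ()

Split : ℕ → ℕ → Set
Split d q = ∃ λ y → y < q × y * y + d ≈ 0 [ q ]

Split? : ∀ d q → Dec (Split d q)
Split? d q = anyUpTo? (λ y → y * y + d ≈? 0 [ q ]) q

Bad : ℕ → ℕ → Set
Bad d q = Prime q × q ≢ 2 × (q ∣ d ⊎ ¬ Split d q)

Bad? : ∀ d q → Dec (Bad d q)
Bad? d q = prime? q ×-dec (¬? (q ≟ 2) ×-dec (q ∣? d ⊎-dec ¬? (Split? d q)))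

prime-odd : ∀ {q} → Prime q → q ≢ 2 → ¬ 2 ∣ q
prime-odd pq q≢2 2∣q with prime⇒irreducible pq 2∣q
... | inj₁ ()
... | inj₂ 2≡q = q≢2 (sym 2≡q)

-- The weight that stands for `X / q` in sums of reciprocals; the value at 0 is a default that keeps
-- it total.
quot : ℕ → ℕ → ℕ
quot X zero    = 0
quot X (suc q) = X / suc q

quot*≤ : ∀ X q → quot X q * q ≤ X
quot*≤ X zero    = z≤n
quot*≤ X (suc q) = m/n*n≤m X (suc q)

quot-≥ : ∀ X q → 0 < q → q ≤ X → X ≤ 2 * (quot X q * q)
quot-≥ X (suc q) _ q≤X = begin
  X  ≡⟨ m≡m%n+[m/n]*n X (suc q) ⟩
  X % suc q + X / suc q * suc q  ≤⟨ +-monoˡ-≤ (X / suc q * suc q) (<⇒≤ (m%n<n X (suc q))) ⟩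
  suc q + X / suc q * suc q  ≤⟨ +-monoˡ-≤ (X / suc q * suc q) (m≤n*m (suc q) (X / suc q) {{>-nonZero (m≥n⇒m/n>0 q≤X)}}) ⟩
  X / suc q * suc q + X / suc q * suc q  ≡⟨ cong (X / suc q * suc q +_) (sym (+-identityʳ (X / suc q * suc q))) ⟩
  2 * (X / suc q * suc q)  ∎
  where open ≤-Reasoning

module Supply (h : ℕ) (h-odd : h ≈ 1 [ 2 ]) where
  open HalfSystem h using () renaming (n to d)
  open HalfSystem h using (signs-*; signs-cong; signs-square; signs-neg; signs≡1)

  Positive : ℕ → Set
  Positive a = Coprime d a × signs h a ≈ 0 [ 2 ]

  Positive? : ∀ a → Dec (Positive a)
  Positive? a = coprime? d a ×-dec (signs h a ≈? 0 [ 2 ])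

  no-bad-prime⇒positive : ∀ n → 0 < n → ¬ 2 ∣ n → (∀ q → q ∣ n → ¬ Bad d q) → Positive n
  no-bad-prime⇒positive = <-rec _ go
    where
    go : ∀ n → (∀ {m} → m < n → 0 < m → ¬ 2 ∣ m → (∀ q → q ∣ m → ¬ Bad d q) → Positive m) →
         0 < n → ¬ 2 ∣ n → (∀ q → q ∣ n → ¬ Bad d q) → Positive n
    go 1 rec _ _ _ = (λ (_ , c∣1) → ∣1⇒≡1 c∣1) , ≈-reflexive signs≡1
    go n@(suc (suc _)) rec 0<n n-odd good with ∃prime∣ n (s<s z<s)
    ... | q , pq , divides m n≡ = subst Positive (sym n≡) (coprime-* d⊥m d⊥q ,
            ≈-trans (signs-* m q d⊥m d⊥q) (≈-+ (proj₂ ih) q-positive))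
      where
      m∣n : m ∣ n
      m∣n = divides q (trans n≡ (*-comm m q))
      q∣n : q ∣ n
      q∣n = divides m n≡
      0<m : 0 < m
      0<m = n≢0⇒n>0 (λ m≡0 → <⇒≢ 0<n (sym (trans n≡ (cong (_* q) m≡0))))
      m<n : m < n
      m<n = subst (m <_) (sym n≡) (m<m*n m q {{>-nonZero 0<m}} (prime>1 pq))
      ih : Positive m
      ih = rec m<n 0<m (λ 2∣m → n-odd (∣-trans 2∣m m∣n)) (λ p p∣m → good p (∣-trans p∣m m∣n))
      d⊥m : Coprime d m
      d⊥m = proj₁ ih
      q≢2 : q ≢ 2
      q≢2 refl = n-odd q∣n
      d⊥q : Coprime d q
      d⊥q = coprime-sym (prime∤⇒coprime pq (λ q∣d → good q q∣n (pq , q≢2 , inj₁ q∣d)))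
      q-positive : signs h q ≈ 0 [ 2 ]
      q-positive with Split? d q
      ... | no ¬s = contradiction (pq , q≢2 , inj₂ ¬s) (good q q∣n)
      ... | yes (y , _ , sq) with odd⇒suc-double q (prime-odd pq q≢2)
      ...   | k , refl = signs-of-split h k y h-odd d⊥q sq

  module _ (κ : ℕ) .{{_ : NonZero κ}} (d⊥2 : Coprime d 2) (G≤ : ∑gcd d ≤ κ * κ) (κ≤d : 272 * κ ≤ d) where
    φ : ℕ
    φ = ∑ d (λ x → 𝟙 (coprime? d x))

    #Positive : ℕ
    #Positive = ∑ d (λ a → 𝟙 (Positive? a))

    #B : ℕ
    #B = ∑ (256 * κ) (λ j → 𝟙 (Positive? (2 * j + 1)))

    -- Multiplication by -1 maps positive residues to non-positive ones, as d ≡ 3 mod 4.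
    half : #Positive + #Positive ≤ φ
    half = begin
      #Positive + #Positive  ≡⟨ cong (#Positive +_) (sym (∑-perm d 1 neg (λ a → 𝟙 (Positive? a)) (λ a _ → 𝟙≤1 (Positive? a)) (λ a _ → m%n<n (2 * h * a) d)
          (λ a< b< p → ≈-< a< b< (≈-cancel (2 * h) d⊥2h (%⇒≈ p))))) ⟩
      #Positive + ∑ d (λ a → 𝟙 (Positive? (neg a)))  ≡⟨ ∑-+ d (λ a → 𝟙 (Positive? a)) (λ a → 𝟙 (Positive? (neg a))) ⟨
      ∑ d (λ a → 𝟙 (Positive? a) + 𝟙 (Positive? (neg a)))  ≤⟨ ∑-mono d (λ a _ → at a) ⟩
      φ  ∎
      where
      open ≤-Reasoning
      neg : ℕ → ℕ
      neg a = (2 * h * a) % d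
      d⊥2h : Coprime d (2 * h)
      d⊥2h {c} (c∣d , c∣2h) = ∣1⇒≡1 (∣m+n∣m⇒∣n {c} {2 * h} {1} (subst (c ∣_) (+-comm 1 (2 * h)) c∣d) c∣2h)
      at : ∀ a → 𝟙 (Positive? a) + 𝟙 (Positive? (neg a)) ≤ 𝟙 (coprime? d a)
      at a with Positive? a
      ... | no _ = 𝟙-mono (Positive? (neg a)) (coprime? d a) (λ (d⊥na , _) (c∣d , c∣a) →
              d⊥na (c∣d , ≈⇒∣ (≈-∣ c∣d (≈-sym (%-≈ (2 * h * a) d))) (∣n⇒∣m*n (2 * h) c∣a)))
      ... | yes (d⊥a , pa) = ≤-reflexive (trans (cong (1 +_) (𝟙-no (Positive? (neg a)) (λ (_ , pna) → 1≉0
              (≈-trans (≈-trans (≈-sym h-odd) (≈-trans (≈-reflexive (trans (sym signs-neg) (sym (+-identityʳ (signs h (2 * h)))))) (≈-+ (≈-refl {a = signs h (2 * h)}) (≈-sym pa))))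
                (≈-trans (≈-sym (signs-* (2 * h) a d⊥2h d⊥a)) (≈-trans (≈-reflexive (signs-cong (≈-sym (%-≈ (2 * h * a) d)))) pna))))))
              (sym (𝟙-yes (coprime? d a) d⊥a)))

    -- The class of `n x⁻²` has the symbol of `n`, because the square of a unit has symbol 1.
    hit : ∀ n x → Positive n → Coprime d x → ∃ λ a → a < d × Positive a × a * (x * x) ≈ n [ d ]
    hit n x (d⊥n , pn) d⊥x = a , m%n<n (n * (x̄ * x̄)) d , (d⊥a , pa) , ax²≈n
      where
      x̄ = proj₁ (inverse {d} x d⊥x)
      a = (n * (x̄ * x̄)) % d
      ax²≈n : a * (x * x) ≈ n [ d ]
      ax²≈n = ≈-trans (≈-*ʳ (x * x) (%-≈ (n * (x̄ * x̄)) d)) (≈-trans (≈-reflexive (lem n x̄ x))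
        (≈-trans (≈-*ˡ n (≈-* (proj₂ (inverse {d} x d⊥x)) (proj₂ (inverse {d} x d⊥x)))) (≈-reflexive (*-identityʳ n))))
        where lem : ∀ n y x → n * (y * y) * (x * x) ≡ n * ((x * y) * (x * y))
              lem = solve-∀
      d⊥a : Coprime d a
      d⊥a (c∣d , c∣a) = d⊥n (c∣d , ≈⇒∣ (≈-∣ c∣d ax²≈n) (∣m⇒∣m*n (x * x) c∣a))
      pa : signs h a ≈ 0 [ 2 ]
      pa = ≈-trans (≈-reflexive (sym (+-identityʳ (signs h a)))) (≈-trans (≈-+ (≈-refl {a = signs h a}) (≈-sym (signs-square x d⊥x)))
        (≈-trans (≈-sym (signs-* a (x * x) d⊥a (coprime-* d⊥x d⊥x))) (≈-trans (≈-reflexive (signs-cong ax²≈n)) pn)))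

    private
      F : ℕ → ℕ → ℕ → ℕ
      F x j a = 𝟙 (Positive? a) * 𝟙 (a * (x * x) ≈? 2 * j + 1 [ d ])

    -- Pairs of a unit `x` and a positive `n = 2 j + 1` are counted through `n ≡ a x²` with `a`
    -- positive. For each fixed `a` the bound `upper` applies, so no estimate of a character sum
    -- over `n` is used.
    φ*#B : φ * #B ≤ #Positive * (281 * κ)
    φ*#B = begin
      φ * #B
        ≡⟨ ∑-product d (256 * κ) (λ x → 𝟙 (coprime? d x)) (λ j → 𝟙 (Positive? (2 * j + 1))) ⟩
      ∑ d (λ x → ∑ (256 * κ) (λ j → 𝟙 (coprime? d x) * 𝟙 (Positive? (2 * j + 1))))
        ≤⟨ ∑-mono d (λ x _ → ∑-mono (256 * κ) (λ j _ → at x j)) ⟩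
      ∑ d (λ x → ∑ (256 * κ) (λ j → ∑ d (F x j)))
        ≡⟨ ∑-cong d (λ x _ → ∑-swap (256 * κ) d (F x)) ⟩
      ∑ d (λ x → ∑ d (λ a → ∑ (256 * κ) (λ j → F x j a)))
        ≡⟨ ∑-swap d d (λ x a → ∑ (256 * κ) (λ j → F x j a)) ⟩
      ∑ d (λ a → ∑ d (λ x → ∑ (256 * κ) (λ j → F x j a)))
        ≡⟨ ∑-cong d (λ a _ → trans (∑-swap d (256 * κ) (λ x j → F x j a))
             (trans (∑-cong (256 * κ) (λ j _ → ∑-*ˡ d (𝟙 (Positive? a)) (λ x → 𝟙 (a * (x * x) ≈? 2 * j + 1 [ d ]))))
               (∑-*ˡ (256 * κ) (𝟙 (Positive? a)) (#sols d a 2 1)))) ⟩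
      ∑ d (λ a → 𝟙 (Positive? a) * ∑ (256 * κ) (#sols d a 2 1))
        ≤⟨ ∑-mono d (λ a _ → per-class a) ⟩
      ∑ d (λ a → 𝟙 (Positive? a) * (281 * κ))
        ≡⟨ ∑-*ʳ d (281 * κ) (λ a → 𝟙 (Positive? a)) ⟩
      #Positive * (281 * κ) ∎
      where
      open ≤-Reasoning
      at : ∀ x j → 𝟙 (coprime? d x) * 𝟙 (Positive? (2 * j + 1)) ≤ ∑ d (F x j)
      at x j = ≤-trans (≤-reflexive (𝟙-× (coprime? d x) (Positive? (2 * j + 1))))
        (≤-trans (𝟙≤∑ (coprime? d x ×-dec Positive? (2 * j + 1)) d (λ a → Positive? a ×-dec (a * (x * x) ≈? 2 * j + 1 [ d ]))
            (λ (d⊥x , pn) → hit (2 * j + 1) x pn d⊥x))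
          (≤-reflexive (∑-cong d (λ a _ → sym (𝟙-× (Positive? a) (a * (x * x) ≈? 2 * j + 1 [ d ]))))))
      per-class : ∀ a → 𝟙 (Positive? a) * ∑ (256 * κ) (#sols d a 2 1) ≤ 𝟙 (Positive? a) * (281 * κ)
      per-class a with Positive? a
      ... | no _ = z≤n
      ... | yes (d⊥a , _) = +-monoˡ-≤ 0 (Equidistribution.upper d a 2 d⊥2 d⊥a d⊥2 κ G≤ κ≤d 1)

    #B≤ : 2 * #B ≤ 281 * κ
    #B≤ = *-cancelˡ-≤ φ {{>-nonZero 0<φ}} (begin
      φ * (2 * #B)  ≡⟨ lem φ #B ⟩
      φ * #B + φ * #B  ≤⟨ +-mono-≤ φ*#B φ*#B ⟩
      #Positive * (281 * κ) + #Positive * (281 * κ)  ≡⟨ *-distribʳ-+ (281 * κ) #Positive #Positive ⟨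
      (#Positive + #Positive) * (281 * κ)  ≤⟨ *-monoˡ-≤ (281 * κ) half ⟩
      φ * (281 * κ)  ∎)
      where
      open ≤-Reasoning
      lem : ∀ x y → x * (2 * y) ≡ x * y + x * y
      lem = solve-∀
      0<φ : 0 < φ
      0<φ = ≤-trans (≤-reflexive (sym (𝟙-yes (coprime? d 1) (λ (_ , c∣1) → ∣1⇒≡1 c∣1))))
        (∑-term (λ x → 𝟙 (coprime? d x)) (≤-trans (≤-trans (s≤s (s≤s z≤n)) (m≤m*n 272 κ)) κ≤d))

    -- At most `281 κ / 2` of the `256 κ` odd `n < X` have symbol 1, so at least `231 κ / 2` of them
    -- have a bad prime factor. The accuracy of `upper` matters: `512 - 281 = 231` has to exceed the
    -- 174 that `one-of-three` can lose.
    bad-prime-supply : 231 * κ ≤ 2 * ∑ (512 * κ) (λ q → 𝟙 (Bad? d q) * quot (512 * κ) q)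
    bad-prime-supply = ≤-by {l = 2 * (256 * κ) + 2 * #B} {r = 2 * (#B + T) + 281 * κ} 0
        (+-mono-≤ (*-monoʳ-≤ 2 cover) #B≤) (lem κ #B T)
      where
      open ≤-Reasoning
      X = 512 * κ
      T = ∑ X (λ q → 𝟙 (Bad? d q) * quot X q)
      lem : ∀ κ b t → 231 * κ + (2 * (b + t) + 281 * κ) + 0 ≡ 2 * t + (2 * (256 * κ) + 2 * b)
      lem = solve-∀
      one : ∀ j → j < 256 * κ → 1 ≤ 𝟙 (Positive? (2 * j + 1)) + ∑ X (λ q → 𝟙 (Bad? d q) * 𝟙 (q ∣? (2 * j + 1)))
      one j j< with anyUpTo? (λ q → Bad? d q ×-dec q ∣? (2 * j + 1)) X
      ... | yes (q , q<X , bad , q∣) = ≤-trans (≤-trans (≤-reflexive (sym (trans (𝟙-× (Bad? d q) (q ∣? (2 * j + 1))) (𝟙-yes (Bad? d q ×-dec q ∣? (2 * j + 1)) (bad , q∣)))))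
              (∑-term (λ q → 𝟙 (Bad? d q) * 𝟙 (q ∣? (2 * j + 1))) q<X)) (m≤n+m _ (𝟙 (Positive? (2 * j + 1))))
      ... | no none = ≤-trans (≤-reflexive (sym (𝟙-yes (Positive? (2 * j + 1)) (no-bad-prime⇒positive (2 * j + 1) (m≤n+m 1 (2 * j))
              (subst (λ z → ¬ 2 ∣ z) (+-comm 1 (2 * j)) (suc-double-odd j))
              (λ q q∣ bad → none (q , ≤-<-trans (∣⇒≤ {{>-nonZero (m≤n+m 1 (2 * j))}} q∣) n<X , bad , q∣)))))) (m≤m+n _ _)
        where
        n<X : 2 * j + 1 < X
        n<X = ≤-trans (≤-reflexive (lem₂ j)) (≤-trans (*-monoʳ-≤ 2 j<) (≤-reflexive (sym (*-assoc 2 256 κ))))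
          where lem₂ : ∀ j → suc (2 * j + 1) ≡ 2 * suc j
                lem₂ = solve-∀
      multiples : ∀ q → q < X → 𝟙 (Bad? d q) * ∑ (256 * κ) (λ j → 𝟙 (q ∣? (2 * j + 1))) ≤ 𝟙 (Bad? d q) * quot X q
      multiples q q<X with Bad? d q
      ... | no _ = z≤n
      -- `quot X q` blocks of `q` consecutive `j` already cover `j < 256 * κ`, as rounding `X / q`
      -- down loses at most half.
      ... | yes (pq , q≢2 , _) = +-monoˡ-≤ 0 (∑𝟙-class (256 * κ) q (quot X q) (λ j → q ∣? (2 * j + 1))
              (*-cancelˡ-≤ 2 (≤-trans (≤-reflexive (sym (*-assoc 2 256 κ))) (quot-≥ X q (<-trans z<s (prime>1 pq)) (<⇒≤ q<X))))
              (λ a b → ≈-cancel 2 q⊥2 (≈-+cancelʳ (≈-refl {a = 1}) (≈-trans (∣⇒≈0 a) (≈-sym (∣⇒≈0 b))))))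
        where
        q⊥2 : Coprime q 2
        q⊥2 = coprime-sym (prime∤⇒coprime prime[2] (prime-odd pq q≢2))
      cover : 256 * κ ≤ #B + T
      cover = begin
        256 * κ ≡⟨ *-identityʳ (256 * κ) ⟨
        256 * κ * 1 ≤⟨ ∑-≥const (256 * κ) 1 one ⟩
        ∑ (256 * κ) (λ j → 𝟙 (Positive? (2 * j + 1)) + ∑ X (λ q → 𝟙 (Bad? d q) * 𝟙 (q ∣? (2 * j + 1))))
          ≡⟨ ∑-+ (256 * κ) (λ j → 𝟙 (Positive? (2 * j + 1))) (λ j → ∑ X (λ q → 𝟙 (Bad? d q) * 𝟙 (q ∣? (2 * j + 1)))) ⟩
        #B + ∑ (256 * κ) (λ j → ∑ X (λ q → 𝟙 (Bad? d q) * 𝟙 (q ∣? (2 * j + 1))))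
          ≡⟨ cong (#B +_) (trans (∑-swap (256 * κ) X (λ j q → 𝟙 (Bad? d q) * 𝟙 (q ∣? (2 * j + 1)))) (∑-cong X (λ q _ → ∑-*ˡ (256 * κ) (𝟙 (Bad? d q)) (λ j → 𝟙 (q ∣? (2 * j + 1)))))) ⟩
        #B + ∑ X (λ q → 𝟙 (Bad? d q) * ∑ (256 * κ) (λ j → 𝟙 (q ∣? (2 * j + 1))))
          ≤⟨ +-monoʳ-≤ #B (∑-mono X multiples) ⟩
        #B + T ∎

-- Local obstructions

square-abs : ∀ i → i ℤ.* i ≡ ℤ.+ (ℤ.∣ i ∣ * ℤ.∣ i ∣)
square-abs (ℤ.+ n)      = sym (ℤₚ.pos-* n n)
square-abs (ℤ.-[1+ n ]) = refl

/1-≃ : ∀ n → ℚ.toℚᵘ (ℤ.+ n ℚ./ 1) ℚᵘ.≃ ℚᵘ.mkℚᵘ (ℤ.+ n) 0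
/1-≃ n = ℚₚ.toℚᵘ-fromℚᵘ (ℚᵘ.mkℚᵘ (ℤ.+ n) 0)

RepQ⇒ℕ : ∀ d r → RepQ d r → ∃ λ u → ∃₂ λ v w → 0 < w × r * (w * w) ≡ u * u + d * (v * v)
RepQ⇒ℕ d r (α@(ℚ.mkℚ n₁ a-1 _) , β@(ℚ.mkℚ n₂ b-1 _) , eq) = x * b , y * a , a * b , s≤s z≤n , cleared
  where
  x = ℤ.∣ n₁ ∣
  y = ℤ.∣ n₂ ∣
  a = suc a-1
  b = suc b-1
  A = ℚᵘ.mkℚᵘ n₁ a-1
  B = ℚᵘ.mkℚᵘ n₂ b-1
  D = ℚᵘ.mkℚᵘ (ℤ.+ d) 0
  rational : ℚᵘ.mkℚᵘ (ℤ.+ r) 0 ℚᵘ.≃ A ℚᵘ.* A ℚᵘ.+ D ℚᵘ.* (B ℚᵘ.* B)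
  rational = begin-equality
    ℚᵘ.mkℚᵘ (ℤ.+ r) 0  ≃⟨ /1-≃ r ⟨
    ℚ.toℚᵘ (ℤ.+ r ℚ./ 1)  ≡⟨ cong ℚ.toℚᵘ eq ⟩
    ℚ.toℚᵘ (α ℚ.* α ℚ.+ (ℤ.+ d ℚ./ 1) ℚ.* (β ℚ.* β))  ≃⟨ ℚₚ.toℚᵘ-homo-+ (α ℚ.* α) _ ⟩
    ℚ.toℚᵘ (α ℚ.* α) ℚᵘ.+ ℚ.toℚᵘ ((ℤ.+ d ℚ./ 1) ℚ.* (β ℚ.* β)) ≃⟨ ℚᵘₚ.+-cong (ℚₚ.toℚᵘ-homo-* α α) (ℚᵘₚ.≃-trans (ℚₚ.toℚᵘ-homo-* (ℤ.+ d ℚ./ 1) (β ℚ.* β)) (ℚᵘₚ.*-cong (/1-≃ d) (ℚₚ.toℚᵘ-homo-* β β))) ⟩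
    A ℚᵘ.* A ℚᵘ.+ D ℚᵘ.* (B ℚᵘ.* B)  ∎
    where open ℚᵘₚ.≤-Reasoning
  integral : ℤ.+ r ℤ.* ℤ.+ (a * a * (1 * (b * b))) ≡ ((n₁ ℤ.* n₁) ℤ.* ℤ.+ (1 * (b * b)) ℤ.+ (ℤ.+ d ℤ.* (n₂ ℤ.* n₂)) ℤ.* ℤ.+ (a * a)) ℤ.* ℤ.+ 1
  integral = ℚᵘₚ.drop-*≡* rational
  natural : r * (a * a * (1 * (b * b))) ≡ (x * x) * (1 * (b * b)) + (d * (y * y)) * (a * a)
  natural = ℤₚ.+-injective (begin
    ℤ.+ (r * (a * a * (1 * (b * b))))  ≡⟨ ℤₚ.pos-* r _ ⟩
    ℤ.+ r ℤ.* ℤ.+ (a * a * (1 * (b * b)))  ≡⟨ trans integral (ℤₚ.*-identityʳ _) ⟩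
    (n₁ ℤ.* n₁) ℤ.* ℤ.+ (1 * (b * b)) ℤ.+ (ℤ.+ d ℤ.* (n₂ ℤ.* n₂)) ℤ.* ℤ.+ (a * a)
      ≡⟨ cong₂ (λ s t → s ℤ.* ℤ.+ (1 * (b * b)) ℤ.+ (ℤ.+ d ℤ.* t) ℤ.* ℤ.+ (a * a)) (square-abs n₁) (square-abs n₂) ⟩
    ℤ.+ (x * x) ℤ.* ℤ.+ (1 * (b * b)) ℤ.+ (ℤ.+ d ℤ.* ℤ.+ (y * y)) ℤ.* ℤ.+ (a * a)
      ≡⟨ cong₂ ℤ._+_ (ℤₚ.pos-* (x * x) _) (trans (ℤₚ.pos-* (d * (y * y)) (a * a)) (cong (ℤ._* ℤ.+ (a * a)) (ℤₚ.pos-* d (y * y)))) ⟨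
    ℤ.+ ((x * x) * (1 * (b * b))) ℤ.+ ℤ.+ ((d * (y * y)) * (a * a))  ≡⟨ ℤₚ.pos-+ ((x * x) * (1 * (b * b))) _ ⟨
    ℤ.+ ((x * x) * (1 * (b * b)) + (d * (y * y)) * (a * a))  ∎)
    where open ≡-Reasoning
  cleared : r * (a * b * (a * b)) ≡ x * b * (x * b) + d * (y * a * (y * a))
  cleared = trans (lem₁ r a b) (trans natural (lem₂ x y a b d))
    where
    lem₁ : ∀ r a b → r * (a * b * (a * b)) ≡ r * (a * a * (1 * (b * b)))
    lem₁ = solve-∀
    lem₂ : ∀ x y a b d → (x * x) * (1 * (b * b)) + (d * (y * y)) * (a * a) ≡ x * b * (x * b) + d * (y * a * (y * a))
    lem₂ = solve-∀

-- Infinite descent on the denominator `w`; each local obstruction becomes a divisibility check for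
-- one modulus.
descent : ∀ d r m → 1 < m →
  (∀ u v w → r * (w * w) ≡ u * u + d * (v * v) → m ∣ u × m ∣ v × m ∣ w) → ¬ RepQ d r
descent d r m 1<m div rep with RepQ⇒ℕ d r rep
... | u₀ , v₀ , w₀ , 0<w₀ , eq₀ = <-rec (λ w → 0 < w → ∀ u v → r * (w * w) ≡ u * u + d * (v * v) → ⊥) go w₀ 0<w₀ u₀ v₀ eq₀
  where
  instance m≢0 : NonZero m
           m≢0 = >-nonZero (<-trans z<s 1<m)
  go : ∀ w → (∀ {w′} → w′ < w → 0 < w′ → ∀ u v → r * (w′ * w′) ≡ u * u + d * (v * v) → ⊥) →
       0 < w → ∀ u v → r * (w * w) ≡ u * u + d * (v * v) → ⊥
  go w rec 0<w u v eq with div u v w eq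
  ... | divides u′ refl , divides v′ refl , divides w′ refl = rec (m<m*n w′ m {{>-nonZero 0<w′}} 1<m) 0<w′ u′ v′
      (*-cancelʳ-≡ (r * (w′ * w′)) _ (m * m) {{m*n≢0 m m}} (trans (lem₁ r w′ m) (trans eq (lem₂ u′ v′ m d))))
    where
    0<w′ : 0 < w′
    0<w′ = n≢0⇒n>0 (λ z → <⇒≢ 0<w (sym (cong (_* m) z)))
    lem₁ : ∀ r w m → r * (w * w) * (m * m) ≡ r * (w * m * (w * m))
    lem₁ = solve-∀
    lem₂ : ∀ u v m d → u * m * (u * m) + d * (v * m * (v * m)) ≡ (u * u + d * (v * v)) * (m * m)
    lem₂ = solve-∀

prime∣square : ∀ {p x} → Prime p → p ∣ x * x → p ∣ x
prime∣square {p} {x} pp h with euclidsLemma x x pp h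
... | inj₁ q = q
... | inj₂ q = q

-- If `q ∤ v`, then `u / v` is a square root of `- d` modulo `q`. Otherwise `q` divides `u` and `v`,
-- so `q² ∣ r w²`, and since `r` has only one factor `q`, another one falls to `w`.
¬RepQ-inert : ∀ {d q r} → Prime q → ¬ Split d q → q ∣ r → ¬ (q * q ∣ r) → ¬ RepQ d r
¬RepQ-inert {d} {q} {r} pq inert (divides r′ refl) q²∤r = descent d (r′ * q) q (prime>1 pq) div
  where
  instance q≢0 : NonZero q
           q≢0 = prime⇒nonZero pq
  div : ∀ u v w → r′ * q * (w * w) ≡ u * u + d * (v * v) → q ∣ u × q ∣ v × q ∣ w
  div u v w eq with q ∣? v
  ... | no q∤v = contradiction ((u * v̄) % q , m%n<n _ q , ≈-trans (≈-+ (≈-* (%-≈ (u * v̄) q) (%-≈ (u * v̄) q)) ≈-refl) root) inert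
    where
    v̄ = proj₁ (inverse {q} v (prime∤⇒coprime pq q∤v))
    vv̄ : v * v̄ ≈ 1 [ q ]
    vv̄ = proj₂ (inverse {q} v (prime∤⇒coprime pq q∤v))
    root : u * v̄ * (u * v̄) + d ≈ 0 [ q ]
    root = ≈-trans (≈-+ (≈-refl {a = u * v̄ * (u * v̄)}) (≈-trans (≈-reflexive (sym (*-identityʳ d))) (≈-*ˡ d (≈-sym (≈-* vv̄ vv̄)))))
      (≈-trans (≈-reflexive (trans (lem u v v̄ d) (trans (cong (_* (v̄ * v̄)) (sym eq)) (lem′ r′ q w v̄)))) (≈-+m 0 (r′ * (w * w) * (v̄ * v̄))))
      where
      lem : ∀ u v z d → u * z * (u * z) + d * ((v * z) * (v * z)) ≡ (u * u + d * (v * v)) * (z * z)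
      lem = solve-∀
      lem′ : ∀ r q w z → r * q * (w * w) * (z * z) ≡ r * (w * w) * (z * z) * q
      lem′ = solve-∀
  ... | yes q∣v@(divides v′ refl) = q∣u , q∣v , q∣w
    where
    q∣dv² : q ∣ d * (v′ * q * (v′ * q))
    q∣dv² = ∣n⇒∣m*n d (∣m⇒∣m*n (v′ * q) (n∣m*n v′))
    q∣u : q ∣ u
    q∣u = prime∣square pq (∣m+n∣m⇒∣n (subst (q ∣_) (trans eq (+-comm (u * u) _)) (∣m⇒∣m*n (w * w) (n∣m*n r′))) q∣dv²)
    q∣r′w² : q ∣ r′ * (w * w)
    q∣r′w² with q∣u
    ... | divides u′ refl = divides (u′ * u′ + d * (v′ * v′)) (*-cancelʳ-≡ _ _ q (trans (lem r′ q w) (trans eq (lem′ u′ v′ d q))))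
      where
      lem : ∀ r q w → r * (w * w) * q ≡ r * q * (w * w)
      lem = solve-∀
      lem′ : ∀ u v d q → u * q * (u * q) + d * (v * q * (v * q)) ≡ (u * u + d * (v * v)) * q * q
      lem′ = solve-∀
    q∣w : q ∣ w
    q∣w with euclidsLemma r′ (w * w) pq q∣r′w²
    ... | inj₁ q∣r′ = contradiction (*-monoˡ-∣ q q∣r′) q²∤r
    ... | inj₂ q∣w² = prime∣square pq q∣w²

-- `q` divides `u`, and cancelling one `q` leaves `r w² ≡ e v²` modulo `q`. A `w` prime to `q` would
-- make `r e ≡ (e v / w)²` a square.
¬RepQ-ramified : ∀ {q e r} → Prime q → Coprime q e → ¬ (∃ λ y → y < q × y * y ≈ r * e [ q ]) → ¬ RepQ (e * q) (r * q)
¬RepQ-ramified {q} {e} {r} pq cop nonsquare = descent (e * q) (r * q) q (prime>1 pq) div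
  where
  instance q≢0 : NonZero q
           q≢0 = prime⇒nonZero pq
  div : ∀ u v w → r * q * (w * w) ≡ u * u + e * q * (v * v) → q ∣ u × q ∣ v × q ∣ w
  div u v w eq = q∣u , q∣v , q∣w
    where
    q∣u : q ∣ u
    q∣u = prime∣square pq (∣m+n∣m⇒∣n (subst (q ∣_) (trans eq (+-comm (u * u) _)) (∣m⇒∣m*n (w * w) (n∣m*n r))) (∣m⇒∣m*n (v * v) (n∣m*n e)))
    u′ = quotient q∣u
    reduced : r * (w * w) ≡ u′ * u′ * q + e * (v * v)
    reduced = *-cancelʳ-≡ _ _ q (trans (lem r q w) (trans eq (trans (cong (λ z → z * z + e * q * (v * v)) (_∣_.equality q∣u)) (lem′ u′ v e q))))
      where
      lem : ∀ r q w → r * (w * w) * q ≡ r * q * (w * w)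
      lem = solve-∀
      lem′ : ∀ u v e q → u * q * (u * q) + e * q * (v * v) ≡ (u * u * q + e * (v * v)) * q
      lem′ = solve-∀
    rw²≈ : r * (w * w) ≈ e * (v * v) [ q ]
    rw²≈ = ≈-trans (≈-reflexive (trans reduced (+-comm (u′ * u′ * q) (e * (v * v))))) (≈-+m (e * (v * v)) (u′ * u′))
    q∣w : q ∣ w
    q∣w with q ∣? w
    ... | yes q∣w = q∣w
    ... | no q∤w = contradiction ((e * v * w̄) % q , m%n<n _ q , ≈-trans (≈-* (%-≈ (e * v * w̄) q) (%-≈ (e * v * w̄) q)) root) nonsquare
      where
      w̄ = proj₁ (inverse {q} w (prime∤⇒coprime pq q∤w))
      ww̄ : w * w̄ ≈ 1 [ q ]
      ww̄ = proj₂ (inverse {q} w (prime∤⇒coprime pq q∤w))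
      root : e * v * w̄ * (e * v * w̄) ≈ r * e [ q ]
      root = ≈-trans (≈-reflexive (lem e v w̄)) (≈-trans (≈-*ˡ (e * (w̄ * w̄)) (≈-sym rw²≈)) (≈-trans (≈-reflexive (lem′ e w w̄ r))
        (≈-trans (≈-*ˡ (r * e) (≈-* ww̄ ww̄)) (≈-reflexive (*-identityʳ (r * e))))))
        where
        lem : ∀ e v z → e * v * z * (e * v * z) ≡ e * (z * z) * (e * (v * v))
        lem = solve-∀
        lem′ : ∀ e w z r → e * (z * z) * (r * (w * w)) ≡ r * e * ((w * z) * (w * z))
        lem′ = solve-∀
    q∣v : q ∣ v
    q∣v = prime∣square pq (coprime-divisor cop (≈⇒∣ rw²≈ (∣n⇒∣m*n r (∣m⇒∣m*n w q∣w))))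

even-square : ∀ {x} → 2 ∣ x → x * x ≈ 0 [ 4 ]
even-square (divides k refl) = ∣⇒≈0 (divides (k * k) (lem k))
  where lem : ∀ k → k * 2 * (k * 2) ≡ k * k * 4
        lem = solve-∀

2∣n*suc-n : ∀ n → 2 ∣ n * suc n
2∣n*suc-n zero    = divides 0 refl
2∣n*suc-n (suc n) = subst (2 ∣_) (lem n) (∣m∣n⇒∣m+n (2∣n*suc-n n) (m∣m*n (suc n)))
  where lem : ∀ n → n * suc n + 2 * suc n ≡ suc n * suc (suc n)
        lem = solve-∀

odd-square : ∀ {x} → ¬ 2 ∣ x → x * x ≈ 1 [ 8 ]
odd-square {x} odd with odd⇒suc-double x odd
... | k , refl with 2∣n*suc-n k
...   | divides c eq = ≈-trans (≈-reflexive (trans (lem k) (trans (cong (λ z → 1 + 4 * z) eq) (lem′ c)))) (≈-+m 1 c)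
  where
  lem : ∀ k → suc (2 * k) * suc (2 * k) ≡ 1 + 4 * (k * suc k)
  lem = solve-∀
  lem′ : ∀ c → 1 + 4 * (c * 2) ≡ 1 + c * 8
  lem′ = solve-∀

4∣8 : 4 ∣ 8
4∣8 = divides 2 refl

odd-square₄ : ∀ {x} → ¬ 2 ∣ x → x * x ≈ 1 [ 4 ]
odd-square₄ odd = ≈-∣ 4∣8 (odd-square odd)

≉ : ∀ {a b} m {{_ : NonZero m}} → a % m ≢ b % m → ¬ a ≈ b [ m ]
≉ m h p = h (≈⇒% p)

-- With all squares 0 or 1 modulo 4, the congruence `3 w² ≡ u² + v²` has only the solution with
-- three zeros.
¬RepQ-1mod4 : ∀ {d r} → d ≈ 1 [ 4 ] → r ≈ 3 [ 4 ] → ¬ RepQ d r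
¬RepQ-1mod4 {d} {r} d≈1 r≈3 = descent d r 2 (s≤s (s≤s z≤n)) div
  where
  div : ∀ u v w → r * (w * w) ≡ u * u + d * (v * v) → 2 ∣ u × 2 ∣ v × 2 ∣ w
  div u v w eq = go (2 ∣? u) (2 ∣? v) (2 ∣? w)
    where
    with-squares : ∀ {a b c} → u * u ≈ a [ 4 ] → v * v ≈ b [ 4 ] → w * w ≈ c [ 4 ] → 3 * c ≈ a + 1 * b [ 4 ]
    with-squares p q s = ≈-trans (≈-sym (≈-* r≈3 s)) (≈-trans (≈-reflexive eq) (≈-+ p (≈-* d≈1 q)))
    go : Dec (2 ∣ u) → Dec (2 ∣ v) → Dec (2 ∣ w) → 2 ∣ u × 2 ∣ v × 2 ∣ w
    go (yes a) (yes b) (yes c) = a , b , c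
    go (yes a) (yes b) (no c)  = contradiction (with-squares (even-square a) (even-square b) (odd-square₄ c)) (≉ 4 λ ())
    go (yes a) (no b)  (yes c) = contradiction (with-squares (even-square a) (odd-square₄ b) (even-square c)) (≉ 4 λ ())
    go (yes a) (no b)  (no c)  = contradiction (with-squares (even-square a) (odd-square₄ b) (odd-square₄ c)) (≉ 4 λ ())
    go (no a)  (yes b) (yes c) = contradiction (with-squares (odd-square₄ a) (even-square b) (even-square c)) (≉ 4 λ ())
    go (no a)  (yes b) (no c)  = contradiction (with-squares (odd-square₄ a) (even-square b) (odd-square₄ c)) (≉ 4 λ ())
    go (no a)  (no b)  (yes c) = contradiction (with-squares (odd-square₄ a) (odd-square₄ b) (even-square c)) (≉ 4 λ ())
    go (no a)  (no b)  (no c)  = contradiction (with-squares (odd-square₄ a) (odd-square₄ b) (odd-square₄ c)) (≉ 4 λ ())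

-- For odd `u` and `w` the equation asks for `2 e v² ≡ 4` modulo 8, but `2 e v²` is 2 modulo 4 when
-- `v` is odd and 0 modulo 8 when `v` is even. Hence the choice of the class 5.
¬RepQ-even : ∀ {e r} → ¬ 2 ∣ e → r ≈ 5 [ 8 ] → ¬ RepQ (2 * e) r
¬RepQ-even {e} {r} e-odd r≈5 = descent (2 * e) r 2 (s≤s (s≤s z≤n)) div
  where
  div : ∀ u v w → r * (w * w) ≡ u * u + 2 * e * (v * v) → 2 ∣ u × 2 ∣ v × 2 ∣ w
  div u v w eq = go (2 ∣? w) (2 ∣? u)
    where
    even-rest : 2 ∣ 2 * e * (v * v)
    even-rest = ∣m⇒∣m*n (v * v) (m∣m*n e)
    2∣v-from : 2 * e * (v * v) ≈ 0 [ 4 ] → 2 ∣ v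
    2∣v-from p with euclidsLemma e (v * v) prime[2] (*-cancelˡ-∣ 2 (subst (4 ∣_) (*-assoc 2 e (v * v)) (≈0⇒∣ p)))
    ... | inj₁ 2∣e  = contradiction 2∣e e-odd
    ... | inj₂ 2∣v² = prime∣square prime[2] 2∣v²
    go : Dec (2 ∣ w) → Dec (2 ∣ u) → 2 ∣ u × 2 ∣ v × 2 ∣ w
    go (yes c) (yes a) = a , 2∣v-from (≈-sym (≈-trans (≈-trans (≈-sym (≈-trans (≈-*ˡ r (even-square c)) (≈-reflexive (*-zeroʳ r)))) (≈-reflexive eq)) (≈-+ (even-square a) ≈-refl))) , c
    go (yes c) (no a)  = contradiction (prime∣square prime[2] (∣m+n∣m⇒∣n (subst (2 ∣_) (trans eq (+-comm (u * u) _)) (∣n⇒∣m*n r (∣m⇒∣m*n w c))) even-rest)) a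
    go (no c)  (yes a) = contradiction (prime∣square prime[2] (coprime-divisor 2⊥r (subst (2 ∣_) (sym eq) (∣m∣n⇒∣m+n (∣m⇒∣m*n u a) even-rest)))) c
      where
      2⊥r : Coprime 2 r
      2⊥r = prime∤⇒coprime prime[2] (λ 2∣r → ≉ 2 (λ ()) (≈-trans (≈-sym (≈-∣ (divides 4 refl) r≈5)) (∣⇒≈0 2∣r)))
    go (no c)  (no a)  = contradiction (≈-trans main (≈-trans (≈-+ (≈-refl {a = 1}) tail≈0) (≈-refl {a = 1}))) (≉ 8 λ ())
      where
      main : 5 ≈ 1 + 2 * e * (v * v) [ 8 ]
      main = ≈-trans (≈-sym (≈-* r≈5 (odd-square c))) (≈-trans (≈-reflexive eq) (≈-+ (odd-square a) ≈-refl))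
      2∣v : 2 ∣ v
      2∣v = 2∣v-from (≈-+cancelˡ 1 (≈-trans (≈-sym (≈-∣ 4∣8 main)) (≈-+m 1 1)))
      tail≈0 : 2 * e * (v * v) ≈ 0 [ 8 ]
      tail≈0 = ∣⇒≈0 (*-pres-∣ (m∣m*n {2} e) (≈0⇒∣ (even-square 2∣v)))

representable-zero : ∀ d → RepQ d 0
representable-zero d = ℚ.0ℚ , ℚ.0ℚ , sym (trans (ℚₚ.+-identityˡ _) (ℚₚ.*-zeroʳ (ℤ.+ d ℚ./ 1)))

-- Positivity of the residue follows from non-representability, as `0 = 0² + d 0²`.
InD-intro : ∀ d x .{{_ : NonZero d}} → 4 * ((x * x) % d) < d → ¬ RepQ d ((x * x) % d) → InD d ((x * x) % d)
InD-intro d x 4r<d ¬rep = n≢0⇒n>0 (λ r≡0 → ¬rep (subst (RepQ d) (sym r≡0) (representable-zero d))) , 4r<d , (ℤ.+ x , square) , ¬rep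
  where
  r = (x * x) % d
  square : d ∣ ℤ.∣ ℤ.+ x ℤ.* ℤ.+ x ℤ.- ℤ.+ r ∣
  square = subst (λ z → d ∣ ℤ.∣ z ∣) (sym (trans (cong (ℤ._- ℤ.+ r) (sym (ℤₚ.pos-* x x))) (trans (ℤₚ.m-n≡m⊖n (x * x) r) (ℤₚ.⊖-≥ (m%n≤m (x * x) d)))))
    (divides ((x * x) / d) (trans (cong (_∸ r) (m≡m%n+[m/n]*n (x * x) d)) (m+n∸m≡n r _)))

scaled-≤ : ∀ c d S → d ≤ suc c * S → (ℤ.+ 1 ℚ./ suc c) ℚ.* (ℤ.+ d ℚ./ 1) ℚ.≤ (ℤ.+ S ℚ./ 1)
scaled-≤ c d S h = ℚₚ.toℚᵘ-cancel-≤ (begin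
  ℚ.toℚᵘ ((ℤ.+ 1 ℚ./ suc c) ℚ.* (ℤ.+ d ℚ./ 1))  ≃⟨ ℚₚ.toℚᵘ-homo-* (ℤ.+ 1 ℚ./ suc c) (ℤ.+ d ℚ./ 1) ⟩
  ℚ.toℚᵘ (ℤ.+ 1 ℚ./ suc c) ℚᵘ.* ℚ.toℚᵘ (ℤ.+ d ℚ./ 1)  ≃⟨ ℚᵘₚ.*-cong (ℚₚ.toℚᵘ-fromℚᵘ (ℚᵘ.mkℚᵘ (ℤ.+ 1) c)) (/1-≃ d) ⟩
  ℚᵘ.mkℚᵘ (ℤ.+ 1) c ℚᵘ.* ℚᵘ.mkℚᵘ (ℤ.+ d) 0  ≤⟨ ℚᵘ.*≤* (subst₂ ℤ._≤_ (eq₁ d) (eq₂ S (suc c)) (ℤ.+≤+ h)) ⟩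
  ℚᵘ.mkℚᵘ (ℤ.+ S) 0  ≃⟨ /1-≃ S ⟨
  ℚ.toℚᵘ (ℤ.+ S ℚ./ 1)  ∎)
  where
  open ℚᵘₚ.≤-Reasoning
  eq₁ : ∀ d → ℤ.+ d ≡ (ℤ.+ 1 ℤ.* ℤ.+ d) ℤ.* ℤ.+ 1
  eq₁ d = sym (trans (ℤₚ.*-identityʳ _) (ℤₚ.*-identityˡ (ℤ.+ d)))
  eq₂ : ∀ S c → ℤ.+ (c * S) ≡ ℤ.+ S ℤ.* ℤ.+ (c * 1)
  eq₂ S c = trans (cong ℤ.+_ (trans (*-comm c S) (cong (S *_) (sym (*-identityʳ c))))) (ℤₚ.pos-* S (c * 1))

-- Residues with a given obstruction

∑𝟙-unique : ∀ {p} {P : ℕ → Set p} n (P? : ∀ i → Dec (P i)) B →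
  (∀ {i j} → i < n → j < n → P i → P j → i ≡ j) → (∀ i → i < n → P i → 1 ≤ B) → ∑ n (λ i → 𝟙 (P? i)) ≤ B
∑𝟙-unique n P? B unique h with ∑𝟙-witness n P?
... | inj₁ z             = ≤-trans (≤-reflexive z) z≤n
... | inj₂ (i , i<n , p) = ≤-trans (∑𝟙≤1 n P? unique) (h i i<n p)

quot-* : ∀ a q → 0 < q → quot (a * q) q ≡ a
quot-* a (suc q) _ = m*n/n≡m a (suc q)

coprime-divisors-* : ∀ {a b n} → Coprime a b → a ∣ n → b ∣ n → a * b ∣ n
coprime-divisors-* {a} {b} cop (divides k refl) b∣n = subst (a * b ∣_) (*-comm a k) (*-monoʳ-∣ a (coprime-divisor (coprime-sym cop) (subst (b ∣_) (*-comm k a) b∣n)))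

distinct-primes-coprime : ∀ {p q} → Prime p → Prime q → p ≢ q → Coprime p q
distinct-primes-coprime pp pq p≢q = prime∤⇒coprime pp (λ p∣q → case prime⇒irreducible pq p∣q of λ where
  (inj₁ p≡1) → <⇒≢ (prime>1 pp) (sym p≡1)
  (inj₂ p≡q) → p≢q p≡q)

odd-prime≥3 : ∀ {q} → Prime q → q ≢ 2 → 3 ≤ q
odd-prime≥3 pq q≢2 = ≤∧≢⇒< (prime>1 pq) (λ 2≡q → q≢2 (sym 2≡q))

Inert : ℕ → ℕ → Set
Inert d q = Prime q × q ≢ 2 × ¬ Split d q

Inert? : ∀ d q → Dec (Inert d q)
Inert? d q = prime? q ×-dec (¬? (q ≟ 2) ×-dec ¬? (Split? d q))

Ramified : ℕ → ℕ → Set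
Ramified d q = Prime q × q ≢ 2 × q ∣ d

Ramified? : ∀ d q → Dec (Ramified d q)
Ramified? d q = prime? q ×-dec (¬? (q ≟ 2) ×-dec q ∣? d)

inert⇒∤ : ∀ {d q} → Inert d q → ¬ q ∣ d
inert⇒∤ (pq , _ , inert) q∣d = inert (0 , <-trans z<s (prime>1 pq) , ∣⇒≈0 q∣d)

-- For `d = e q` and the residue `i q`, the necessary condition modulo `q` for representability.
-- Zero counts as a square, so the complement consists of nonzero classes.
SquareClass : ℕ → ℕ → ℕ → Set
SquareClass q e i = ∃ λ y → y < q × y * y ≈ i * e [ q ]

SquareClass? : ∀ q e i → Dec (SquareClass q e i)
SquareClass? q e i = anyUpTo? (λ y → y * y ≈? i * e [ q ]) q

-- q = 2k+1: every square is that of some y ≤ k.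
nonsquare-classes : ∀ k e → Coprime (suc (2 * k)) e → k ≤ ∑ (suc (2 * k)) (λ s → 𝟙 (¬? (SquareClass? (suc (2 * k)) e s)))
nonsquare-classes k e cop = ≤-by {l = q} {r = suc k + ∑ q (λ s → 𝟙 (¬? (SquareClass? q e s)))} 0
    (≤-trans (≤-reflexive (sym (*-identityʳ q))) (≤-trans (∑-≥const q 1 (λ s _ → either s)) (≤-trans (≤-reflexive (∑-+ q _ _)) (+-monoˡ-≤ _ squares))))
    (lem k (∑ q (λ s → 𝟙 (¬? (SquareClass? q e s)))))
  where
  open ≤-Reasoning
  q = suc (2 * k)
  lem : ∀ k z → k + (suc k + z) + 0 ≡ z + suc (2 * k)
  lem = solve-∀
  either : ∀ s → 1 ≤ ∑ (suc k) (λ y → 𝟙 (y * y ≈? s * e [ q ])) + 𝟙 (¬? (SquareClass? q e s))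
  either s with SquareClass? q e s
  ... | no _ = m≤n+m 1 _
  ... | yes (y , y<q , sq) with y ≤? k
  ...   | yes y≤k = ≤-trans (≤-trans (≤-reflexive (sym (𝟙-yes (y * y ≈? s * e [ q ]) sq))) (∑-term (λ y → 𝟙 (y * y ≈? s * e [ q ])) (s≤s y≤k))) (m≤m+n _ 0)
  ...   | no y≰k = ≤-trans (≤-trans (≤-reflexive (sym (𝟙-yes (z * z ≈? s * e [ q ]) (≈-trans z²≈y² sq)))) (∑-term (λ y → 𝟙 (y * y ≈? s * e [ q ])) (s≤s z≤k))) (m≤m+n _ 0)
    where
    z = q ∸ y
    z+y : z + y ≡ q
    z+y = m∸n+n≡m (<⇒≤ y<q)
    z≤k : z ≤ k
    z≤k = ≤-trans (∸-monoʳ-≤ q (≰⇒> y≰k)) (≤-reflexive (trans (cong (_∸ k) (cong (k +_) (+-identityʳ k))) (m+n∸m≡n k k)))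
    z²≈y² : z * z ≈ y * y [ q ]
    z²≈y² = ≈-+cancelˡ (z * y) (≈-trans (≈-reflexive (lem₁ z y)) (≈-trans (≈-trans (≈-*ˡ z (≈-reflexive z+y)) (≈-+m 0 z))
      (≈-sym (≈-trans (≈-reflexive (lem₂ z y)) (≈-trans (≈-*ˡ y (≈-reflexive z+y)) (≈-+m 0 y))))))
      where
      lem₁ : ∀ z y → z * y + z * z ≡ z * (z + y)
      lem₁ = solve-∀
      lem₂ : ∀ z y → z * y + y * y ≡ y * (z + y)
      lem₂ = solve-∀
  squares : ∑ q (λ s → ∑ (suc k) (λ y → 𝟙 (y * y ≈? s * e [ q ]))) ≤ suc k
  squares = begin
    ∑ q (λ s → ∑ (suc k) (λ y → 𝟙 (y * y ≈? s * e [ q ])))  ≡⟨ ∑-swap q (suc k) (λ s y → 𝟙 (y * y ≈? s * e [ q ])) ⟩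
    ∑ (suc k) (λ y → ∑ q (λ s → 𝟙 (y * y ≈? s * e [ q ])))  ≤⟨ ∑-≤const (suc k) 1 (λ y _ → ∑𝟙≤1 q (λ s → y * y ≈? s * e [ q ])
        (λ {i} {j} i< j< a b → ≈-< i< j< (≈-cancel e cop (subst₂ (_≈_[ q ]) (*-comm i e) (*-comm j e) (≈-trans (≈-sym a) b))))) ⟩
    suc k * 1  ≡⟨ *-identityʳ (suc k) ⟩
    suc k  ∎

floor-≥ : ∀ d c .{{_ : NonZero c}} → c ≤ d → ∃ λ m → m * c ≤ d × d ≤ 2 * (m * c)
floor-≥ d c@(suc _) c≤d = d / c , m/n*n≤m d c , quot-≥ d c (s≤s z≤n) c≤d

ceil-≤ : ∀ d c .{{_ : NonZero c}} → c ≤ d → ∃ λ m → d < m * c × m * c ≤ 2 * d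
ceil-≤ d c c≤d = suc (d / c) , subst (_< suc (d / c) * c) (sym (m≡m%n+[m/n]*n d c)) (+-monoˡ-< (d / c * c) (m%n<n d c)) ,
  ≤-trans (+-mono-≤ c≤d (m/n*n≤m d c)) (≤-reflexive (cong (d +_) (sym (+-identityʳ d))))

module Events (d κ : ℕ) .{{_ : NonZero d}} .{{_ : NonZero κ}} (d⊥2 : Coprime d 2) (G≤ : ∑gcd d ≤ κ * κ) (κ≤d : 272 * κ ≤ d) where
  residue : ℕ → ℕ
  residue x = (x * x) % d

  residue≡ : ∀ x {n} → x * x ≈ n [ d ] → n < d → residue x ≡ n
  residue≡ x p n<d = trans (≈⇒% p) (m<n⇒m%n≡m n<d)

  -- The obstruction at an inert prime q, and (Twisted) that at a prime q dividing d.
  Exact : ℕ → ℕ → Set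
  Exact q x = q ∣ residue x × ¬ (q * q ∣ residue x) × 4 * residue x < d

  Exact? : ∀ q x → Dec (Exact q x)
  Exact? q x = q ∣? residue x ×-dec (¬? (q * q ∣? residue x) ×-dec 4 * residue x <? d)

  Twisted : ℕ → ℕ → Set
  Twisted q x = q ∣ residue x × 4 * residue x < d × ¬ SquareClass q (quot d q) (quot (residue x) q)

  Twisted? : ∀ q x → Dec (Twisted q x)
  Twisted? q x = q ∣? residue x ×-dec (4 * residue x <? d ×-dec ¬? (SquareClass? q (quot d q) (quot (residue x) q)))

  exact⇒InD : ∀ {q x} → Inert d q → Exact q x → InD d (residue x)
  exact⇒InD {q} {x} (pq , _ , inert) (q∣r , q²∤r , 4r<d) = InD-intro d x 4r<d (¬RepQ-inert {d} {q} {residue x} pq inert q∣r q²∤r)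

  twisted⇒InD : ∀ {q x} → SquareFree d → Ramified d q → Twisted q x → InD d (residue x)
  twisted⇒InD {q} {x} sf (pq , _ , divides e d≡) (divides r r≡ , 4r<d , nonsquare) = InD-intro d x 4r<d
    (subst₂ (λ a b → ¬ RepQ a b) (sym d≡) (sym r≡) (¬RepQ-ramified {q} {e} {r} pq (squarefree-coprime pq (subst SquareFree d≡ sf))
      (subst₂ (λ a b → ¬ SquareClass q a b) (trans (cong (λ z → quot z q) d≡) (quot-* e q 0<q)) (trans (cong (λ z → quot z q) r≡) (quot-* r q 0<q)) nonsquare)))
    where 0<q = <-trans z<s (prime>1 pq)

  d⊥1 : Coprime d 1
  d⊥1 (_ , c∣1) = ∣1⇒≡1 c∣1

  module _ {q : ℕ} (q-inert : Inert d q) where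
    private
      pq = proj₁ q-inert
      d⊥q : Coprime d q
      d⊥q = coprime-sym (prime∤⇒coprime pq (inert⇒∤ q-inert))
      instance q≢0 : NonZero q
               q≢0 = prime⇒nonZero pq

    -- `3072 = 4 * 3 * 256`: the 4 keeps the multiples `q j` below `d / 4`, and the 3 uses `q ≥ 3`,
    -- by which the multiples of `q²` to be removed are indexed by a range a third as long. At least
    -- `3 * 232 - 281 = 415` times `m κ` values remain.
    exact-lower : 3072 * κ * q ≤ d → d ≤ 32 * (q * ∑ d (λ x → 𝟙 (Exact? q x)))
    exact-lower c≤d with floor-≥ d (3072 * κ * q) {{m*n≢0 (3072 * κ) q {{m*n≢0 3072 κ}}}} c≤d
    ... | m , mc≤d , d≤2mc = ≤-by {l = d + 32 * (q * (m * 3 * (232 * κ)))} {r = 2 * (m * (3072 * κ * q)) + 32 * (q * (A + m * (281 * κ)))} (7136 * (m * κ * q))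
        (+-mono-≤ d≤2mc (*-monoʳ-≤ 32 (*-monoʳ-≤ q total))) (lem d m κ q A)
      where
      open ≤-Reasoning
      A = ∑ d (λ x → 𝟙 (Exact? q x))
      M = m * 3 * (256 * κ)
      F : ℕ → ℕ
      F x = ∑ (m * (256 * κ)) (λ j → 𝟙 (1 * (x * x) ≈? q * q * j + 0 [ d ]))
      lem : ∀ d m κ q a → d + (2 * (m * (3072 * κ * q)) + 32 * (q * (a + m * (281 * κ)))) + 7136 * (m * κ * q) ≡ 32 * (q * a) + (d + 32 * (q * (m * 3 * (232 * κ))))
      lem = solve-∀
      4qj<d : ∀ j → j < M → 4 * (q * j) < d
      4qj<d j j<M = subst (_< d) (*-assoc 4 q j) (<-≤-trans (*-monoʳ-< (4 * q) {{m*n≢0 4 q}} j<M) (≤-trans (≤-reflexive (lem₁ m κ q)) mc≤d))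
        where
        lem₁ : ∀ m κ q → 4 * q * (m * 3 * (256 * κ)) ≡ m * (3072 * κ * q)
        lem₁ = solve-∀
      qj<d : ∀ j → j < M → q * j < d
      qj<d j j<M = ≤-<-trans (m≤n*m (q * j) 4) (4qj<d j j<M)
      solution : ∀ {x j} → 1 * (x * x) ≈ q * j + 0 [ d ] → x * x ≈ q * j [ d ]
      solution {x} {j} p = subst₂ (_≈_[ d ]) (*-identityˡ (x * x)) (+-identityʳ (q * j)) p
      at : ∀ x → ∑ M (λ j → 𝟙 (1 * (x * x) ≈? q * j + 0 [ d ])) ≤ 𝟙 (Exact? q x) + F x
      at x = ∑𝟙-unique M (λ j → 1 * (x * x) ≈? q * j + 0 [ d ]) _
        (λ {i} {j} i< j< a b → *-cancelˡ-≡ i j q (trans (sym (residue≡ x (solution {x} {i} a) (qj<d i i<))) (residue≡ x (solution {x} {j} b) (qj<d j j<)))) hit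
        where
        hit : ∀ j → j < M → 1 * (x * x) ≈ q * j + 0 [ d ] → 1 ≤ 𝟙 (Exact? q x) + F x
        hit j j<M p with q ∣? j
        ... | yes (divides j′ refl) = ≤-trans (≤-trans (≤-reflexive (sym (𝟙-yes (1 * (x * x) ≈? q * q * j′ + 0 [ d ]) (≈-trans p (≈-reflexive (lem₂ q j′))))))
                (∑-term {m * (256 * κ)} {j′} (λ j → 𝟙 (1 * (x * x) ≈? q * q * j + 0 [ d ])) (*-cancelˡ-< 3 _ _ (≤-<-trans (≤-trans (≤-reflexive (*-comm 3 j′)) (*-monoʳ-≤ j′ (odd-prime≥3 pq (proj₁ (proj₂ q-inert))))) (<-≤-trans j<M (≤-reflexive (lem₃ m κ))))))) (m≤n+m (F x) (𝟙 (Exact? q x)))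
          where
          lem₂ : ∀ q j → q * (j * q) + 0 ≡ q * q * j + 0
          lem₂ = solve-∀
          lem₃ : ∀ m κ → m * 3 * (256 * κ) ≡ 3 * (m * (256 * κ))
          lem₃ = solve-∀
        ... | no q∤j = ≤-trans (≤-reflexive (sym (𝟙-yes (Exact? q x) (subst (λ r → q ∣ r × ¬ (q * q ∣ r) × 4 * r < d) (sym (residue≡ x (solution {x} {j} p) (qj<d j j<M)))
                (m∣m*n j , (λ h → q∤j (*-cancelˡ-∣ q h)) , 4qj<d j j<M))))) (m≤m+n _ _)
      total : m * 3 * (232 * κ) ≤ A + m * (281 * κ)
      total = begin
        m * 3 * (232 * κ)  ≤⟨ Equidistribution.lower* d 1 q d⊥2 d⊥1 d⊥q κ G≤ κ≤d 0 (m * 3) ⟩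
        ∑ M (#sols d 1 q 0)  ≡⟨ ∑-swap M d (λ j x → 𝟙 (1 * (x * x) ≈? q * j + 0 [ d ])) ⟩
        ∑ d (λ x → ∑ M (λ j → 𝟙 (1 * (x * x) ≈? q * j + 0 [ d ])))  ≤⟨ ∑-mono d (λ x _ → at x) ⟩
        ∑ d (λ x → 𝟙 (Exact? q x) + F x)
          ≡⟨ ∑-+ d (λ x → 𝟙 (Exact? q x)) F ⟩
        A + ∑ d F
          ≡⟨ cong (A +_) (∑-swap d (m * (256 * κ)) (λ x j → 𝟙 (1 * (x * x) ≈? q * q * j + 0 [ d ]))) ⟩
        A + ∑ (m * (256 * κ)) (#sols d 1 (q * q) 0)  ≤⟨ +-monoʳ-≤ A (Equidistribution.upper* d 1 (q * q) d⊥2 d⊥1 (coprime-* d⊥q d⊥q) κ G≤ κ≤d 0 m) ⟩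
        A + m * (281 * κ)  ∎

  -- For an upper bound it is enough to count multiples of `q p` below `d / 4`, with
  -- `1024 = 4 * 256`. Rounding `m` up costs a factor 2, and `2 * 281 ≤ 1024`.
  exact-pair-below : ∀ {q p} → Inert d q → Inert d p → q ≢ p → ∀ m → d < m * (1024 * κ * (q * p)) → m * (1024 * κ * (q * p)) ≤ 2 * d →
    q * p * ∑ d (λ x → 𝟙 (Exact? q x) * 𝟙 (Exact? p x)) ≤ d
  exact-pair-below {q} {p} q-inert p-inert q≢p m d<mc mc≤2d = *-cancelˡ-≤ 1024 (≤-by {l = 1024 * (q * p * P) + 281 * (m * (1024 * κ * (q * p)))} {r = 1024 * (q * p * (m * (281 * κ))) + 281 * (2 * d)} (462 * d)
      (+-mono-≤ (*-monoʳ-≤ 1024 (*-monoʳ-≤ (q * p) total)) (*-monoʳ-≤ 281 mc≤2d)) (lem m κ q p P d))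
    where
    open ≤-Reasoning
    pq = proj₁ q-inert
    pp = proj₁ p-inert
    P = ∑ d (λ x → 𝟙 (Exact? q x) * 𝟙 (Exact? p x))
    lem : ∀ m κ q p P d → 1024 * (q * p * P) + (1024 * (q * p * (m * (281 * κ))) + 281 * (2 * d)) + 462 * d ≡ 1024 * d + (1024 * (q * p * P) + 281 * (m * (1024 * κ * (q * p))))
    lem = solve-∀
    d⊥qp : Coprime d (q * p)
    d⊥qp = coprime-* (coprime-sym (prime∤⇒coprime pq (inert⇒∤ q-inert))) (coprime-sym (prime∤⇒coprime pp (inert⇒∤ p-inert)))
    at : ∀ x → 𝟙 (Exact? q x) * 𝟙 (Exact? p x) ≤ ∑ (m * (256 * κ)) (λ j → 𝟙 (1 * (x * x) ≈? q * p * j + 0 [ d ]))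
    at x = ≤-trans (≤-reflexive (𝟙-× (Exact? q x) (Exact? p x))) (𝟙≤∑ (Exact? q x ×-dec Exact? p x) (m * (256 * κ)) (λ j → 1 * (x * x) ≈? q * p * j + 0 [ d ]) find)
      where
      find : Exact q x × Exact p x → ∃ λ j → j < m * (256 * κ) × 1 * (x * x) ≈ q * p * j + 0 [ d ]
      find ((q∣r , _ , 4r<d) , (p∣r , _)) with coprime-divisors-* (distinct-primes-coprime pq pp q≢p) q∣r p∣r
      ... | divides j r≡ = j , *-cancelʳ-< (4 * (q * p)) j _ (begin-strict
              j * (4 * (q * p))  ≡⟨ trans (lem₁ j (q * p)) (cong (4 *_) (sym r≡)) ⟩
              4 * residue x  <⟨ 4r<d ⟩
              d  <⟨ d<mc ⟩
              m * (1024 * κ * (q * p))  ≡⟨ lem₂ m κ (q * p) ⟩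
              m * (256 * κ) * (4 * (q * p))  ∎) ,
          ≈-trans (≈-reflexive (*-identityˡ (x * x))) (≈-trans (≈-sym (%-≈ (x * x) d)) (≈-reflexive (trans r≡ (trans (*-comm j (q * p)) (sym (+-identityʳ _))))))
        where
        lem₁ : ∀ j z → j * (4 * z) ≡ 4 * (j * z)
        lem₁ = solve-∀
        lem₂ : ∀ m κ z → m * (1024 * κ * z) ≡ m * (256 * κ) * (4 * z)
        lem₂ = solve-∀
    total : P ≤ m * (281 * κ)
    total = begin
      P  ≤⟨ ∑-mono d (λ x _ → at x) ⟩
      ∑ d (λ x → ∑ (m * (256 * κ)) (λ j → 𝟙 (1 * (x * x) ≈? q * p * j + 0 [ d ])))  ≡⟨ ∑-swap d (m * (256 * κ)) (λ x j → 𝟙 (1 * (x * x) ≈? q * p * j + 0 [ d ])) ⟩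
      ∑ (m * (256 * κ)) (#sols d 1 (q * p) 0)  ≤⟨ Equidistribution.upper* d 1 (q * p) d⊥2 d⊥1 d⊥qp κ G≤ κ≤d 0 m ⟩
      m * (281 * κ)  ∎

  exact-pair : ∀ {q p} → Inert d q → Inert d p → q ≢ p → 1024 * κ * (q * p) ≤ d →
    q * p * ∑ d (λ x → 𝟙 (Exact? q x) * 𝟙 (Exact? p x)) ≤ d
  exact-pair {q} {p} q-inert p-inert q≢p c≤d =
    let m , d<mc , mc≤2d = ceil-≤ d (1024 * κ * (q * p)) {{c≢0}} c≤d in exact-pair-below q-inert p-inert q≢p m d<mc mc≤2d
    where
    c≢0 : NonZero (1024 * κ * (q * p))
    c≢0 = m*n≢0 (1024 * κ) (q * p) {{m*n≢0 1024 κ}} {{m*n≢0 q p {{prime⇒nonZero (proj₁ q-inert)}} {{prime⇒nonZero (proj₁ p-inert)}}}}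

  prime∣residue⇒∣ : ∀ {q x} → Prime q → q ∣ d → q ∣ residue x → q ∣ x
  prime∣residue⇒∣ {q} {x} pq q∣d q∣r = prime∣square pq (≈⇒∣ (≈-∣ q∣d (%-≈ (x * x) d)) q∣r)

  -- A prime `q ∣ d` divides `x² mod d` only if it divides `x`, so `x` runs through multiples of
  -- `q p`; there are exactly `d / (q p)` of them, whatever the size of `q p`.
  twisted-pair : ∀ {q p} → Ramified d q → Ramified d p → q ≢ p → q * p * ∑ d (λ x → 𝟙 (Twisted? q x) * 𝟙 (Twisted? p x)) ≤ d
  twisted-pair {q} {p} (pq , _ , q∣d) (pp , _ , p∣d) q≢p with coprime-divisors-* (distinct-primes-coprime pq pp q≢p) q∣d p∣d
  ... | divides k d≡ = ≤-trans (*-monoʳ-≤ (q * p) (≤-trans (∑-mono d (λ x _ → ≤-trans (≤-reflexive (𝟙-× (Twisted? q x) (Twisted? p x)))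
            (𝟙-mono (Twisted? q x ×-dec Twisted? p x) (q * p ∣? x) (λ ((q∣r , _) , (p∣r , _)) →
              coprime-divisors-* (distinct-primes-coprime pq pp q≢p) (prime∣residue⇒∣ pq q∣d q∣r) (prime∣residue⇒∣ pp p∣d p∣r)))))
          (∑𝟙-class d (q * p) k (q * p ∣?_) (≤-reflexive d≡) (λ a b → ≈-trans (∣⇒≈0 a) (≈-sym (∣⇒≈0 b))))))
        (≤-reflexive (trans (*-comm (q * p) k) (sym d≡)))

module _ (e q κ : ℕ) .{{_ : NonZero e}} .{{_ : NonZero κ}} (pq : Prime q) (q≢2 : q ≢ 2) (q⊥e : Coprime q e)
  (e⊥2 : Coprime e 2) (Ge≤ : ∑gcd e ≤ κ * κ) (κ≤e : 272 * κ ≤ e)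
  (d⊥2 : Coprime (e * q) 2) (G≤ : ∑gcd (e * q) ≤ κ * κ) (κ≤d : 272 * κ ≤ e * q) where
  private
    k = proj₁ (odd⇒suc-double q (prime-odd pq q≢2))
    q≡ : q ≡ suc (2 * k)
    q≡ = proj₂ (odd⇒suc-double q (prime-odd pq q≢2))
    0<q : 0 < q
    0<q = <-trans z<s (prime>1 pq)
    instance q≢0 : NonZero q
             q≢0 = prime⇒nonZero pq
             d≢0 : NonZero (e * q)
             d≢0 = m*n≢0 e q
    open module Ev = Events (e * q) κ d⊥2 G≤ κ≤d
    open ≤-Reasoning
    e⊥q : Coprime e q
    e⊥q = coprime-sym q⊥e

  -- Take `x = y q` with residue `i q`; dividing by `q` leaves `q y² ≡ i` modulo `e`, so
  -- equidistribution is applied modulo `e` with coefficient and step both `q`. Each of the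
  -- `k ≥ q / 3` non-square classes of `i` modulo `q` is a progression of its own and needs about
  -- `κ` terms. Hence `i` must range up to about `κ q`, and `κ q²` must be below `d`.
  twisted-lower-below : ∀ m → m * (1024 * κ * (q * q)) ≤ e * q → e * q ≤ 2 * (m * (1024 * κ * (q * q))) →
    e * q ≤ 32 * (q * ∑ (e * q) (λ x → 𝟙 (Twisted? q x)))
  twisted-lower-below m mc≤d d≤2mc = *-cancelˡ-≤ 3 (≤-by {l = 3 * (e * q) + 96 * (q * (k * (m * (232 * κ)))) + 7424 * (q * (m * κ)) * q} {r = 3 * (2 * (m * (1024 * κ * (q * q)))) + 96 * (q * A) + 7424 * (q * (m * κ)) * (3 * k)} (1280 * (q * q * (m * κ)))
      (+-mono-≤ (+-mono-≤ (*-monoʳ-≤ 3 d≤2mc) (*-monoʳ-≤ 96 (*-monoʳ-≤ q total))) (*-monoʳ-≤ (7424 * (q * (m * κ))) q≤3k)) (lem (e * q) q k m κ A))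
    where
    A = ∑ (e * q) (λ x → 𝟙 (Twisted? q x))
    M = m * (256 * κ)
    lem : ∀ d q k m κ A → 3 * d + (3 * (2 * (m * (1024 * κ * (q * q)))) + 96 * (q * A) + 7424 * (q * (m * κ)) * (3 * k)) + 1280 * (q * q * (m * κ))
      ≡ 3 * (32 * (q * A)) + (3 * d + 96 * (q * (k * (m * (232 * κ)))) + 7424 * (q * (m * κ)) * q)
    lem = solve-∀
    0<k : 0 < k
    0<k = n≢0⇒n>0 (λ k≡0 → <⇒≢ (prime>1 pq) (sym (trans q≡ (cong (λ z → suc (2 * z)) k≡0))))
    q≤3k : q ≤ 3 * k
    q≤3k = ≤-trans (≤-reflexive q≡) (+-monoˡ-≤ (2 * k) 0<k)
    NS? : ∀ i → Dec (¬ SquareClass q e i)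
    NS? i = ¬? (SquareClass? q e i)
    P? : ∀ y i → Dec (¬ SquareClass q e i × q * (y * y) ≈ i [ e ])
    P? y i = NS? i ×-dec (q * (y * y) ≈? i [ e ])
    4iq<d : ∀ i → i < M * q → 4 * (i * q) < e * q
    4iq<d i i< = <-≤-trans (subst (_< 4 * q * (M * q)) (lem₁ q i) (*-monoʳ-< (4 * q) {{m*n≢0 4 q}} i<)) (≤-trans (≤-reflexive (lem₂ q m κ)) mc≤d)
      where
      lem₁ : ∀ q i → 4 * q * i ≡ 4 * (i * q)
      lem₁ = solve-∀
      lem₂ : ∀ q m κ → 4 * q * (m * (256 * κ) * q) ≡ m * (1024 * κ * (q * q))
      lem₂ = solve-∀
    i<e : ∀ i → i < M * q → i < e
    i<e i i< = *-cancelʳ-< q i e (≤-<-trans (m≤n*m (i * q) 4) (4iq<d i i<))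
    lift : ∀ y i → q * (y * y) ≈ i [ e ] → y * q * (y * q) ≈ i * q [ e * q ]
    lift y i (mk≈ {a} {b} p) = mk≈ {i = a} {b} (trans (lem₁ y q a e) (trans (cong (_* q) p) (lem₂ i b e q)))
      where
      lem₁ : ∀ y q a e → y * q * (y * q) + a * (e * q) ≡ (q * (y * y) + a * e) * q
      lem₁ = solve-∀
      lem₂ : ∀ i b e q → (i + b * e) * q ≡ i * q + b * (e * q)
      lem₂ = solve-∀
    at : ∀ y → ∑ (M * q) (λ i → 𝟙 (P? y i)) ≤ 𝟙 (Twisted? q (y * q))
    at y = ∑𝟙-unique (M * q) (P? y) _ (λ {i} {j} i< j< (_ , a) (_ , b) → ≈-< (i<e i i<) (i<e j j<) (≈-trans (≈-sym a) b)) hit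
      where
      hit : ∀ i → i < M * q → ¬ SquareClass q e i × q * (y * y) ≈ i [ e ] → 1 ≤ 𝟙 (Twisted? q (y * q))
      hit i i< (ns , p) = ≤-reflexive (sym (𝟙-yes (Twisted? q (y * q)) (subst (q ∣_) (sym r≡) (n∣m*n i) , subst (λ r → 4 * r < e * q) (sym r≡) (4iq<d i i<) ,
          subst₂ (λ a b → ¬ SquareClass q a b) (sym (quot-* e q 0<q)) (sym (trans (cong (λ z → quot z q) r≡) (quot-* i q 0<q))) ns)))
        where
        r≡ : residue (y * q) ≡ i * q
        r≡ = residue≡ (y * q) (lift y i p) (≤-<-trans (m≤n*m (i * q) 4) (4iq<d i i<))
    periodic : ∀ s j → SquareClass q e (j * q + s) → SquareClass q e s
    periodic s j (y , y< , p) = y , y< , ≈-trans p (≈-*ʳ e (≈-trans (≈-reflexive (+-comm (j * q) s)) (≈-+m s j)))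
    split : ∀ y j s → 𝟙 (NS? s) * 𝟙 (q * (y * y) ≈? q * j + s [ e ]) ≤ 𝟙 (P? y (j * q + s))
    split y j s = ≤-trans (≤-reflexive (𝟙-× (NS? s) (q * (y * y) ≈? q * j + s [ e ]))) (𝟙-mono (NS? s ×-dec (q * (y * y) ≈? q * j + s [ e ])) (P? y (j * q + s))
      (λ (ns , p) → (λ c → ns (periodic s j c)) , ≈-trans p (≈-reflexive (cong (_+ s) (*-comm q j)))))
    total : k * (m * (232 * κ)) ≤ A
    total = begin
      k * (m * (232 * κ))  ≤⟨ *-monoˡ-≤ (m * (232 * κ)) (subst (λ z → k ≤ ∑ z (λ s → 𝟙 (¬? (SquareClass? z e s)))) (sym q≡) (nonsquare-classes k e (subst (λ z → Coprime z e) q≡ q⊥e))) ⟩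
      ∑ q (λ s → 𝟙 (NS? s)) * (m * (232 * κ))  ≡⟨ ∑-*ʳ q (m * (232 * κ)) (λ s → 𝟙 (NS? s)) ⟨
      ∑ q (λ s → 𝟙 (NS? s) * (m * (232 * κ)))  ≤⟨ ∑-mono q (λ s _ → *-monoʳ-≤ (𝟙 (NS? s)) (Equidistribution.lower* e q q e⊥2 e⊥q e⊥q κ Ge≤ κ≤e s m)) ⟩
      ∑ q (λ s → 𝟙 (NS? s) * ∑ M (#sols e q q s))  ≡⟨ ∑-cong q (λ s _ → trans (sym (∑-*ˡ M (𝟙 (NS? s)) (#sols e q q s))) (∑-cong M (λ j _ → sym (∑-*ˡ e (𝟙 (NS? s)) (λ y → 𝟙 (q * (y * y) ≈? q * j + s [ e ])))))) ⟩
      ∑ q (λ s → ∑ M (λ j → ∑ e (λ y → F y j s)))  ≡⟨ ∑-cong q (λ s _ → ∑-swap M e (λ j y → F y j s)) ⟩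
      ∑ q (λ s → ∑ e (λ y → ∑ M (λ j → F y j s)))  ≡⟨ ∑-swap q e (λ s y → ∑ M (λ j → F y j s)) ⟩
      ∑ e (λ y → ∑ q (λ s → ∑ M (λ j → F y j s)))  ≡⟨ ∑-cong e (λ y _ → ∑-swap q M (λ s j → F y j s)) ⟩
      ∑ e (λ y → ∑ M (λ j → ∑ q (λ s → F y j s)))  ≤⟨ ∑-mono e (λ y _ → ∑-mono M (λ j _ → ∑-mono q (λ s _ → split y j s))) ⟩
      ∑ e (λ y → ∑ M (λ j → ∑ q (λ s → 𝟙 (P? y (j * q + s)))))  ≡⟨ ∑-cong e (λ y _ → ∑-blocks M q (λ i → 𝟙 (P? y i))) ⟨
      ∑ e (λ y → ∑ (M * q) (λ i → 𝟙 (P? y i)))  ≤⟨ ∑-mono e (λ y _ → at y) ⟩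
      ∑ e (λ y → 𝟙 (Twisted? q (y * q)))  ≤⟨ ∑-inj e (e * q) (_* q) (λ x → 𝟙 (Twisted? q x)) (λ y y< → *-monoˡ-< q y<) (λ {i} {j} _ _ h → *-cancelʳ-≡ i j q h) ⟩
      A  ∎
      where
      F : ℕ → ℕ → ℕ → ℕ
      F y j s = 𝟙 (NS? s) * 𝟙 (q * (y * y) ≈? q * j + s [ e ])

  twisted-lower : 1024 * κ * (q * q) ≤ e * q → e * q ≤ 32 * (q * ∑ (e * q) (λ x → 𝟙 (Twisted? q x)))
  twisted-lower c≤d = let m , mc≤d , d≤2mc = floor-≥ (e * q) (1024 * κ * (q * q)) {{c≢0}} c≤d in twisted-lower-below m mc≤d d≤2mc
    where
    c≢0 : NonZero (1024 * κ * (q * q))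
    c≢0 = m*n≢0 (1024 * κ) (q * q) {{m*n≢0 1024 κ}} {{m*n≢0 q q}}

-- Inclusion–exclusion

crossing : ∀ (f : ℕ → ℕ) c n → f 0 < c → c ≤ f n → ∃ λ k → k < n × f k < c × c ≤ f (suc k)
crossing f c zero    lo hi = contradiction hi (<⇒≱ lo)
crossing f c (suc n) lo hi with c ≤? f n
... | yes h = let k , k<n , r = crossing f c n lo h in k , m<n⇒m<1+n k<n , r
... | no ¬h = n , ≤-refl , ≰⇒> ¬h , hi

-- The inequality [∪ Eᵢ] ≥ Σ [Eᵢ] − Σ_{j<i} [Eᵢ][Eⱼ] at one point, for indicators gᵢ ≤ [∪ Eᵢ] = u.
bonferroni : ∀ n u (g : ℕ → ℕ) → (∀ q → q < n → g q ≡ 0 ⊎ (g q ≡ 1 × 1 ≤ u)) →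
  ∑ n g ≤ u + ∑ n (λ q → g q * ∑ q g)
bonferroni zero    u g h = z≤n
bonferroni (suc n) u g h = case h n ≤-refl of λ where
    (inj₁ z)       → ≤-trans (≤-reflexive (trans (cong (∑ n g +_) z) (+-identityʳ _))) (≤-trans ih (+-monoʳ-≤ u (m≤m+n P (g n * ∑ n g))))
    (inj₂ (z , 1≤u)) → ≤-trans (+-mono-≤ (≤-reflexive (trans (sym (+-identityʳ _)) (cong (_* ∑ n g) (sym z)))) (≤-trans (≤-reflexive z) 1≤u))
                         (≤-trans (≤-reflexive (+-comm (g n * ∑ n g) u)) (+-monoʳ-≤ u (m≤n+m (g n * ∑ n g) P)))
  where
  P = ∑ n (λ q → g q * ∑ q g)
  ih : ∑ n g ≤ u + P
  ih = bonferroni n u g (λ q q<n → h q (m<n⇒m<1+n q<n))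

module Sieve {S : ℕ → Set} {E : ℕ → ℕ → Set} (S? : ∀ q → Dec (S q)) (E? : ∀ q x → Dec (E q x))
  (d X Y : ℕ) .{{_ : NonZero X}} (u : ℕ → ℕ)
  (S-range : ∀ q → q < Y → S q → 0 < q × q ≤ X)
  (S-lower : ∀ q → q < Y → S q → d ≤ 32 * (q * ∑ d (λ x → 𝟙 (E? q x))))
  (S-detect : ∀ q x → q < Y → S q → E q x → 1 ≤ u x) where

  open ≤-Reasoning

  #E : ℕ → ℕ
  #E q = ∑ d (λ x → 𝟙 (E? q x))

  v : ℕ → ℕ
  v q = 𝟙 (S? q) * quot X q

  A : ℕ → ℕ
  A q = ∑ d (λ x → 𝟙 (S? q) * 𝟙 (E? q x))

  U : ℕ
  U = ∑ d u

  d*v≤ : ∀ q → q < Y → d * v q ≤ 32 * X * A q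
  d*v≤ q q<Y = case S? q of λ where
      (no ¬s) → ≤-trans (≤-reflexive (trans (cong (λ z → d * (z * quot X q)) (𝟙-no (S? q) ¬s)) (*-zeroʳ d))) z≤n
      (yes s) → begin
        d * (𝟙 (S? q) * quot X q)  ≡⟨ cong (λ z → d * (z * quot X q)) (𝟙-yes (S? q) s) ⟩
        d * (1 * quot X q)  ≡⟨ cong (d *_) (*-identityˡ (quot X q)) ⟩
        d * quot X q  ≤⟨ *-monoˡ-≤ (quot X q) (S-lower q q<Y s) ⟩
        32 * (q * #E q) * quot X q  ≡⟨ lem q (#E q) (quot X q) ⟩
        32 * (quot X q * q) * #E q  ≤⟨ *-monoˡ-≤ (#E q) (*-monoʳ-≤ 32 (quot*≤ X q)) ⟩
        32 * X * #E q  ≡⟨ cong (32 * X *_) (trans (sym (*-identityˡ _)) (trans (cong (_* #E q) (sym (𝟙-yes (S? q) s))) (sym (∑-*ˡ d (𝟙 (S? q)) (λ x → 𝟙 (E? q x)))))) ⟩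
        32 * X * A q  ∎
    where
    lem : ∀ q a w → 32 * (q * a) * w ≡ 32 * (w * q) * a
    lem = solve-∀

  d*∑v≤ : ∀ n → n ≤ Y → d * ∑ n v ≤ 32 * X * ∑ n A
  d*∑v≤ n n≤Y = begin
    d * ∑ n v  ≡⟨ ∑-*ˡ n d v ⟨
    ∑ n (λ q → d * v q)  ≤⟨ ∑-mono n (λ q q<n → d*v≤ q (<-≤-trans q<n n≤Y)) ⟩
    ∑ n (λ q → 32 * X * A q)  ≡⟨ ∑-*ˡ n (32 * X) A ⟩
    32 * X * ∑ n A  ∎

  module Multiplicity (c : ℕ) (S-multiplicity : ∀ x → x < d → ∑ Y (λ q → 𝟙 (S? q) * 𝟙 (E? q x)) ≤ c) where
    -- For larger primes the product of two can exceed what `exact-pair` admits. Bounded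
    -- multiplicity replaces the pair bound and costs only the factor `c`; `8192 = 256 * 32`.
    sparse-union : ∀ σ V → σ ≡ ∑ Y v → V ≡ U → X ≤ 256 * σ → d ≤ 8192 * (c * V)
    sparse-union _ _ refl refl big = *-cancelʳ-≤ d _ X (begin
      d * X  ≤⟨ *-monoʳ-≤ d big ⟩
      d * (256 * ∑ Y v)  ≡⟨ lem₁ d (∑ Y v) ⟩
      256 * (d * ∑ Y v)  ≤⟨ *-monoʳ-≤ 256 (d*∑v≤ Y ≤-refl) ⟩
      256 * (32 * X * ∑ Y A)  ≤⟨ *-monoʳ-≤ 256 (*-monoʳ-≤ (32 * X) ∑A≤) ⟩
      256 * (32 * X * (c * U))  ≡⟨ lem₂ X (c * U) ⟩
      8192 * (c * U) * X  ∎)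
      where
      lem₁ : ∀ d z → d * (256 * z) ≡ 256 * (d * z)
      lem₁ = solve-∀
      lem₂ : ∀ X z → 256 * (32 * X * z) ≡ 8192 * z * X
      lem₂ = solve-∀
      at : ∀ x → x < d → ∑ Y (λ q → 𝟙 (S? q) * 𝟙 (E? q x)) ≤ c * u x
      at x x<d = case anyUpTo? (λ q → S? q ×-dec E? q x) Y of λ where
        (yes (q , q<Y , s , e)) → ≤-trans (S-multiplicity x x<d) (≤-trans (≤-reflexive (sym (*-identityʳ c))) (*-monoʳ-≤ c (S-detect q x q<Y s e)))
        (no none)               → ≤-trans (≤-reflexive (∑-zero Y (λ q q<Y → trans (𝟙-× (S? q) (E? q x)) (𝟙-no (S? q ×-dec E? q x) (λ (s , e) → none (q , q<Y , s , e)))))) z≤n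
      ∑A≤ : ∑ Y A ≤ c * U
      ∑A≤ = begin
        ∑ Y A  ≡⟨ ∑-swap Y d (λ q x → 𝟙 (S? q) * 𝟙 (E? q x)) ⟩
        ∑ d (λ x → ∑ Y (λ q → 𝟙 (S? q) * 𝟙 (E? q x)))  ≤⟨ ∑-mono d at ⟩
        ∑ d (λ x → c * u x)  ≡⟨ ∑-*ˡ d c u ⟩
        c * U  ∎

  module Pairs (S-pair : ∀ q p → q < Y → p < q → S q → S p → q * p * ∑ d (λ x → 𝟙 (E? q x) * 𝟙 (E? p x)) ≤ d) where
    g : ℕ → ℕ → ℕ
    g x q = 𝟙 (S? q) * 𝟙 (E? q x)

    A₂ : ℕ → ℕ → ℕ
    A₂ q p = ∑ d (λ x → g x q * g x p)

    g-cases : ∀ x q → q < Y → g x q ≡ 0 ⊎ (g x q ≡ 1 × 1 ≤ u x)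
    g-cases x q q<Y = case S? q ×-dec E? q x of λ where
      (yes (s , e)) → inj₂ (trans (𝟙-× (S? q) (E? q x)) (𝟙-yes (S? q ×-dec E? q x) (s , e)) , S-detect q x q<Y s e)
      (no ¬se)      → inj₁ (trans (𝟙-× (S? q) (E? q x)) (𝟙-no (S? q ×-dec E? q x) ¬se))

    -- The 4 is the loss from the two floors, a factor of at most 2 each.
    X²*A₂≤ : ∀ q p → q < Y → p < q → X * X * A₂ q p ≤ 4 * d * (v q * v p)
    X²*A₂≤ q p q<Y p<q = case S? q ×-dec S? p of λ where
        (no ¬s) → ≤-trans (≤-reflexive (trans (cong (X * X *_) (∑-zero d (λ x _ → zero-term ¬s x))) (*-zeroʳ (X * X)))) z≤n
        (yes (sq , sp)) → begin
          X * X * A₂ q p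
            ≤⟨ *-monoˡ-≤ (A₂ q p) (*-mono-≤ (quot-≥ X q (proj₁ (S-range q q<Y sq)) (proj₂ (S-range q q<Y sq)))
                 (quot-≥ X p (proj₁ (S-range p (<-trans p<q q<Y) sp)) (proj₂ (S-range p (<-trans p<q q<Y) sp)))) ⟩
          2 * (quot X q * q) * (2 * (quot X p * p)) * A₂ q p
            ≡⟨ lem (quot X q) q (quot X p) p (A₂ q p) ⟩
          4 * (q * p * A₂ q p) * (quot X q * quot X p)
            ≤⟨ *-monoˡ-≤ (quot X q * quot X p) (*-monoʳ-≤ 4 (≤-trans (*-monoʳ-≤ (q * p) (∑-mono d (λ x _ → *-mono-≤ (g≤ x q) (g≤ x p)))) (S-pair q p q<Y p<q sq sp))) ⟩
          4 * d * (quot X q * quot X p)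
            ≡⟨ cong₂ (λ a b → 4 * d * (a * b)) (unit q sq) (unit p sp) ⟩
          4 * d * (v q * v p) ∎
      where
      lem : ∀ a q b p z → 2 * (a * q) * (2 * (b * p)) * z ≡ 4 * (q * p * z) * (a * b)
      lem = solve-∀
      unit : ∀ q → S q → quot X q ≡ v q
      unit q s = trans (sym (*-identityˡ (quot X q))) (cong (_* quot X q) (sym (𝟙-yes (S? q) s)))
      g≤ : ∀ x q → g x q ≤ 𝟙 (E? q x)
      g≤ x q = ≤-trans (*-monoˡ-≤ (𝟙 (E? q x)) (𝟙≤1 (S? q))) (≤-reflexive (*-identityˡ _))
      zero-term : ¬ (S q × S p) → ∀ x → g x q * g x p ≡ 0
      zero-term ¬s x = case S? q of λ where
        (no ¬sq) → cong (λ z → z * 𝟙 (E? q x) * g x p) (𝟙-no (S? q) ¬sq)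
        (yes sq) → trans (cong (λ z → g x q * (z * 𝟙 (E? p x))) (𝟙-no (S? p) (λ sp → ¬s (sq , sp)))) (*-zeroʳ (g x q))

    A₂-sum : ℕ → ℕ
    A₂-sum n = ∑ n (λ q → ∑ q (λ p → A₂ q p))

    ∑A≤ : ∀ n → n ≤ Y → ∑ n A ≤ U + A₂-sum n
    ∑A≤ n n≤Y = begin
      ∑ n A  ≡⟨ ∑-swap n d (λ q x → g x q) ⟩
      ∑ d (λ x → ∑ n (g x))  ≤⟨ ∑-mono d (λ x _ → bonferroni n (u x) (g x) (λ q q<n → g-cases x q (<-≤-trans q<n n≤Y))) ⟩
      ∑ d (λ x → u x + ∑ n (λ q → g x q * ∑ q (g x)))  ≡⟨ ∑-+ d u (λ x → ∑ n (λ q → g x q * ∑ q (g x))) ⟩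
      U + ∑ d (λ x → ∑ n (λ q → g x q * ∑ q (g x)))  ≡⟨ cong (U +_) (trans (∑-swap d n (λ x q → g x q * ∑ q (g x))) (∑-cong n (λ q _ → trans (∑-cong d (λ x _ → sym (∑-*ˡ q (g x q) (g x)))) (∑-swap d q (λ x p → g x q * g x p))))) ⟩
      U + A₂-sum n  ∎

    X²*A₂-sum≤ : ∀ n → n ≤ Y → X * X * A₂-sum n ≤ 4 * d * (∑ n v * ∑ n v)
    X²*A₂-sum≤ n n≤Y = begin
      X * X * A₂-sum n  ≡⟨ trans (sym (∑-*ˡ n (X * X) (λ q → ∑ q (A₂ q)))) (∑-cong n (λ q _ → sym (∑-*ˡ q (X * X) (A₂ q)))) ⟩
      ∑ n (λ q → ∑ q (λ p → X * X * A₂ q p))  ≤⟨ ∑-mono n (λ q q<n → ∑-mono q (λ p p<q → X²*A₂≤ q p (<-≤-trans q<n n≤Y) p<q)) ⟩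
      ∑ n (λ q → ∑ q (λ p → 4 * d * (v q * v p)))  ≤⟨ ∑-mono n (λ q q<n → ∑-range (λ p → 4 * d * (v q * v p)) (<⇒≤ q<n)) ⟩
      ∑ n (λ q → ∑ n (λ p → 4 * d * (v q * v p)))  ≡⟨ trans (∑-cong n (λ q _ → ∑-*ˡ n (4 * d) (λ p → v q * v p))) (∑-*ˡ n (4 * d) (λ q → ∑ n (λ p → v q * v p))) ⟩
      4 * d * ∑ n (λ q → ∑ n (λ p → v q * v p))  ≡⟨ cong (4 * d *_) (∑-product n n v v) ⟨
      4 * d * (∑ n v * ∑ n v)  ∎

    -- With `σ = ∑ n v`, the main term is at least `d σ / (32 X)` and the pair terms are at most
    -- `4 d σ² / X²`, which is at most half of it once `σ ≤ X / 256`: the origin of 256. Then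
    -- `σ ≥ X / 512` gives `32768 = 64 * 512`.
    union-of-many : ∀ n → n ≤ Y → 256 * ∑ n v ≤ X → X ≤ 512 * ∑ n v → d ≤ 32768 * U
    union-of-many n n≤Y σ≤ σ≥ = *-cancelʳ-≤ d _ X (begin
      d * X  ≤⟨ *-monoʳ-≤ d σ≥ ⟩
      d * (512 * σ)  ≡⟨ lem₁ d σ ⟩
      512 * (d * σ)  ≤⟨ *-monoʳ-≤ 512 dσ≤ ⟩
      512 * (64 * X * U)  ≡⟨ lem₂ X U ⟩
      32768 * U * X  ∎)
      where
      σ = ∑ n v
      P = A₂-sum n
      lem₁ : ∀ d z → d * (512 * z) ≡ 512 * (d * z)
      lem₁ = solve-∀
      lem₂ : ∀ X z → 512 * (64 * X * z) ≡ 32768 * z * X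
      lem₂ = solve-∀
      64XP≤ : 64 * X * P ≤ d * σ
      64XP≤ = *-cancelˡ-≤ X (begin
        X * (64 * X * P)  ≡⟨ lem₃ X P ⟩
        64 * (X * X * P)  ≤⟨ *-monoʳ-≤ 64 (X²*A₂-sum≤ n n≤Y) ⟩
        64 * (4 * d * (σ * σ))  ≡⟨ lem₄ d σ ⟩
        256 * σ * (d * σ)  ≤⟨ *-monoˡ-≤ (d * σ) σ≤ ⟩
        X * (d * σ)  ∎)
        where
        lem₃ : ∀ X P → X * (64 * X * P) ≡ 64 * (X * X * P)
        lem₃ = solve-∀
        lem₄ : ∀ d z → 64 * (4 * d * (z * z)) ≡ 256 * z * (d * z)
        lem₄ = solve-∀
      dσ≤ : d * σ ≤ 64 * X * U
      dσ≤ = ≤-by {l = 2 * (d * σ) + 64 * X * P} {r = 2 * (32 * X * (U + P)) + d * σ} 0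
        (+-mono-≤ (*-monoʳ-≤ 2 (≤-trans (d*∑v≤ n n≤Y) (*-monoʳ-≤ (32 * X) (∑A≤ n n≤Y)))) 64XP≤) (lem₅ d σ X U P)
        where
        lem₅ : ∀ d σ X U P → d * σ + (2 * (32 * X * (U + P)) + d * σ) + 0 ≡ 64 * X * U + (2 * (d * σ) + 64 * X * P)
        lem₅ = solve-∀

    union-of-one : ∀ n → n < Y → X ≤ 512 * v n → d ≤ 32768 * U
    union-of-one n n<Y big = *-cancelʳ-≤ d _ X (begin
      d * X  ≤⟨ *-monoʳ-≤ d big ⟩
      d * (512 * v n)  ≡⟨ lem₁ d (v n) ⟩
      512 * (d * v n)  ≤⟨ *-monoʳ-≤ 512 (d*v≤ n n<Y) ⟩
      512 * (32 * X * A n)  ≤⟨ *-monoʳ-≤ 512 (*-monoʳ-≤ (32 * X) A≤U) ⟩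
      -- Doubled to reach the constant of `union-of-many`.
      512 * (32 * X * U)  ≤⟨ ≤-trans (m≤m+n _ (512 * (32 * X * U))) (≤-reflexive (lem₂ X U)) ⟩
      32768 * U * X  ∎)
      where
      lem₁ : ∀ d z → d * (512 * z) ≡ 512 * (d * z)
      lem₁ = solve-∀
      lem₂ : ∀ X z → 512 * (32 * X * z) + 512 * (32 * X * z) ≡ 32768 * z * X
      lem₂ = solve-∀
      A≤U : A n ≤ U
      A≤U = ∑-mono d (λ x _ → case g-cases x n n<Y of λ where
        (inj₁ z)         → ≤-trans (≤-reflexive z) z≤n
        (inj₂ (z , 1≤u)) → ≤-trans (≤-reflexive z) 1≤u)

    -- Either the weights of an initial segment add up to about X/256, or a single weight is that large.
    union : ∀ σ V → σ ≡ ∑ Y v → V ≡ U → X ≤ 256 * σ → d ≤ 32768 * V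
    union _ _ refl refl big with crossing (λ n → 256 * ∑ n v) X Y (>-nonZero⁻¹ X) big
    ... | n , n<Y , lo , hi with X ≤? 512 * ∑ n v
    ...   | yes σ≥ = union-of-many n (<⇒≤ n<Y) (<⇒≤ lo) σ≥
    ...   | no σ≱  = union-of-one n n<Y (≤-by {l = 2 * X + 512 * ∑ n v} {r = 2 * (256 * (∑ n v + v n)) + X} 0
              (+-mono-≤ (*-monoʳ-≤ 2 hi) (≰⇒≥ σ≱)) (lem X (∑ n v) (v n)))
      where
      lem : ∀ X s w → X + (2 * (256 * (s + w)) + X) + 0 ≡ 512 * w + (2 * X + 512 * s)
      lem = solve-∀

-- Parameters

n<2^n : ∀ n → n < 2 ^ n
n<2^n zero    = s≤s z≤n
n<2^n (suc n) = ≤-trans (+-mono-≤ (m^n>0 2 n) (n<2^n n)) (≤-reflexive (cong (2 ^ n +_) (sym (+-identityʳ (2 ^ n)))))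

log₄ : ∀ d → 0 < d → ∃ λ b → 2 ^ (2 * b) ≤ d × d < 2 ^ (2 * suc b)
log₄ d 0<d = let b , _ , lo , hi = crossing (λ k → 2 ^ (2 * k)) (suc d) d (s≤s 0<d)
                       (≤-trans (n<2^n d) (^-monoʳ-≤ 2 (m≤n*m d 2))) in b , s≤s⁻¹ lo , hi

large-prime-divisors : ∀ {P : ℕ → Set} (P? : ∀ q → Dec (P q)) B M w c → 0 < M → M < 2 ^ c →
  (∀ q → P q → Prime q × 2 ^ w ≤ q × q ∣ M) → w * ∑ B (λ q → 𝟙 (P? q)) ≤ c
large-prime-divisors P? B M w c 0<M M< h = 2^-cancel-≤ (begin
  2 ^ (w * ∑ B (λ q → 𝟙 (P? q)))  ≡⟨ ^-*-assoc 2 w _ ⟨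
  (2 ^ w) ^ ∑ B (λ q → 𝟙 (P? q))  ≤⟨ prime-divisors≤ P? B M 0<M (λ q _ → h q) ⟩
  M  ≤⟨ <⇒≤ M< ⟩
  2 ^ c  ∎)
  where open ≤-Reasoning

2^-cancel-< : ∀ m n → 2 ^ m < 2 ^ n → m < n
2^-cancel-< m n h = ≰⇒> (λ n≤m → <⇒≱ h (^-monoʳ-≤ 2 n≤m))

∑-tail : ∀ {m n} (f g : ℕ → ℕ) → m ≤ n → (∀ q → m ≤ q → f q ≤ g q) → ∑ n f ≤ ∑ m f + ∑ n g
∑-tail {m} {n} f g m≤n h = begin
  ∑ n f  ≡⟨ cong (λ k → ∑ k f) (m+[n∸m]≡n m≤n) ⟨
  ∑ (m + (n ∸ m)) f  ≡⟨ ∑-split m (n ∸ m) f ⟩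
  ∑ m f + ∑ (n ∸ m) (λ i → f (m + i))  ≤⟨ +-monoʳ-≤ (∑ m f) (≤-trans (∑-mono (n ∸ m) (λ i _ → h (m + i) (m≤m+n m i))) (≤-trans (m≤n+m _ (∑ m g)) (≤-reflexive (sym (∑-split m (n ∸ m) g))))) ⟩
  ∑ m f + ∑ (m + (n ∸ m)) g  ≡⟨ cong (λ k → ∑ m f + ∑ k g) (m+[n∸m]≡n m≤n) ⟩
  ∑ m f + ∑ n g  ∎
  where open ≤-Reasoning

-- At most `2 ^ k` prime factors lie below `2 ^ k`, and the product of the others is at most `d`. As
-- `k` is free, this amounts to ω(d) = o(log d).
primes-bound : ∀ k d b → 0 < d → d < 2 ^ (2 * suc b) → k * primes (suc d) d ≤ k * 2 ^ k + 2 * suc b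
primes-bound k d b 0<d d< = begin
  k * primes (suc d) d  ≤⟨ *-monoʳ-≤ k split ⟩
  k * (2 ^ k + large)  ≡⟨ *-distribˡ-+ k (2 ^ k) large ⟩
  k * 2 ^ k + k * large  ≤⟨ +-monoʳ-≤ (k * 2 ^ k) (large-prime-divisors P? (suc d) d k (2 * suc b) 0<d d< (λ q p → p)) ⟩
  k * 2 ^ k + 2 * suc b  ∎
  where
  open ≤-Reasoning
  P? : ∀ q → Dec (Prime q × 2 ^ k ≤ q × q ∣ d)
  P? q = prime? q ×-dec (2 ^ k ≤? q ×-dec q ∣? d)
  large = ∑ (suc d) (λ q → 𝟙 (P? q))
  f : ℕ → ℕ
  f q = 𝟙 (prime? q ×-dec q ∣? d)
  split : primes (suc d) d ≤ 2 ^ k + large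
  split = ≤-trans (∑-mono (suc d) at) (≤-trans (≤-reflexive (∑-+ (suc d) (λ q → 𝟙 (q <? 2 ^ k)) (λ q → 𝟙 (P? q)))) (+-monoˡ-≤ large small))
    where
    at : ∀ q → q < suc d → f q ≤ 𝟙 (q <? 2 ^ k) + 𝟙 (P? q)
    at q _ = 𝟙-elim (prime? q ×-dec q ∣? d) λ (pq , q∣d) → case q <? 2 ^ k of λ where
      (yes q<) → ≤-trans (≤-reflexive (sym (𝟙-yes (q <? 2 ^ k) q<))) (m≤m+n _ _)
      (no q≮)  → ≤-trans (≤-reflexive (sym (𝟙-yes (P? q) (pq , ≮⇒≥ q≮ , q∣d)))) (m≤n+m _ (𝟙 (q <? 2 ^ k)))
    small : ∑ (suc d) (λ q → 𝟙 (q <? 2 ^ k)) ≤ 2 ^ k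
    small = ≤-trans (∑-tail-zero (suc d)) (≤-trans (∑-≤const (2 ^ k) 1 (λ q _ → 𝟙≤1 (q <? 2 ^ k))) (≤-reflexive (*-identityʳ (2 ^ k))))
      where
      ∑-tail-zero : ∀ n → ∑ n (λ q → 𝟙 (q <? 2 ^ k)) ≤ ∑ (2 ^ k) (λ q → 𝟙 (q <? 2 ^ k))
      ∑-tail-zero n = case ≤-total n (2 ^ k) of λ where
        (inj₁ n≤) → ∑-range (λ q → 𝟙 (q <? 2 ^ k)) n≤
        (inj₂ ≤n) → ≤-trans (∑-tail (λ q → 𝟙 (q <? 2 ^ k)) (λ _ → 0) ≤n (λ q ≤q → ≤-reflexive (𝟙-no (q <? 2 ^ k) (≤⇒≯ ≤q))))
                      (≤-reflexive (trans (cong (∑ (2 ^ k) (λ q → 𝟙 (q <? 2 ^ k)) +_) (∑-zero n (λ _ _ → refl))) (+-identityʳ _)))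

-- `b` is the integer part of the base 4 logarithm of `d`. By `64 t ≤ b` a factor `2 ^ t`, and with
-- it `2 ^ ω(d)`, is at most a small power of `d`. The variable `y` will be `2 ^ 512`.
∃-sufficiently-large : ∀ y → (∀ d b → 0 < d → d < 2 ^ (2 * suc b) → 512 * primes (suc d) d ≤ 512 * y + 2 * suc b) →
  ∃ λ N → ∀ d → N ≤ d → ∃₂ λ b t → 2 ^ (2 * b) ≤ d × d < 2 ^ (2 * suc b) × 9 ≤ t × 64 * t ≤ b × primes (suc d) d ≤ t
-- `922 = (8 * 64 * 9 + 2) / 5`: the inequality `64 (9 + ω(d)) ≤ b`, multiplied by 8, needs
-- `512 y + 8 * 64 * 9 + 2 ≤ 6 b`, and `6 b` is split as `b + 5 b`.
∃-sufficiently-large y bound = 2 ^ (2 * (512 * y + 922)) , λ d N≤d →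
  let 0<d = ≤-trans (m^n>0 2 (2 * (512 * y + 922))) N≤d
      b , lo , hi = log₄ d 0<d
      b≥ = s≤s⁻¹ (*-cancelˡ-< 2 (512 * y + 922) (suc b) (2^-cancel-< (2 * (512 * y + 922)) (2 * suc b) (≤-<-trans N≤d hi)))
  in b , 9 + primes (suc d) d , lo , hi , m≤m+n 9 _ ,
     *-cancelˡ-≤ 8 (≤-by {l = 512 * primes (suc d) d + (512 * y + 922 + 5 * 922)} {r = 512 * y + 2 * suc b + (b + 5 * b)} 922 (+-mono-≤ (bound d b 0<d hi) (+-mono-≤ b≥ (*-monoʳ-≤ 5 (≤-trans (m≤n+m 922 (512 * y)) b≥)))) (lem y b (primes (suc d) d))) ,
     m≤n+m _ 9
  where
  lem : ∀ y b p → 8 * (64 * (9 + p)) + (512 * y + 2 * suc b + (b + 5 * b)) + 922 ≡ 8 * b + (512 * p + (512 * y + 922 + 5 * 922))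
  lem = solve-∀

module Window (d e κ c k s : ℕ) .{{_ : NonZero d}} .{{_ : NonZero e}} .{{_ : NonZero κ}} (e⊥2 : Coprime e 2) (e⊥c : Coprime e c) (e⊥k : Coprime e k)
  (G≤ : ∑gcd e ≤ κ * κ) (κ≤e : 272 * κ ≤ e) where

  window : ∀ (u : ℕ → ℕ) K .{{_ : NonZero K}} → K * κ ≤ d →
    (∀ m y → m * (K * κ) ≤ d → ∑ (m * (256 * κ)) (λ j → 𝟙 (c * (y * y) ≈? k * j + s [ e ])) ≤ u y) →
    232 * d ≤ 2 * K * ∑ e u
  window u K K≤d hit = below (floor-≥ d (K * κ) {{m*n≢0 K κ}} K≤d)
    where
    open ≤-Reasoning
    below : (∃ λ m → m * (K * κ) ≤ d × d ≤ 2 * (m * (K * κ))) → 232 * d ≤ 2 * K * ∑ e u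
    below (m , m≤ , ≤2m) = begin
      232 * d  ≤⟨ *-monoʳ-≤ 232 ≤2m ⟩
      232 * (2 * (m * (K * κ)))  ≡⟨ lem m K κ ⟩
      2 * K * (m * (232 * κ))  ≤⟨ *-monoʳ-≤ (2 * K) (Equidistribution.lower* e c k e⊥2 e⊥c e⊥k κ G≤ κ≤e s m) ⟩
      2 * K * ∑ (m * (256 * κ)) (#sols e c k s) ≡⟨ cong (2 * K *_) (∑-swap (m * (256 * κ)) e (λ j y → 𝟙 (c * (y * y) ≈? k * j + s [ e ]))) ⟩
      2 * K * ∑ e (λ y → ∑ (m * (256 * κ)) (λ j → 𝟙 (c * (y * y) ≈? k * j + s [ e ]))) ≤⟨ *-monoʳ-≤ (2 * K) (∑-mono e (λ y _ → hit m y m≤)) ⟩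
      2 * K * ∑ e u  ∎
      where
      lem : ∀ m K κ → 232 * (2 * (m * (K * κ))) ≡ 2 * K * (m * (232 * κ))
      lem = solve-∀

module Scale (b t : ℕ) where
  -- Chosen so that κ² ≥ 2^ω(d) d ≥ Σ_{u<e} gcd(u,e) for every e ∣ d.
  κ : ℕ
  κ = 2 ^ (suc b + t)

  instance κ≢0 : NonZero κ
           κ≢0 = m^n≢0 2 (suc b + t)

  power-*-κ : ∀ {d} i → 2 ^ (2 * b) ≤ d → i + (suc b + t) ≤ 2 * b → 2 ^ i * κ ≤ d
  power-*-κ i lo h = ≤-trans (≤-reflexive (sym (^-distribˡ-+-* 2 i (suc b + t)))) (≤-trans (^-monoʳ-≤ 2 h) lo)

  ∑gcd≤κ² : ∀ {d e} → 0 < d → SquareFree d → d < 2 ^ (2 * suc b) → primes (suc d) d ≤ t → e ∣ d → ∑gcd e ≤ κ * κ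
  ∑gcd≤κ² {d} {e} 0<d sf hi p≤t e∣d = begin
    ∑gcd e  ≤⟨ ∑gcd≤ (suc d) e 0<e (s≤s e≤d) (squarefree-divisor e∣d sf) ⟩
    2 ^ primes (suc d) e * e  ≤⟨ *-mono-≤ (^-monoʳ-≤ 2 (≤-trans (∑-mono (suc d) (λ q _ → 𝟙-mono (prime? q ×-dec q ∣? e) (prime? q ×-dec q ∣? d) (λ (pq , q∣e) → pq , ∣-trans q∣e e∣d))) p≤t)) (≤-trans e≤d (<⇒≤ hi)) ⟩
    2 ^ t * 2 ^ (2 * suc b)  ≤⟨ *-monoˡ-≤ (2 ^ (2 * suc b)) (^-monoʳ-≤ 2 (m≤n*m t 2)) ⟩
    2 ^ (2 * t) * 2 ^ (2 * suc b)  ≡⟨ ^-distribˡ-+-* 2 (2 * t) (2 * suc b) ⟨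
    2 ^ (2 * t + 2 * suc b)  ≡⟨ cong (2 ^_) (lem b t) ⟩
    2 ^ (suc b + t + (suc b + t))  ≡⟨ ^-distribˡ-+-* 2 (suc b + t) (suc b + t) ⟩
    κ * κ  ∎
    where
    open ≤-Reasoning
    lem : ∀ b t → 2 * t + 2 * suc b ≡ suc b + t + (suc b + t)
    lem = solve-∀
    0<e : 0 < e
    0<e = n≢0⇒n>0 (λ e≡0 → <⇒≢ 0<d (sym (0∣⇒≡0 (subst (_∣ d) e≡0 e∣d))))
    e≤d : e ≤ d
    e≤d = ∣⇒≤ {{>-nonZero 0<d}} e∣d

  exponent≤ : ∀ {i} → i ≤ 17 → 9 ≤ t → 64 * t ≤ b → i + (suc b + t) ≤ 2 * b
  exponent≤ {i} i≤ 9≤t 64t≤b = ≤-by {l = i + 2 * 9 + 64 * t} {r = 17 + 2 * t + b} (61 * t) (+-mono-≤ (+-mono-≤ i≤ (*-monoʳ-≤ 2 9≤t)) 64t≤b) (lem i b t)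
    where lem : ∀ i b t → i + (suc b + t) + (17 + 2 * t + b) + 61 * t ≡ 2 * b + (i + 2 * 9 + 64 * t)
          lem = solve-∀

twisted-lower-ramified : ∀ d κ .{{_ : NonZero d}} .{{_ : NonZero κ}} (d⊥2 : Coprime d 2) (G≤ : ∑gcd d ≤ κ * κ) (κ≤d : 272 * κ ≤ d) →
  SquareFree d → (∀ {e} → e ∣ d → ∑gcd e ≤ κ * κ) → ∀ q → Ramified d q → 272 * κ * q ≤ d → 1024 * κ * (q * q) ≤ d →
  d ≤ 32 * (q * ∑ d (λ x → 𝟙 (Events.Twisted? d κ d⊥2 G≤ κ≤d q x)))
twisted-lower-ramified d κ d⊥2 G≤ κ≤d sf G∣ q (pq , q≢2 , divides e refl) κq≤d c≤d =
  twisted-lower e q κ {{e≢0}} pq q≢2 (squarefree-coprime pq sf) (λ (c∣e , c∣2) → d⊥2 (∣m⇒∣m*n q c∣e , c∣2)) (G∣ {e} (m∣m*n {e} q))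
    (*-cancelʳ-≤ (272 * κ) e q {{prime⇒nonZero pq}} κq≤d) d⊥2 G≤ κ≤d c≤d
  where
  e≢0 : NonZero e
  e≢0 = ≢-nonZero (λ e≡0 → ≢-nonZero⁻¹ (e * q) (cong (_* q) e≡0))

-- The cases d even and d ≡ 1 mod 4

≈-crt-≥ : ∀ {m n a b} → Coprime m n → b ≤ a → a ≈ b [ m ] → a ≈ b [ n ] → a ≈ b [ m * n ]
≈-crt-≥ {m} {n} {a} {b} cop b≤a p q = subst₂ (_≈_[ m * n ]) (m+[n∸m]≡n b≤a) (+-identityʳ b)
    (≈-+ (≈-refl {a = b}) (∣⇒≈0 (coprime-divisors-* cop (div p) (div q))))
  where
  div : ∀ {k} → a ≈ b [ k ] → k ∣ a ∸ b
  div {k} r = ≈0⇒∣ (≈-+cancelˡ b (subst₂ (_≈_[ k ]) (sym (m+[n∸m]≡n b≤a)) (sym (+-identityʳ b)) r))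

≈-crt : ∀ {m n a b} → Coprime m n → a ≈ b [ m ] → a ≈ b [ n ] → a ≈ b [ m * n ]
≈-crt {a = a} {b} cop p q = case ≤-total b a of λ where
  (inj₁ b≤a) → ≈-crt-≥ cop b≤a p q
  (inj₂ a≤b) → ≈-sym (≈-crt-≥ cop a≤b (≈-sym p) (≈-sym q))

odd⇒coprime-2 : ∀ {n} → ¬ 2 ∣ n → Coprime n 2
odd⇒coprime-2 n-odd = coprime-sym (prime∤⇒coprime prime[2] n-odd)

odd⇒≈1 : ∀ {n} → ¬ 2 ∣ n → n ≈ 1 [ 2 ]
odd⇒≈1 {n} n-odd with odd⇒suc-double n n-odd
... | k , refl = ≈-trans (≈-reflexive (cong suc (*-comm 2 k))) (≈-+m 1 k)

progression-≈ : ∀ k j s → k * j + s ≈ s [ k ]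
progression-≈ k j s = ≈-trans (≈-reflexive (trans (+-comm (k * j) s) (cong (s +_) (*-comm k j)))) (≈-+m s j)

#InD : ∀ d .{{_ : NonZero d}} → Decidable (InD d) → ℕ
#InD d dec = ∑ d (λ x → 𝟙 (dec ((x * x) % d)))

enlarge : ∀ a .{{_ : NonZero a}} b c {d S} → a * d ≤ b * S → b ≤ a * c → d ≤ c * S
enlarge a b c {d} {S} h b≤ = *-cancelˡ-≤ a (≤-trans h (≤-trans (*-monoˡ-≤ S b≤) (≤-reflexive (*-assoc a c S))))

module _ (d b t : ℕ) .{{_ : NonZero d}} (lo : 2 ^ (2 * b) ≤ d) (hi : d < 2 ^ (2 * suc b)) (9≤t : 9 ≤ t) (64t≤b : 64 * t ≤ b)
  (p≤t : primes (suc d) d ≤ t) (sf : SquareFree d) (dec : Decidable (InD d)) where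
  open Scale b t

  private
    G∣ : ∀ {e} → e ∣ d → ∑gcd e ≤ κ * κ
    G∣ = ∑gcd≤κ² (>-nonZero⁻¹ d) sf hi p≤t

    κ-multiple : ∀ c i → c ≤ 2 ^ i → i ≤ 17 → c * κ ≤ d
    κ-multiple c i c≤ i≤ = ≤-trans (*-monoˡ-≤ κ c≤) (power-*-κ i lo (exponent≤ i≤ 9≤t 64t≤b))

    272κ≤d : 272 * κ ≤ d
    272κ≤d = κ-multiple 272 9 (≤ᵇ⇒≤ 272 512 _) (≤ᵇ⇒≤ 9 17 _)

    coprime-1 : ∀ {e} → Coprime e 1
    coprime-1 (_ , c∣1) = ∣1⇒≡1 c∣1

    -- `1024 * k = 4 * 256 * k` keeps the terms of step `k` below `d / 4`. A root `y` modulo `e` is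
    -- paired with a root `x` modulo `d` so that `e` can be the odd part of `d`.
    residues-in-progression : ∀ e k s x y m .{{_ : NonZero k}} → s < k → m * (1024 * k * κ) ≤ d →
      (∀ j → 1 * (y * y) ≈ k * j + s [ e ] → x * x ≈ k * j + s [ d ]) → (∀ j → ¬ RepQ d (k * j + s)) →
      ∑ (m * (256 * κ)) (λ j → 𝟙 (1 * (y * y) ≈? k * j + s [ e ])) ≤ 𝟙 (dec ((x * x) % d))
    residues-in-progression e k s x y m s<k m≤ square obstruction = ∑𝟙-unique (m * (256 * κ)) (λ j → 1 * (y * y) ≈? k * j + s [ e ]) _
        (λ {i} {j} i< j< p q → *-cancelˡ-≡ i j k (+-cancelʳ-≡ s (k * i) (k * j) (≈-< (r<d i i<) (r<d j j<) (≈-trans (≈-sym (square i p)) (square j q))))) found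
      where
      open ≤-Reasoning
      4r<d : ∀ j → j < m * (256 * κ) → 4 * (k * j + s) < d
      4r<d j j< = begin-strict
        4 * (k * j + s)            <⟨ *-monoʳ-< 4 (+-monoʳ-< (k * j) s<k) ⟩
        4 * (k * j + k)            ≡⟨ lem₁ k j ⟩
        4 * k * suc j              ≤⟨ *-monoʳ-≤ (4 * k) j< ⟩
        4 * k * (m * (256 * κ))    ≡⟨ lem₂ k m κ ⟩
        m * (1024 * k * κ)         ≤⟨ m≤ ⟩
        d                          ∎
        where
        lem₁ : ∀ k j → 4 * (k * j + k) ≡ 4 * k * suc j
        lem₁ = solve-∀
        lem₂ : ∀ k m κ → 4 * k * (m * (256 * κ)) ≡ m * (1024 * k * κ)
        lem₂ = solve-∀
      r<d : ∀ j → j < m * (256 * κ) → k * j + s < d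
      r<d j j< = ≤-<-trans (m≤n*m (k * j + s) 4) (4r<d j j<)
      found : ∀ j → j < m * (256 * κ) → 1 * (y * y) ≈ k * j + s [ e ] → 1 ≤ 𝟙 (dec ((x * x) % d))
      found j j< p = ≤-reflexive (sym (𝟙-yes (dec ((x * x) % d)) (InD-intro d x
          (subst (λ r → 4 * r < d) (sym r≡) (4r<d j j<)) (subst (λ r → ¬ RepQ d r) (sym r≡) (obstruction j)))))
        where
        r≡ : (x * x) % d ≡ k * j + s
        r≡ = trans (≈⇒% (square j p)) (m<n⇒m%n≡m (r<d j j<))

  many-in-D-1mod4 : d ≈ 1 [ 4 ] → d ≤ 131072 * #InD d dec
  many-in-D-1mod4 d≈1 = enlarge 232 (2 * (1024 * 4)) 131072 {d} {#InD d dec}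
      (Window.window d d κ 1 4 3 d⊥2 coprime-1 (coprime-* d⊥2 d⊥2) (G∣ ∣-refl) 272κ≤d
        (λ y → 𝟙 (dec ((y * y) % d))) (1024 * 4) (κ-multiple (1024 * 4) 12 (≤ᵇ⇒≤ 4096 4096 _) (≤ᵇ⇒≤ 12 17 _)) hit)
      (≤ᵇ⇒≤ (2 * (1024 * 4)) (232 * 131072) _)
    where
    d⊥2 : Coprime d 2
    d⊥2 = odd⇒coprime-2 (λ 2∣d → 1≉0 (≈-trans (≈-sym (≈-∣ (divides 2 refl) d≈1)) (∣⇒≈0 2∣d)))
    hit : ∀ m y → m * (1024 * 4 * κ) ≤ d → ∑ (m * (256 * κ)) (λ j → 𝟙 (1 * (y * y) ≈? 4 * j + 3 [ d ])) ≤ 𝟙 (dec ((y * y) % d))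
    hit m y m≤ = residues-in-progression d 4 3 y y m (≤ᵇ⇒≤ 4 4 _) m≤
      (λ j → subst (_≈ 4 * j + 3 [ d ]) (*-identityˡ (y * y)))
      (λ j → ¬RepQ-1mod4 {d} {4 * j + 3} d≈1 (progression-≈ 4 j 3))

  many-in-D-even : ∀ e → d ≡ 2 * e → ¬ 2 ∣ e → d ≤ 131072 * #InD d dec
  many-in-D-even e d≡ e-odd = enlarge 232 (2 * (1024 * 8)) 131072 {d} {#InD d dec}
      (≤-trans (Window.window d e κ 1 8 5 {{it}} {{e≢0}} e⊥2 coprime-1 (coprime-* e⊥2 (coprime-* e⊥2 e⊥2)) (G∣ {e} (divides 2 d≡)) 272κ≤e
          (λ y → 𝟙 (dec ((lift y * lift y) % d))) (1024 * 8) (κ-multiple (1024 * 8) 13 (≤ᵇ⇒≤ 8192 8192 _) (≤ᵇ⇒≤ 13 17 _)) hit)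
        (*-monoʳ-≤ (2 * (1024 * 8)) (∑-inj e d lift (λ x → 𝟙 (dec ((x * x) % d))) lift<
          (λ y< z< p → ≈-< y< z< (≈-trans (≈-sym (lift≈ _)) (≈-trans (≈-reflexive p) (lift≈ _)))))))
      (≤ᵇ⇒≤ (2 * (1024 * 8)) (232 * 131072) _)
    where
    e≢0 : NonZero e
    e≢0 = ≢-nonZero (λ e≡0 → ≢-nonZero⁻¹ d (trans d≡ (cong (2 *_) e≡0)))
    e⊥2 : Coprime e 2
    e⊥2 = odd⇒coprime-2 e-odd
    272κ≤e : 272 * κ ≤ e
    272κ≤e = *-cancelˡ-≤ 2 (≤-trans (≤-reflexive (sym (*-assoc 2 272 κ))) (≤-trans (κ-multiple 544 10 (≤ᵇ⇒≤ 544 1024 _) (≤ᵇ⇒≤ 10 17 _)) (≤-reflexive d≡)))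
    -- Equidistribution needs an odd modulus, so `y` is counted modulo `e = d / 2`. Its odd
    -- representative modulo `d` has an odd square, in agreement with the odd residue `8 j + 5`.
    lift : ℕ → ℕ
    lift y with 2 ∣? y
    ... | yes _ = y + e
    ... | no _  = y
    lift< : ∀ y → y < e → lift y < d
    lift< y y<e with 2 ∣? y
    ... | yes _ = <-≤-trans (+-monoˡ-< e y<e) (≤-reflexive (trans (cong (e +_) (sym (+-identityʳ e))) (sym d≡)))
    ... | no _  = <-≤-trans y<e (≤-trans (m≤n*m e 2) (≤-reflexive (sym d≡)))
    lift≈ : ∀ y → lift y ≈ y [ e ]
    lift≈ y with 2 ∣? y
    ... | yes _ = ≈-trans (≈-reflexive (cong (y +_) (sym (+-identityʳ e)))) (≈-+m y 1)
    ... | no _  = ≈-refl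
    lift≈1 : ∀ y → lift y ≈ 1 [ 2 ]
    lift≈1 y with 2 ∣? y
    ... | yes 2∣y = ≈-+ (∣⇒≈0 2∣y) (odd⇒≈1 e-odd)
    ... | no 2∤y  = odd⇒≈1 2∤y
    square : ∀ y j → 1 * (y * y) ≈ 8 * j + 5 [ e ] → lift y * lift y ≈ 8 * j + 5 [ d ]
    square y j p = subst (lift y * lift y ≈ 8 * j + 5 [_]) (sym d≡) (≈-crt (coprime-sym e⊥2)
      (≈-trans (≈-* (lift≈1 y) (lift≈1 y)) (≈-sym (≈-trans (≈-reflexive (lem j)) (≈-+m 1 (4 * j + 2)))))
      (≈-trans (≈-* (lift≈ y) (lift≈ y)) (subst (_≈ 8 * j + 5 [ e ]) (*-identityˡ (y * y)) p)))
      where lem : ∀ j → 8 * j + 5 ≡ 1 + (4 * j + 2) * 2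
            lem = solve-∀
    hit : ∀ m y → m * (1024 * 8 * κ) ≤ d → ∑ (m * (256 * κ)) (λ j → 𝟙 (1 * (y * y) ≈? 8 * j + 5 [ e ])) ≤ 𝟙 (dec ((lift y * lift y) % d))
    hit m y m≤ = residues-in-progression e 8 5 (lift y) y m (≤ᵇ⇒≤ 6 8 _) m≤ (square y)
      (λ j → subst (λ n → ¬ RepQ n (8 * j + 5)) (sym d≡) (¬RepQ-even {e} {8 * j + 5} e-odd (progression-≈ 8 j 5)))

-- The case d ≡ 3 mod 4

∑-quot≤ : ∀ {P : ℕ → Set} (P? : ∀ q → Dec (P q)) n a X → (∀ q → P q → a ≤ q) →
  a * ∑ n (λ q → 𝟙 (P? q) * quot X q) ≤ X * ∑ n (λ q → 𝟙 (P? q))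
∑-quot≤ P? n a X h = begin
  a * ∑ n (λ q → 𝟙 (P? q) * quot X q)  ≡⟨ ∑-*ˡ n a (λ q → 𝟙 (P? q) * quot X q) ⟨
  ∑ n (λ q → a * (𝟙 (P? q) * quot X q))  ≤⟨ ∑-mono n (λ q _ → at q) ⟩
  ∑ n (λ q → X * 𝟙 (P? q))  ≡⟨ ∑-*ˡ n X (λ q → 𝟙 (P? q)) ⟩
  X * ∑ n (λ q → 𝟙 (P? q))  ∎
  where
  open ≤-Reasoning
  at : ∀ q → a * (𝟙 (P? q) * quot X q) ≤ X * 𝟙 (P? q)
  at q with P? q
  ... | no _  = ≤-trans (≤-reflexive (*-zeroʳ a)) z≤n
  ... | yes p = begin
    a * (1 * quot X q)  ≡⟨ trans (cong (a *_) (*-identityˡ (quot X q))) (*-comm a (quot X q)) ⟩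
    quot X q * a  ≤⟨ *-monoʳ-≤ (quot X q) (h q p) ⟩
    quot X q * q  ≤⟨ quot*≤ X q ⟩
    X  ≡⟨ *-identityʳ X ⟨
    X * 1  ∎

module Dyadic (d X : ℕ) where
  g : ℕ → ℕ
  g q = 𝟙 (Bad? d q) * quot X q

  Above? : ∀ i q → Dec (Bad d q × 2 ^ i < q)
  Above? i q = Bad? d q ×-dec 2 ^ i <? q

  block : ℕ → ℕ
  block i = ∑ (2 ^ suc i) (λ q → 𝟙 (Above? i q) * quot X q)

  -- Each weight is at most `X / 2 ^ i`, so Chebyshev's bound says that a dyadic block contributes
  -- at most `2 / i` to the sum of reciprocals.
  block≤ : ∀ i → i * block i ≤ 2 * X
  block≤ i = *-cancelˡ-≤ (2 ^ i) {{m^n≢0 2 i}} (begin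
    2 ^ i * (i * block i)  ≡⟨ lem₁ (2 ^ i) i (block i) ⟩
    i * (2 ^ i * block i)  ≤⟨ *-monoʳ-≤ i (∑-quot≤ (Above? i) (2 ^ suc i) (2 ^ i) X (λ q (_ , above) → <⇒≤ above)) ⟩
    i * (X * ∑ (2 ^ suc i) (λ q → 𝟙 (Above? i q)))  ≡⟨ lem₂ i X (∑ (2 ^ suc i) (λ q → 𝟙 (Above? i q))) ⟩
    X * (i * ∑ (2 ^ suc i) (λ q → 𝟙 (Above? i q)))  ≤⟨ *-monoʳ-≤ X (dyadic-primes (Above? i) i (λ q ((pq , _) , above) → pq , above)) ⟩
    X * (2 * 2 ^ i)  ≡⟨ lem₃ X (2 ^ i) ⟩
    2 ^ i * (2 * X)  ∎)
    where
    open ≤-Reasoning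
    lem₁ : ∀ a i z → a * (i * z) ≡ i * (a * z)
    lem₁ = solve-∀
    lem₂ : ∀ i X z → i * (X * z) ≡ X * (i * z)
    lem₂ = solve-∀
    lem₃ : ∀ X a → X * (2 * a) ≡ a * (2 * X)
    lem₃ = solve-∀

  ∑g-double : ∀ i → 0 < i → ∑ (2 ^ suc i) g ≤ ∑ (2 ^ i) g + block i
  ∑g-double (suc i) _ = ∑-tail g (λ q → 𝟙 (Above? (suc i) q) * quot X q) (^-monoʳ-≤ 2 (n≤1+n (suc i))) at
    where
    at : ∀ q → 2 ^ suc i ≤ q → g q ≤ 𝟙 (Above? (suc i) q) * quot X q
    at q 2^i≤q = *-monoˡ-≤ (quot X q) (𝟙-mono (Bad? d q) (Above? (suc i) q) λ bad@(pq , q≢2 , _) →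
      bad , ≤∧≢⇒< 2^i≤q (λ eq → prime-odd pq q≢2 (subst (2 ∣_) eq (m∣m*n (2 ^ i)))))

  ∑g-telescope : ∀ z m → 0 < z → ∑ (2 ^ (z + m)) g ≤ ∑ (2 ^ z) g + ∑ m (λ i → block (z + i))
  ∑g-telescope z zero    0<z = ≤-trans (≤-reflexive (cong (λ k → ∑ (2 ^ k) g) (+-identityʳ z))) (m≤m+n _ 0)
  ∑g-telescope z (suc m) 0<z = begin
    ∑ (2 ^ (z + suc m)) g  ≡⟨ cong (λ k → ∑ (2 ^ k) g) (+-suc z m) ⟩
    ∑ (2 ^ suc (z + m)) g  ≤⟨ ∑g-double (z + m) (≤-trans 0<z (m≤m+n z m)) ⟩
    ∑ (2 ^ (z + m)) g + block (z + m)  ≤⟨ +-monoˡ-≤ (block (z + m)) (∑g-telescope z m 0<z) ⟩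
    ∑ (2 ^ z) g + ∑ m (λ i → block (z + i)) + block (z + m)  ≡⟨ +-assoc (∑ (2 ^ z) g) _ _ ⟩
    ∑ (2 ^ z) g + ∑ (suc m) (λ i → block (z + i))  ∎
    where open ≤-Reasoning

  blocks≤ : ∀ z m → z * ∑ m (λ i → block (z + i)) ≤ m * (2 * X)
  blocks≤ z m = ≤-trans (≤-reflexive (sym (∑-*ˡ m z (λ i → block (z + i)))))
    (∑-≤const m (2 * X) (λ i _ → ≤-trans (*-monoˡ-≤ (block (z + i)) (m≤m+n z i)) (block≤ (z + i))))

-- If all three sums were below `X / 256 ≤ 2 κ`, the total would be at most
-- `(2 + 2 + 2 + 1 + 80) κ = 87 κ`, against a supply of `231 κ / 2`.
one-of-three : ∀ κ .{{_ : NonZero κ}} X T c s₁ s₂ s₃ r → X ≤ 512 * κ → 231 * κ ≤ 2 * T → c ≤ 80 * κ → r ≤ κ → T ≤ s₁ + s₃ + (s₂ + r) + c →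
  X ≤ 256 * s₁ ⊎ X ≤ 256 * s₂ ⊎ X ≤ 256 * s₃
one-of-three κ X T c s₁ s₂ s₃ r X≤ T≥ c≤ r≤ T≤ with X ≤? 256 * s₁ | X ≤? 256 * s₂ | X ≤? 256 * s₃
... | yes h | _     | _     = inj₁ h
... | _     | yes h | _     = inj₂ (inj₁ h)
... | _     | _     | yes h = inj₂ (inj₂ h)
... | no h₁ | no h₂ | no h₃ = contradiction (*-cancelʳ-≤ 231 174 κ (begin
    231 * κ  ≤⟨ T≥ ⟩
    2 * T  ≤⟨ *-monoʳ-≤ 2 T≤ ⟩
    2 * (s₁ + s₃ + (s₂ + r) + c)  ≤⟨ *-monoʳ-≤ 2 (+-mono-≤ (+-mono-≤ (+-mono-≤ (small s₁ h₁) (small s₃ h₃)) (+-mono-≤ (small s₂ h₂) r≤)) c≤) ⟩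
    2 * (2 * κ + 2 * κ + (2 * κ + κ) + 80 * κ)  ≡⟨ lem κ ⟩
    174 * κ  ∎)) (<⇒≱ (≤ᵇ⇒≤ 175 231 _))
  where
  open ≤-Reasoning
  lem : ∀ κ → 2 * (2 * κ + 2 * κ + (2 * κ + κ) + 80 * κ) ≡ 174 * κ
  lem = solve-∀
  small : ∀ s → ¬ X ≤ 256 * s → s ≤ 2 * κ
  small s h = *-cancelˡ-≤ 256 (≤-trans (≰⇒≥ h) (≤-trans X≤ (≤-reflexive (*-assoc 256 2 κ))))

≤-raise : ∀ a b d S → a ≤ b → d ≤ a * S → d ≤ b * S
≤-raise a b d S a≤b h = ≤-trans h (*-monoˡ-≤ S a≤b)

≤-raise-assoc : ∀ a a′ b d S → a * a′ ≤ b → d ≤ a * (a′ * S) → d ≤ b * S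
≤-raise-assoc a a′ b d S aa′≤b h = ≤-raise (a * a′) b d S aa′≤b (≤-trans h (≤-reflexive (sym (*-assoc a a′ S))))

bad-prime-supply : ∀ d h κ X .{{_ : NonZero κ}} → d ≡ suc (2 * h) → X ≡ 512 * κ → h ≈ 1 [ 2 ] → ∑gcd d ≤ κ * κ → 272 * κ ≤ d →
  231 * κ ≤ 2 * ∑ X (Dyadic.g d X)
bad-prime-supply d h κ X refl refl h-odd G≤ κ≤d = Supply.bad-prime-supply h h-odd κ (odd⇒coprime-2 (suc-double-odd h)) G≤ κ≤d

module _ (d h b t : ℕ) .{{_ : NonZero d}} (d≡ : d ≡ suc (2 * h)) (h-odd : h ≈ 1 [ 2 ]) (lo : 2 ^ (2 * b) ≤ d) (hi : d < 2 ^ (2 * suc b)) (9≤t : 9 ≤ t) (64t≤b : 64 * t ≤ b)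
  (p≤t : primes (suc d) d ≤ t) (sf : SquareFree d) (dec : Decidable (InD d)) where
  open Scale b t
  open ≤-Reasoning

  private
    d⊥2 : Coprime d 2
    d⊥2 = odd⇒coprime-2 (subst (λ n → ¬ 2 ∣ n) (sym d≡) (suc-double-odd h))

    G∣ : ∀ {e} → e ∣ d → ∑gcd e ≤ κ * κ
    G∣ = ∑gcd≤κ² (>-nonZero⁻¹ d) sf hi p≤t

    G≤ : ∑gcd d ≤ κ * κ
    G≤ = G∣ ∣-refl

    272κ≤d : 272 * κ ≤ d
    272κ≤d = ≤-trans (*-monoˡ-≤ κ (≤ᵇ⇒≤ 272 512 _)) (power-*-κ 9 lo (exponent≤ (≤ᵇ⇒≤ 9 17 _) 9≤t 64t≤b))

    open module Ev = Events d κ d⊥2 G≤ 272κ≤d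

    u : ℕ → ℕ
    u x = 𝟙 (dec (residue x))

    X : ℕ
    X = 512 * κ

    instance X≢0 : NonZero X
             X≢0 = m*n≢0 512 κ

    -- Bad primes below 2^w are treated by inclusion–exclusion; at most 9 primes above 2^w divide
    -- any one residue; those in [2^z, X) are removed by Chebyshev's bound.
    w z : ℕ
    w = b / 4
    z = b ∸ (13 + t)

    4w≤b : w * 4 ≤ b
    4w≤b = m/n*n≤m b 4

    b≤4w+3 : b ≤ 3 + w * 4
    b≤4w+3 = ≤-trans (≤-reflexive (m≡m%n+[m/n]*n b 4)) (+-monoˡ-≤ (w * 4) (s≤s⁻¹ (m%n<n b 4)))

    z+13+t : z + (13 + t) ≡ b
    z+13+t = m∸n+n≡m (≤-by {l = 64 * t + 2 * 9} {r = b + 2 * t} (61 * t + 5) (+-mono-≤ 64t≤b (*-monoʳ-≤ 2 9≤t)) (lem b t))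
      where lem : ∀ b t → 13 + t + (b + 2 * t) + (61 * t + 5) ≡ b + (64 * t + 2 * 9)
            lem = solve-∀

    w≤z : w ≤ z
    w≤z = +-cancelʳ-≤ (13 + t) w z (≤-trans (*-cancelˡ-≤ 4 (≤-by {l = w * 4 + 64 * t + 6 * 9} {r = b + b + 6 * t} (2 * b + 54 * t + 2)
        (+-mono-≤ (+-mono-≤ 4w≤b 64t≤b) (*-monoʳ-≤ 6 9≤t)) (lem w b t))) (≤-reflexive (sym z+13+t)))
      where lem : ∀ w b t → 4 * (w + (13 + t)) + (b + b + 6 * t) + (2 * b + 54 * t + 2) ≡ 4 * b + (w * 4 + 64 * t + 6 * 9)
            lem = solve-∀

    13≤w : 13 ≤ w
    13≤w = *-cancelˡ-≤ 4 (≤-by {l = b + 64 * t + 64 * 9} {r = 3 + w * 4 + b + 64 * t} 521 (+-mono-≤ (+-mono-≤ b≤4w+3 64t≤b) (*-monoʳ-≤ 64 9≤t)) (lem w b t))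
      where lem : ∀ w b t → 52 + (3 + w * 4 + b + 64 * t) + 521 ≡ 4 * w + (b + 64 * t + 64 * 9)
            lem = solve-∀

    0<z : 0 < z
    0<z = ≤-trans (≤-trans (≤ᵇ⇒≤ 1 13 _) 13≤w) w≤z

    -- The quotient `2 (b + 1) / w` is a little over 8, as `w` is `b / 4` rounded down and
    -- `b ≥ 64 * 9`; 9 leaves room for the rounding.
    at-most-9 : ∀ c → w * c ≤ 2 * suc b → c ≤ 9
    at-most-9 c wc≤ = ≮⇒≥ λ 9<c → contradiction
        (≤-by {l = 4 * (w * 10) + 10 * b + 2 * (64 * t) + 128 * 9} {r = 4 * (2 * suc b) + 10 * (3 + w * 4) + 2 * b + 128 * t} 0
          (+-mono-≤ (+-mono-≤ (+-mono-≤ (*-monoʳ-≤ 4 (≤-trans (*-monoʳ-≤ w 9<c) wc≤)) (*-monoʳ-≤ 10 b≤4w+3)) (*-monoʳ-≤ 2 64t≤b)) (*-monoʳ-≤ 128 9≤t)) (lem w b t))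
        (<⇒≱ (≤ᵇ⇒≤ 39 1152 _))
      where lem : ∀ w b t → 1152 + (4 * (2 * suc b) + 10 * (3 + w * 4) + 2 * b + 128 * t) + 0 ≡ 38 + (4 * (w * 10) + 10 * b + 2 * (64 * t) + 128 * 9)
            lem = solve-∀

    few-large-primes : ∀ {P : ℕ → Set} (P? : ∀ q → Dec (P q)) B M → 0 < M → M ≤ d → (∀ q → P q → Prime q × 2 ^ w ≤ q × q ∣ M) → ∑ B (λ q → 𝟙 (P? q)) ≤ 9
    few-large-primes P? B M 0<M M≤d h = at-most-9 _ (large-prime-divisors P? B M w (2 * suc b) 0<M (≤-<-trans M≤d hi) h)

    -- The product `q p` costs at most `2 ^ (b / 2)`, while `d / κ` has order at least
    -- `2 ^ (b - t)`. The case `p = q` is what the ramified primes require.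
    Y²≤ : ∀ q p → q < 2 ^ w → p < 2 ^ w → 1024 * κ * (q * p) ≤ d
    Y²≤ q p q< p< = begin
      1024 * κ * (q * p)  ≤⟨ *-monoʳ-≤ (1024 * κ) (*-mono-≤ (<⇒≤ q<) (<⇒≤ p<)) ⟩
      1024 * κ * (2 ^ w * 2 ^ w)  ≡⟨ cong₂ _*_ (sym (^-distribˡ-+-* 2 10 (suc b + t))) (sym (^-distribˡ-+-* 2 w w)) ⟩
      2 ^ (10 + (suc b + t)) * 2 ^ (w + w) ≡⟨ ^-distribˡ-+-* 2 (10 + (suc b + t)) (w + w) ⟨
      2 ^ (10 + (suc b + t) + (w + w)) ≤⟨ ^-monoʳ-≤ 2 (*-cancelˡ-≤ {10 + (suc b + t) + (w + w)} {2 * b} 2 (≤-by {l = w * 4 + 64 * t + 3 * 9} {r = b + b + 3 * t} (59 * t + 5) (+-mono-≤ (+-mono-≤ 4w≤b 64t≤b) (*-monoʳ-≤ 3 9≤t)) (lem w b t))) ⟩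
      2 ^ (2 * b)  ≤⟨ lo ⟩
      d  ∎
      where lem : ∀ w b t → 2 * (10 + (suc b + t) + (w + w)) + (b + b + 3 * t) + (59 * t + 5) ≡ 2 * (2 * b) + (w * 4 + 64 * t + 3 * 9)
            lem = solve-∀

    -- This fixes `z`: with 3072 rounded up to `2 ^ 12`, the exponents `12 + (b + 1 + t) + z` add up
    -- to exactly `2 b`.
    Z≤ : ∀ q → q < 2 ^ z → 3072 * κ * q ≤ d
    Z≤ q q< = begin
      3072 * κ * q  ≤⟨ *-mono-≤ (*-monoˡ-≤ κ (≤ᵇ⇒≤ 3072 4096 _)) (<⇒≤ q<) ⟩
      4096 * κ * 2 ^ z  ≡⟨ cong (_* 2 ^ z) (sym (^-distribˡ-+-* 2 12 (suc b + t))) ⟩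
      2 ^ (12 + (suc b + t)) * 2 ^ z  ≡⟨ ^-distribˡ-+-* 2 (12 + (suc b + t)) z ⟨
      2 ^ (12 + (suc b + t) + z)  ≡⟨ cong (2 ^_) (trans (lem b t z) (trans (cong (b +_) z+13+t) (cong (b +_) (sym (+-identityʳ b))))) ⟩
      2 ^ (2 * b)  ≤⟨ lo ⟩
      d  ∎
      where lem : ∀ b t z → 12 + (suc b + t) + z ≡ b + (z + (13 + t))
            lem = solve-∀

    -- The number of dyadic blocks in the gap: `13 + t` from `2 ^ z` to `2 ^ b`, and `10 + t` from
    -- there to `X`.
    X≡ : 2 ^ (z + (23 + 2 * t)) ≡ X
    X≡ = trans (cong (2 ^_) (trans (lem₁ z t) (trans (cong (_+ (10 + t)) z+13+t) (lem₂ b t)))) (^-distribˡ-+-* 2 9 (suc b + t))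
      where
      lem₁ : ∀ z t → z + (23 + 2 * t) ≡ z + (13 + t) + (10 + t)
      lem₁ = solve-∀
      lem₂ : ∀ b t → b + (10 + t) ≡ 9 + (suc b + t)
      lem₂ = solve-∀

    Y≤Z : 2 ^ w ≤ 2 ^ z
    Y≤Z = ^-monoʳ-≤ 2 w≤z

    Z≤X : 2 ^ z ≤ X
    Z≤X = ≤-trans (^-monoʳ-≤ 2 (m≤m+n z (23 + 2 * t))) (≤-reflexive X≡)

    LargeInert? : ∀ q → Dec (Inert d q × 2 ^ w ≤ q)
    LargeInert? q = Inert? d q ×-dec 2 ^ w ≤? q

    LargeRamified? : ∀ q → Dec (Ramified d q × 2 ^ w ≤ q)
    LargeRamified? q = Ramified? d q ×-dec 2 ^ w ≤? q

    s₁ s₂ s₃ r c : ℕ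
    s₁ = ∑ (2 ^ w) (λ q → 𝟙 (Inert? d q) * quot X q)
    s₂ = ∑ (2 ^ w) (λ q → 𝟙 (Ramified? d q) * quot X q)
    s₃ = ∑ (2 ^ z) (λ q → 𝟙 (LargeInert? q) * quot X q)
    r  = ∑ (2 ^ z) (λ q → 𝟙 (LargeRamified? q) * quot X q)
    c  = ∑ (23 + 2 * t) (λ i → Dyadic.block d X (z + i))

    -- `twisted-lower` needs `1024 κ q² ≤ d`, which excludes ramified primes near `√d`, so those
    -- from `2 ^ w` on are given up. There are at most 9 of them, each of weight at most
    -- `X / 2 ^ w`, and `9 * 512 ≤ 2 ^ 13 ≤ 2 ^ w`.
    r≤κ : r ≤ κ
    r≤κ = *-cancelˡ-≤ (2 ^ w) {{m^n≢0 2 w}} (begin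
      2 ^ w * r  ≤⟨ ∑-quot≤ LargeRamified? (2 ^ z) (2 ^ w) X (λ q (_ , large) → large) ⟩
      X * ∑ (2 ^ z) (λ q → 𝟙 (LargeRamified? q))  ≤⟨ *-monoʳ-≤ X (few-large-primes LargeRamified? (2 ^ z) d (>-nonZero⁻¹ d) ≤-refl (λ q ((pq , _ , q∣d) , large) → pq , large , q∣d)) ⟩
      512 * κ * 9  ≡⟨ lem κ ⟩
      4608 * κ  ≤⟨ *-monoˡ-≤ κ (≤-trans (≤ᵇ⇒≤ 4608 8192 _) (^-monoʳ-≤ 2 13≤w)) ⟩
      2 ^ w * κ  ∎)
      where lem : ∀ κ → 512 * κ * 9 ≡ 4608 * κ
            lem = solve-∀

    -- Each block carries at most `2 X / z`, and the number of blocks is linear in `t`, which is at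
    -- most `b / 64`.
    c≤80κ : c ≤ 80 * κ
    c≤80κ = *-cancelˡ-≤ z {{>-nonZero 0<z}} (begin
      z * c  ≤⟨ Dyadic.blocks≤ d X z (23 + 2 * t) ⟩
      (23 + 2 * t) * (2 * X)  ≡⟨ lem₁ κ (23 + 2 * t) ⟩
      -- Given `64 t ≤ b`, the inequality `64 (23 + 2 t) ≤ 5 z` follows from `187 t ≥ 1537`; this is
      -- where `t ≥ 9` comes from.
      16 * κ * (64 * (23 + 2 * t))  ≤⟨ *-monoʳ-≤ (16 * κ) (≤-by {l = 5 * (64 * t) + 187 * 9} {r = 5 * (z + (13 + t)) + 187 * t} 146
                                              (+-mono-≤ (*-monoʳ-≤ 5 (≤-trans 64t≤b (≤-reflexive (sym z+13+t)))) (*-monoʳ-≤ 187 9≤t)) (lem₂ z t)) ⟩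
      16 * κ * (5 * z)  ≡⟨ lem₃ z κ ⟩
      z * (80 * κ)  ∎)
      where
      lem₁ : ∀ κ y → y * (2 * (512 * κ)) ≡ 16 * κ * (64 * y)
      lem₁ = solve-∀
      lem₂ : ∀ z t → 64 * (23 + 2 * t) + (5 * (z + (13 + t)) + 187 * t) + 146 ≡ 5 * z + (5 * (64 * t) + 187 * 9)
      lem₂ = solve-∀
      lem₃ : ∀ z κ → 16 * κ * (5 * z) ≡ z * (80 * κ)
      lem₃ = solve-∀

    decomposition : ∑ X (Dyadic.g d X) ≤ s₁ + s₃ + (s₂ + r) + c
    decomposition = begin
      ∑ X g  ≡⟨ cong (λ k → ∑ k g) (sym X≡) ⟩
      ∑ (2 ^ (z + (23 + 2 * t))) g  ≤⟨ Dyadic.∑g-telescope d X z (23 + 2 * t) 0<z ⟩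
      ∑ (2 ^ z) g + c  ≤⟨ +-monoˡ-≤ c (∑-mono (2 ^ z) (λ q _ → at q)) ⟩
      ∑ (2 ^ z) (λ q → i q + j q) + c  ≡⟨ cong (_+ c) (∑-+ (2 ^ z) i j) ⟩
      ∑ (2 ^ z) i + ∑ (2 ^ z) j + c  ≤⟨ +-monoˡ-≤ c (+-mono-≤
          (∑-tail i (λ q → 𝟙 (LargeInert? q) * quot X q) Y≤Z (λ q Y≤q → *-monoˡ-≤ (quot X q) (𝟙-mono (Inert? d q) (LargeInert? q) (_, Y≤q))))
          (∑-tail j (λ q → 𝟙 (LargeRamified? q) * quot X q) Y≤Z (λ q Y≤q → *-monoˡ-≤ (quot X q) (𝟙-mono (Ramified? d q) (LargeRamified? q) (_, Y≤q))))) ⟩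
      s₁ + s₃ + (s₂ + r) + c  ∎
      where
      g = Dyadic.g d X
      i j : ℕ → ℕ
      i q = 𝟙 (Inert? d q) * quot X q
      j q = 𝟙 (Ramified? d q) * quot X q
      at : ∀ q → g q ≤ i q + j q
      at q = ≤-trans (*-monoˡ-≤ (quot X q) (𝟙-elim (Bad? d q) λ where
          (pq , q≢2 , inj₁ q∣d)   → ≤-trans (≤-reflexive (sym (𝟙-yes (Ramified? d q) (pq , q≢2 , q∣d)))) (m≤n+m _ (𝟙 (Inert? d q)))
          (pq , q≢2 , inj₂ inert) → ≤-trans (≤-reflexive (sym (𝟙-yes (Inert? d q) (pq , q≢2 , inert)))) (m≤m+n _ _)))
        (≤-reflexive (*-distribʳ-+ (quot X q) (𝟙 (Inert? d q)) (𝟙 (Ramified? d q))))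

    detect-exact : ∀ q x → Inert d q → Exact q x → 1 ≤ u x
    detect-exact q x s e = ≤-reflexive (sym (𝟙-yes (dec (residue x)) (exact⇒InD {q} {x} s e)))

    exact-lower-Z : ∀ q → q < 2 ^ z → Inert d q → d ≤ 32 * (q * ∑ d (λ x → 𝟙 (Exact? q x)))
    exact-lower-Z q q< s = exact-lower {q} s (Z≤ q q<)

    range : ∀ {q} → q < 2 ^ z → Prime q → 0 < q × q ≤ X
    range q< pq = <-trans z<s (prime>1 pq) , ≤-trans (<⇒≤ q<) Z≤X

    small-inert : X ≤ 256 * s₁ → d ≤ 32768 * #InD d dec
    small-inert = Sieve.Pairs.union (Inert? d) Exact? d X (2 ^ w) u
      (λ q q< (pq , _) → range (<-≤-trans q< Y≤Z) pq)
      (λ q q< → exact-lower-Z q (<-≤-trans q< Y≤Z))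
      (λ q x _ → detect-exact q x)
      (λ q p q< p<q sq sp → exact-pair {q} {p} sq sp (λ q≡p → <⇒≢ p<q (sym q≡p)) (Y²≤ q p q< (<-trans p<q q<)))
      s₁ (#InD d dec) refl refl

    small-ramified : X ≤ 256 * s₂ → d ≤ 32768 * #InD d dec
    small-ramified = Sieve.Pairs.union (Ramified? d) Twisted? d X (2 ^ w) u
      (λ q q< (pq , _) → range (<-≤-trans q< Y≤Z) pq)
      (λ q q< s → twisted-lower-ramified d κ d⊥2 G≤ 272κ≤d sf (λ {e} → G∣ {e}) q s
        (≤-trans (*-monoˡ-≤ q (*-monoˡ-≤ κ (≤ᵇ⇒≤ 272 3072 _))) (Z≤ q (<-≤-trans q< Y≤Z))) (Y²≤ q q q< q<))
      (λ q x _ s e → ≤-reflexive (sym (𝟙-yes (dec (residue x)) (twisted⇒InD {q} {x} sf s e))))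
      (λ q p q< p<q sq sp → twisted-pair {q} {p} sq sp (λ q≡p → <⇒≢ p<q (sym q≡p)))
      s₂ (#InD d dec) refl refl

    large-inert : X ≤ 256 * s₃ → d ≤ 8192 * (9 * #InD d dec)
    large-inert = Sieve.Multiplicity.sparse-union LargeInert? Exact? d X (2 ^ z) u
      (λ q q< ((pq , _) , _) → range q< pq)
      (λ q q< (s , _) → exact-lower-Z q q< s)
      (λ q x _ (s , _) → detect-exact q x s)
      9 multiplicity s₃ (#InD d dec) refl refl
      where
      multiplicity : ∀ x → x < d → ∑ (2 ^ z) (λ q → 𝟙 (LargeInert? q) * 𝟙 (Exact? q x)) ≤ 9
      multiplicity x _ = case residue x ≟ 0 of λ where
          -- The residue 0 has every prime as a divisor, but it is never exactly divisible by one.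
          (yes r≡0) → ≤-trans (≤-reflexive (∑-zero (2 ^ z) (λ q _ → trans (𝟙-× (LargeInert? q) (Exact? q x))
              (𝟙-no (LargeInert? q ×-dec Exact? q x) (λ (_ , _ , q²∤r , _) → q²∤r (subst (q * q ∣_) (sym r≡0) ((q * q) ∣0))))))) z≤n
          (no r≢0) → ≤-trans (≤-reflexive (∑-cong (2 ^ z) (λ q _ → 𝟙-× (LargeInert? q) (Exact? q x))))
              (few-large-primes (λ q → LargeInert? q ×-dec Exact? q x) (2 ^ z) (residue x) (n≢0⇒n>0 r≢0) (<⇒≤ (m%n<n (x * x) d))
                (λ q (((pq , _) , large) , q∣r , _) → pq , large , q∣r))

    conclude : X ≤ 256 * s₁ ⊎ X ≤ 256 * s₂ ⊎ X ≤ 256 * s₃ → d ≤ 131072 * #InD d dec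
    conclude (inj₁ h₁)        = ≤-raise 32768 131072 d (#InD d dec) (≤ᵇ⇒≤ 32768 131072 _) (small-inert h₁)
    conclude (inj₂ (inj₁ h₂)) = ≤-raise 32768 131072 d (#InD d dec) (≤ᵇ⇒≤ 32768 131072 _) (small-ramified h₂)
    conclude (inj₂ (inj₂ h₃)) = ≤-raise-assoc 8192 9 131072 d (#InD d dec) (≤ᵇ⇒≤ 73728 131072 _) (large-inert h₃)

  many-in-D-3mod4 : d ≤ 131072 * #InD d dec
  many-in-D-3mod4 = conclude (one-of-three κ X (∑ X (Dyadic.g d X)) c s₁ s₂ s₃ r ≤-refl (bad-prime-supply d h κ X d≡ refl h-odd G≤ 272κ≤d) c≤80κ r≤κ decomposition)

-- Combination of the residue classes of d

0<1/ : ∀ c → ℚ.0ℚ ℚ.< (ℤ.+ 1 ℚ./ suc c)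
0<1/ c = ℚₚ.toℚᵘ-cancel-< (ℚᵘₚ.<-respʳ-≃ (ℚᵘₚ.≃-sym (ℚₚ.toℚᵘ-fromℚᵘ (ℚᵘ.mkℚᵘ (ℤ.+ 1) c))) (ℚᵘ.*<* (ℤ.+<+ (s≤s z≤n))))

module _ (K : ℕ) (K≥ : 131072 ≤ K) (d b t : ℕ) .{{_ : NonZero d}} (lo : 2 ^ (2 * b) ≤ d) (hi : d < 2 ^ (2 * suc b))
  (9≤t : 9 ≤ t) (64t≤b : 64 * t ≤ b) (p≤t : primes (suc d) d ≤ t) (sf : SquareFree d) (dec : Decidable (InD d)) where

  many-in-D-odd : ∀ h → d ≡ suc (2 * h) → Dec (2 ∣ h) → d ≤ K * #InD d dec
  many-in-D-odd h d≡ (no h-odd) = ≤-raise 131072 K d (#InD d dec) K≥ (many-in-D-3mod4 d h b t d≡ (odd⇒≈1 h-odd) lo hi 9≤t 64t≤b p≤t sf dec)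
  many-in-D-odd h d≡ (yes (divides k h≡)) = ≤-raise 131072 K d (#InD d dec) K≥ (many-in-D-1mod4 d b t lo hi 9≤t 64t≤b p≤t sf dec
      (≈-trans (≈-reflexive (trans d≡ (trans (cong (λ z → suc (2 * z)) h≡) (lem k)))) (≈-+m 1 k)))
    where
    lem : ∀ k → suc (2 * (k * 2)) ≡ 1 + k * 4
    lem = solve-∀

  many-in-D : Dec (2 ∣ d) → d ≤ K * #InD d dec
  many-in-D (yes (divides e d≡)) = ≤-raise 131072 K d (#InD d dec) K≥ (many-in-D-even d b t lo hi 9≤t 64t≤b p≤t sf dec e (trans d≡ (*-comm e 2))
    (λ 2∣e → sf 2 prime[2] (subst (4 ∣_) (sym d≡) (*-monoˡ-∣ 2 2∣e))))
  many-in-D (no d-odd) = let h , d≡ = odd⇒suc-double d d-odd in many-in-D-odd h d≡ (2 ∣? h)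

-- The threshold is about 2^(2^522) and must never be evaluated.
abstract
  sufficiently-large : ∃ λ N → ∀ d → N ≤ d → ∃₂ λ b t → 2 ^ (2 * b) ≤ d × d < 2 ^ (2 * suc b) × 9 ≤ t × 64 * t ≤ b × primes (suc d) d ≤ t
  sufficiently-large = ∃-sufficiently-large (2 ^ 512) (primes-bound 512)

theorem4p3 : ∃ λ (C : ℚ.ℚ) → (ℚ.0ℚ ℚ.< C) × (∃ λ (N : ℕ) → ∀ (d : ℕ) → N ≤ d → 0 < d → SquareFree d →
    (dec : Decidable (InD d)) → C ℚ.* (ℤ.+ d ℚ./ 1) ℚ.≤ (ℤ.+ SumD d dec ℚ./ 1))
-- `2 ^ 17` is a power of two above the constants of all the cases; the largest of them is
-- `8192 * 9 = 73728`, from the large inert primes.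
theorem4p3 = (ℤ.+ 1 ℚ./ suc 131071) , 0<1/ 131071 , proj₁ sufficiently-large , lower-bound 131071 (≤ᵇ⇒≤ 131072 131072 _)
  where
  lower-bound : ∀ c → 131072 ≤ suc c → ∀ d → proj₁ sufficiently-large ≤ d → 0 < d → SquareFree d → (dec : Decidable (InD d)) →
    (ℤ.+ 1 ℚ./ suc c) ℚ.* (ℤ.+ d ℚ./ 1) ℚ.≤ (ℤ.+ SumD d dec ℚ./ 1)
  lower-bound c c≥ d N≤d 0<d sf dec =
    let b , t , lo , hi , 9≤t , 64t≤b , p≤t = proj₂ sufficiently-large d N≤d in
    scaled-≤ c d (SumD d dec) (≤-trans (many-in-D (suc c) c≥ d b t {{>-nonZero 0<d}} lo hi 9≤t 64t≤b p≤t sf dec (2 ∣? d))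
      (*-monoʳ-≤ (suc c) (SumD≥ d {{>-nonZero 0<d}} sf dec)))
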